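{- Let $n>2$ be odd. Let $\zeta$ be a primitive $n$-th root of unity in $\bar{\mathbb{Q}}$. Let $c$ be a positive rational number such that $f=x^n-c$ is irreducible over $\mathbb{Q}$, and let $a=c^{1/n}$ be the positive real root of $f$. (1) A set $C=\{a\zeta^{b_i}\}_{i=1}^m$ (with $b_1,\dots,b_m$ integers) is a generating set for $f$ over $\mathbb{Q}$ if and only if $$\gcd(n,\,b_2-b_1,\,b_3-b_1,\,\dots,\,b_m-b_1)=1.$$ (2) For $0\le k<l\le n-1$, the set $B=\{a\zeta^k,a\zeta^l\}$ is a shortest minimal generating set for $f$ over $\mathbb{Q}$ if and only if $\gcd(l-k,n)=1$. Thus there are $n\phi(n)/2$ many shortest minimal generating sets for $f$ over $\mathbb{Q}$. (3) Suppose that for some $m>2$, a set $C=\{a\zeta^{b_i}\}_{i=1}^m$ of $m$ distinct roots is a minimal generating set for $f$ over $\mathbb{Q}$. Then $m\le\omega(n)$, where $\omega(n)$ is the number of distinct prime divisors of $n$. (4) If for some $m\geq 2$ we have $n=a_1a_2\cdots a_m$ where the $a_i$ are pairwise coprime integers greater than $1$, then $B=\{a\zeta^{n/a_i}\}_{i=1}^m$ is a minimal generating set for $f$ over $\mathbb{Q}$.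
   Context: $\phi$ is Euler's totient function. Let $\mathbb{Q}_f$ be the splitting field of $f$ over $\mathbb{Q}$. A set $C$ of roots of $f$ is a generating set for $f$ over $\mathbb{Q}$ if $\mathbb{Q}(C)=\mathbb{Q}_f$; it is a minimal generating set if moreover $\mathbb{Q}(A)\neq\mathbb{Q}_f$ for every $A\subsetneq C$; it is a shortest minimal generating set if it is a minimal generating set of least possible cardinality. -}

module Defs where

open import Level using (Level; _⊔_; suc)
open import Algebra.Apartness.Bundles using (HeytingField; HeytingCommutativeRing)
open import Algebra.Bundles using (RawRing; CommutativeRing)
import Algebra.Definitions.RawSemiring as RawSemiringDefs
open import Algebra.Morphism.Structures using (module RingMorphisms)
open import Data.Fin.Base using (Fin)
import Data.Fin.Base as Fin
open import Data.Integer.Base using (ℤ; +_; -[1+_])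
import Data.Integer.Base as ℤ
import Data.Integer.GCD as ℤ
open import Data.List.Base using (List; []; _∷_; map; foldr; filter; length; upTo)
open import Data.Nat.Base using (ℕ; _<_; _≤_)
import Data.Nat.Base as ℕ
open import Data.Nat.Divisibility using (_∣?_)
open import Data.Nat.GCD using (gcd)
open import Data.Nat.Primality using (prime?)
open import Data.Nat.Properties using (_≟_)
open import Data.Product.Base using (Σ-syntax; ∃; ∃-syntax; _×_; proj₁)
open import Data.Rational.Base using (ℚ)
import Data.Rational.Base as ℚ
open import Data.Sum.Base using (_⊎_)
import Data.Vec.Functional as Vector
open import Data.Vec.Functional using (Vector)
open import Function.Definitions using (Injective)
open import Relation.Binary.Core using (Rel)
open import Relation.Binary.Definitions using (Decidable; _Respects_)
open import Relation.Binary.PropositionalEquality.Core using (_≡_)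
open import Relation.Nullary using (¬_; yes; no; _×-dec_)
open import Relation.Unary using (Pred; _∈_; _⊆_; _≐_; _⊂_)

------------------------------------------------------------------------
-- Arithmetic

φ : ℕ → ℕ
φ n = length (filter (λ k → gcd k n ≟ 1) (map ℕ.suc (upTo n)))

ω : ℕ → ℕ
ω n = length (filter (λ p → prime? p ×-dec (p ∣? n)) (upTo (ℕ.suc n)))

-- gcd(n, b₂ - b₁, …, bₘ - b₁), for a family b of m ≥ 1 integers whose
-- first member b₁ is  b zero.
gcdDifferences : ℕ → ∀ {m} → Vector ℤ (ℕ.suc m) → ℤ
gcdDifferences n b =
  Vector.foldr ℤ.gcd (+ n) (λ i → b (Fin.suc i) ℤ.- b Fin.zero)

∏ : ∀ {m} → Vector ℕ m → ℕ
∏ = Vector.foldr ℕ._*_ 1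

------------------------------------------------------------------------
-- P has exactly n elements, counted up to _≈_.

HasCardinality : ∀ {a ℓ p} {A : Set a} → Rel A ℓ → Pred A p → ℕ → Set (a ⊔ ℓ ⊔ p)
HasCardinality {A = A} _≈_ P n =
  Σ[ e ∈ (Fin n → A) ]
    (∀ i → e i ∈ P) ×
    Injective _≡_ _≈_ e ×
    (∀ {x} → x ∈ P → ∃[ i ] x ≈ e i)

------------------------------------------------------------------------
-- Univariate polynomials: coefficient lists, constant term first, where
-- trailing zeros are ignored by _≋_.

module Polynomial {c ℓ} (R : RawRing c ℓ) where

  open RawRing R

  Poly : Set c
  Poly = List Carrier

  coeff : Poly → ℕ → Carrier
  coeff []      _         = 0#
  coeff (a ∷ p) ℕ.zero    = a
  coeff (a ∷ p) (ℕ.suc k) = coeff p k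

  _≋_ : Rel Poly ℓ
  p ≋ q = ∀ k → coeff p k ≈ coeff q k

  _⊕_ : Poly → Poly → Poly
  []      ⊕ q       = q
  (a ∷ p) ⊕ []      = a ∷ p
  (a ∷ p) ⊕ (b ∷ q) = (a + b) ∷ (p ⊕ q)

  _⊗_ : Poly → Poly → Poly
  []      ⊗ q = []
  (a ∷ p) ⊗ q = map (a *_) q ⊕ (0# ∷ (p ⊗ q))

  const : Carrier → Poly
  const a = a ∷ []

  X : Poly
  X = 0# ∷ 1# ∷ []

  rawRing : RawRing c ℓ
  rawRing = record
    { Carrier = Poly
    ; _≈_     = _≋_
    ; _+_     = _⊕_
    ; _*_     = _⊗_
    ; -_      = map (-_)
    ; 0#      = []
    ; 1#      = const 1#
    }

  open RawSemiringDefs (RawRing.rawSemiring rawRing) public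
    using (_^_; Irreducible)

  eval : Poly → Carrier → Carrier
  eval p x = foldr (λ a v → a + x * v) 0# p

module ℚ[X] = Polynomial ℚ.+-*-rawRing

-- X ^ n - c
binomial : ℕ → ℚ → ℚ[X].Poly
binomial n c = (X ^ n) ⊕ const (ℚ.- c)
  where open ℚ[X]

------------------------------------------------------------------------
-- An algebraic closure of ℚ together with its real numbers.
--
-- The field is discrete (decidable apartness).  The real elements are
-- given by their positive cone: they form an ordered subfield R such that
-- the whole field is R(i).  As the field is algebraically closed, R is real
-- closed (Artin–Schreier), and as the field is algebraic over ℚ, the pair
-- is isomorphic to (ℚ̄ , ℚ̄ ∩ ℝ) with its usual order, for ℚ̄ ⊂ ℂ.

record AlgebraicClosureOfℚ c ℓ₁ ℓ₂ p : Set (suc (c ⊔ ℓ₁ ⊔ ℓ₂ ⊔ p)) where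
  field
    heytingField : HeytingField c ℓ₁ ℓ₂

  open HeytingField heytingField public
    using (Carrier; _≈_; _#_; _+_; _*_; -_; _-_; 0#; 1#; #⇒invertible)

  open HeytingCommutativeRing
    (HeytingField.heytingCommutativeRing heytingField) public
    using (commutativeRing)

  rawRing : RawRing c ℓ₁
  rawRing = CommutativeRing.rawRing commutativeRing

  open RawSemiringDefs (RawRing.rawSemiring rawRing) public using (_^_)

  module K[X] = Polynomial rawRing

  field
    _#?_ : Decidable _#_

    ι     : ℚ → Carrier
    ι-hom : RingMorphisms.IsRingHomomorphism ℚ.+-*-rawRing rawRing ι

    algebraic : ∀ x → ∃[ q ]
      ¬ (q ℚ[X].≋ []) × K[X].eval (map ι q) x ≈ 0#

    algebraicallyClosed : ∀ q → (∃[ k ] K[X].coeff q (ℕ.suc k) # 0#) →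
      ∃[ x ] K[X].eval q x ≈ 0#

    Positive : Pred Carrier p

  Real : Pred Carrier (ℓ₁ ⊔ p)
  Real x = Positive x ⊎ x ≈ 0# ⊎ Positive (- x)

  field
    positive-resp : Positive Respects _≈_
    positive-≉0   : ∀ {x} → Positive x → ¬ (x ≈ 0#)
    positive-+    : ∀ {x y} → Positive x → Positive y → Positive (x + y)
    positive-*    : ∀ {x y} → Positive x → Positive y → Positive (x * y)
    real-+        : ∀ {x y} → Real x → Real y → Real (x + y)
    real-inverse  : ∀ {x y} → Real x → x * y ≈ 1# → Real y

    i           : Carrier
    i²≈-1       : i * i ≈ - 1#
    real+i*real : ∀ z → ∃[ x ] ∃[ y ] Real x × Real y × z ≈ x + i * y

------------------------------------------------------------------------

module _ {c ℓ₁ ℓ₂ p} (ℚ̄ : AlgebraicClosureOfℚ c ℓ₁ ℓ₂ p) where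

  open AlgebraicClosureOfℚ ℚ̄

  -- Totalised by 0⁻¹ = 0.
  inverse : Carrier → Carrier
  inverse x with x #? 0#
  ... | yes x#0 = proj₁ (#⇒invertible x#0)
  ... | no  _   = 0#

  power : Carrier → ℤ → Carrier
  power x (+ k)    = x ^ k
  power x -[1+ k ] = inverse x ^ ℕ.suc k

  IsPrimitiveRootOfUnity : ℕ → Carrier → Set ℓ₁
  IsPrimitiveRootOfUnity n ζ =
    ζ ^ n ≈ 1# × (∀ k → 0 < k → k < n → ¬ (ζ ^ k ≈ 1#))

  Root : ℚ[X].Poly → Pred Carrier ℓ₁
  Root f x = K[X].eval (map ι f) x ≈ 0#

  -- The subfield ℚ(S): the least subset containing ℚ and S and closed
  -- under the field operations.
  data Adjoin {s} (S : Pred Carrier s) : Pred Carrier (c ⊔ ℓ₁ ⊔ s) where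
    generator : ∀ {x} → x ∈ S → x ∈ Adjoin S
    rational  : ∀ q → ι q ∈ Adjoin S
    add       : ∀ {x y} → x ∈ Adjoin S → y ∈ Adjoin S → x + y ∈ Adjoin S
    negate    : ∀ {x} → x ∈ Adjoin S → - x ∈ Adjoin S
    multiply  : ∀ {x y} → x ∈ Adjoin S → y ∈ Adjoin S → x * y ∈ Adjoin S
    invert    : ∀ {x y} → x ∈ Adjoin S → x * y ≈ 1# → y ∈ Adjoin S
    respect   : ∀ {x y} → x ≈ y → x ∈ Adjoin S → y ∈ Adjoin S

  SplittingField : ℚ[X].Poly → Pred Carrier (c ⊔ ℓ₁)
  SplittingField f = Adjoin (Root f)

  -- Without the condition `respects`, a proper subset could omit some
  -- representatives of an element and still generate the same field.
  record SubsetOf : Set (c ⊔ suc ℓ₁) where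
    field
      member   : Pred Carrier ℓ₁
      respects : member Respects _≈_

  open SubsetOf public

  _≐ₛ_ : Rel SubsetOf (c ⊔ ℓ₁)
  C ≐ₛ D = member C ≐ member D

  -- The set { x i | i } of values of a family.
  range : ∀ {m} → Vector Carrier m → SubsetOf
  range x = record
    { member   = λ y → ∃[ i ] y ≈ x i
    ; respects = λ y≈z (i , y≈xᵢ) → i , trans (sym y≈z) y≈xᵢ
    }
    where
    open CommutativeRing commutativeRing using (sym; trans)
    open import Data.Product.Base using (_,_)

  IsGeneratingSet : ℚ[X].Poly → Pred SubsetOf (c ⊔ ℓ₁)
  IsGeneratingSet f C =
    member C ⊆ Root f × Adjoin (member C) ≐ SplittingField f

  IsMinimalGeneratingSet : ℚ[X].Poly → Pred SubsetOf (c ⊔ suc ℓ₁)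
  IsMinimalGeneratingSet f C =
    IsGeneratingSet f C ×
    (∀ (A : SubsetOf) → member A ⊂ member C →
       ¬ (Adjoin (member A) ≐ SplittingField f))

  IsShortestMinimalGeneratingSet : ℚ[X].Poly → Pred SubsetOf (c ⊔ suc ℓ₁)
  IsShortestMinimalGeneratingSet f C =
    IsMinimalGeneratingSet f C ×
    ∃[ m ] HasCardinality _≈_ (member C) m ×
           (∀ D k → IsMinimalGeneratingSet f D →
              HasCardinality _≈_ (member D) k → m ≤ k)

{-# OPTIONS --safe #-}

-- Let E = ℚ(ζʳ) for a prime r ∣ n.  Everything rests on the fact that, for
-- every root α = aζᵇ of Xⁿ − c, the field E(α) does not contain ζ; the rest
-- is Bézout's identity and counting.
--
-- First, 1, α, …, αⁿ⁻¹ are linearly independent over ℚ(ζ).  Otherwise the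
-- minimal polynomial of α over ℚ(ζ) has some degree 0 < d < n, and its
-- constant term is ±aᵈ times a root of unity, so that aᵈ ∈ ℚ(ζ).  As complex
-- conjugation acts on the roots of unity by inversion, every conjugate of aᵈ
-- is again fixed by it and has the same n-th power; n being odd, all of them
-- equal aᵈ.  So aᵈ ∈ ℚ, contradicting the irreducibility of Xⁿ − c.
--
-- Hence ζ ∈ E(α) gives ζ ∈ E, by comparing coefficients of powers of α.
-- Dedekind's argument (reduction modulo primes not dividing n) shows that ζ
-- and ζᵗ are conjugate whenever t is prime to n.  As r is odd, some such t is
-- congruent to 1 modulo n/r but not modulo n, and then ζᵗ ≠ ζ although
-- conjugation by it fixes ζʳ; so ζ ∉ E.
--
-- Neither factorisation nor linear algebra over these fields is constructively
-- available, but only negations and decidable statements are needed, so minimal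
-- polynomials are obtained under a double negation.

module Submission where

open import Defs
import Algebra.Definitions.RawMagma as RawMagma
import Algebra.Definitions.RawSemiring as RawSemiringDefs
import Algebra.Properties.CommutativeMonoid.Sum as CommutativeMonoidSum
import Algebra.Properties.CommutativeSemigroup as CommutativeSemigroupProperties
import Algebra.Properties.CommutativeSemiring.Binomial as Binomial
import Algebra.Properties.CommutativeSemiring.Exp as Exp
import Algebra.Properties.Group as GroupProperties
import Algebra.Properties.Ring as RingProperties
import Algebra.Properties.Semiring.Mult as Mult
import Algebra.Properties.Semiring.Sum as Sum
import Algebra.Solver.Ring as RingSolver
import Algebra.Solver.Ring.AlmostCommutativeRing as ACR
open import Algebra.Apartness.Bundles using (HeytingField)
open import Algebra.Bundles using (RawRing; CommutativeRing)
open import Algebra.Morphism.Structures using (module RingMorphisms)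
open import Data.Bool.Base using (true; false)
open import Data.Empty using (⊥; ⊥-elim)
open import Data.Fin.Base as Fin using (Fin; toℕ)
import Data.Fin.Properties as Fin
open import Data.Integer.Base as ℤ using (ℤ; +_; -[1+_]; 1ℤ)
import Data.Integer.DivMod as ℤ
open import Data.Integer.Divisibility.Signed as ℤ∣ using (∣ᵤ⇒∣; ∣⇒∣ᵤ) renaming (_∣_ to _∣ℤ_; divides to dividesℤ)
import Data.Integer.GCD as ℤ
import Data.Integer.Properties as ℤ
import Data.Integer.Tactic.RingSolver as ℤSolver
open import Data.List.Membership.Propositional using () renaming (_∈_ to _∈ₗ_)
open import Data.List.Membership.Propositional.Properties
  using (∈-filter⁺; ∈-filter⁻; ∈-cartesianProduct⁺; ∈-cartesianProduct⁻; ∈-upTo⁺; ∈-upTo⁻; ∈-map⁺; ∈-map⁻; ∈-lookup)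
open import Data.List.Properties using (length-map; length-++; length-upTo; foldr-map)
import Data.List.Relation.Unary.Any as Any
open import Data.List.Relation.Unary.Any.Properties using (lookup-index)
open import Data.List.Relation.Unary.Unique.Propositional using (Unique)
import Data.List.Relation.Unary.Unique.Propositional.Properties as Unique
open import Data.Maybe.Base using (Maybe; just; nothing)
open import Data.Nat.Base as ℕ using (ℕ; zero; suc; z≤n; s≤s)
import Data.Nat.Combinatorics as ℕ
open import Data.Nat.Combinatorics using (nCn≡1; nCk≡n!/k![n-k]!; k![n∸k]!∣n!)
open import Data.Nat.Coprimality using (Coprime)
open import Data.Nat.DivMod using (m/n*n≡m; m*n/n≡m)
open import Data.Nat.Divisibility
  using (_∣_; _∤_; _∣?_; divides; _∣0; 0∣⇒≡0; ∣⇒≤; ∣1⇒≡1; n∣m*n; m∣m*n; ∣-refl; ∣-trans; ∣m∣n⇒∣m+n; ∣m+n∣m⇒∣n)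
open import Data.Nat.GCD using (gcd; gcd-greatest; gcd[m,n]∣m; gcd[m,n]∣n; gcd-GCD; module Bézout)
open import Data.Nat.Induction using (<-wellFounded)
open import Data.Nat.ListAction using (product)
open import Data.Nat.ListAction.Properties using (∈⇒∣product)
open import Data.Nat.Primality using (Prime; prime?; euclidsLemma; prime⇒nonTrivial; prime⇒nonZero; prime⇒irreducible)
open import Data.Nat.Primality.Factorisation using (PrimeFactorisation; factorise)
import Data.Nat.Properties as ℕ
open import Data.Product.Base using (∃-syntax; _×_; _,_; proj₁; proj₂)
open import Data.Rational.Base as ℚ using (ℚ; 0ℚ; 1ℚ)
import Data.Rational.Properties as ℚ
import Data.Rational.Unnormalised.Base as ℚᵘ
import Data.Rational.Unnormalised.Properties as ℚᵘ
open import Data.Sum.Base using (_⊎_; inj₁; inj₂; [_,_]′)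
import Data.Vec.Functional as Vector
open import Data.Vec.Functional using (Vector; removeAt)
open import Function.Base using (_∘_; _$_; id)
open import Function.Bundles using (_⇔_; mk⇔; Equivalence)
open import Function.Definitions using (Injective)
open import Induction.WellFounded using (Acc; acc)
open import Level using (_⊔_)
open import Relation.Binary.Definitions using (Tri; tri<; tri≈; tri>)
open import Relation.Binary.PropositionalEquality as ≡ using (_≡_; _≢_; refl; cong; cong₂; subst)
import Relation.Binary.Reasoning.Setoid as SetoidReasoning
open import Relation.Nullary using (¬_; Dec; yes; no; contradiction; decidable-stable; does; ¬?; _×-dec_)
open import Relation.Unary using (Pred; Decidable; _∈_; _⊆_; _≐_; _⊂_)

-- No automorphism, quotient ring or residue field is formed. Conjugacy of ζ and ζᵗ means that every
-- rational polynomial vanishing at ζ also vanishes at ζᵗ; reduction modulo ℓ means divisibility by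
-- ℓ inside ℤ₍ℓ₎[ζ]. Polynomial identities are mostly checked on values, which suffices because ℚ̄
-- is infinite.
--
-- All negative claims about generation have one source: if the exponents of the roots in a set
-- agree modulo a prime r ∣ n, the set consists of products of a single root α with powers of ζʳ, so
-- it generates a subfield of E(α). A gcd other than 1 supplies such an r, and a proper subset of
-- the sets in (2) and (4) does so as well; in (3) different omitted roots must give different
-- primes.
--
-- The parity of n is a real obstacle. For X⁸ - 2, the power a⁴ = √2 already lies in ℚ(ζ), so that
-- 1, a, ..., a⁷ are dependent over ℚ(ζ); and for n = 2m with m odd, ζ lies in ℚ(ζ²) up to sign,
-- hence in it.

module Arithmetic where

  open import Data.List.Base using (List; []; _∷_; map; length; filter; cartesianProduct; upTo; lookup)
  open import Data.List.Relation.Unary.All as All using (All; []; _∷_)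
  open import Data.List.Relation.Unary.AllPairs using ([]; _∷_)

  -- Primes and counting in finite lists.

  odd-decomposition : ∀ n → ¬ (2 ∣ n) → ∃[ k ] n ≡ suc (2 ℕ.* k)
  odd-decomposition zero          odd = contradiction (2 ∣0) odd
  odd-decomposition (suc zero)    odd = 0 , refl
  odd-decomposition (suc (suc n)) odd = let k , n≡ = odd-decomposition n (odd ∘ ∣m∣n⇒∣m+n ∣-refl) in
    suc k , cong suc (≡.trans (cong suc n≡) (≡.sym (ℕ.*-suc 2 k)))

  1<prime : ∀ {r} → Prime r → 1 ℕ.< r
  1<prime {r} r-prime = ℕ.nonTrivial⇒n>1 r {{prime⇒nonTrivial r-prime}}

  prime∤1 : ∀ {r} → Prime r → r ∤ 1
  prime∤1 r-prime r∣1 = ℕ.<⇒≢ (1<prime r-prime) (≡.sym (∣1⇒≡1 r∣1))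

  prime-divisor : ∀ {g} → g ≢ 0 → g ≢ 1 → ∃[ r ] Prime r × r ∣ g
  prime-divisor {g} g≢0 g≢1 = go (factorise g {{ℕ.≢-nonZero g≢0}})
    where
    go : PrimeFactorisation g → ∃[ r ] Prime r × r ∣ g
    go record { factors = [] ; isFactorisation = g≡1 } = contradiction g≡1 g≢1
    go record { factors = r ∷ rs ; isFactorisation = refl ; factorsPrime = r-prime ∷ _ } = r , r-prime , m∣m*n _

  Unique⇒lookup-injective : ∀ {a} {A : Set a} {xs : List A} → Unique xs → ∀ {i j} → lookup xs i ≡ lookup xs j → i ≡ j
  Unique⇒lookup-injective (_ ∷ _)  {Fin.zero}  {Fin.zero}  _ = refl
  Unique⇒lookup-injective (x∉ ∷ _) {Fin.zero}  {Fin.suc j} e = contradiction e (All.lookup x∉ (∈-lookup j))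
  Unique⇒lookup-injective (x∉ ∷ _) {Fin.suc i} {Fin.zero}  e = contradiction (≡.sym e) (All.lookup x∉ (∈-lookup i))
  Unique⇒lookup-injective (_ ∷ u)  {Fin.suc i} {Fin.suc j} e = cong Fin.suc (Unique⇒lookup-injective u e)

  injection⇒≤length : ∀ {a} {A : Set a} {m} {ys : List A} (f : Fin m → A) →
    (∀ {i j} → f i ≡ f j → i ≡ j) → (∀ i → f i ∈ₗ ys) → m ℕ.≤ length ys
  injection⇒≤length {ys = ys} f f-injective f∈ = Fin.injective⇒≤ {f = λ i → Any.index (f∈ i)} λ {i} {j} e →
    f-injective (≡.trans (lookup-index (f∈ i)) (≡.trans (cong (lookup ys) e) (≡.sym (lookup-index (f∈ j)))))

  Unique-injection⇒≤ : ∀ {a b} {A : Set a} {B : Set b} {xs : List A} {ys : List B} → Unique xs → (f : A → B) →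
    (∀ {x y} → x ∈ₗ xs → y ∈ₗ xs → f x ≡ f y → x ≡ y) → (∀ {x} → x ∈ₗ xs → f x ∈ₗ ys) → length xs ℕ.≤ length ys
  Unique-injection⇒≤ {xs = xs} u f f-injective f∈ = injection⇒≤length (f ∘ lookup xs)
    (λ {i} {j} e → Unique⇒lookup-injective u (f-injective (∈-lookup i) (∈-lookup j) e)) (λ i → f∈ (∈-lookup i))

  length-partition : ∀ {a p} {A : Set a} {P : Pred A p} (P? : Decidable P) xs →
    length (filter P? xs) ℕ.+ length (filter (¬? ∘ P?) xs) ≡ length xs
  length-partition P? []       = refl
  length-partition P? (x ∷ xs) with does (P? x)
  ... | true  = cong suc (length-partition P? xs)
  ... | false = ≡.trans (ℕ.+-suc _ _) (cong suc (length-partition P? xs))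

  length-cartesianProduct : ∀ {a b} {A : Set a} {B : Set b} (xs : List A) (ys : List B) →
    length (cartesianProduct xs ys) ≡ length xs ℕ.* length ys
  length-cartesianProduct []       ys = refl
  length-cartesianProduct (x ∷ xs) ys = ≡.trans (length-++ (map (x ,_) ys))
    (cong₂ ℕ._+_ (length-map (x ,_) ys) (length-cartesianProduct xs ys))

  gcd≡1 : ∀ {m n} → (∀ {d} → d ∣ m → d ∣ n → d ∣ 1) → gcd m n ≡ 1
  gcd≡1 {m} {n} common = ∣1⇒≡1 (common (gcd[m,n]∣m m n) (gcd[m,n]∣n m n))

  gcd≡1⇒common∣1 : ∀ {m n d} → gcd m n ≡ 1 → d ∣ m → d ∣ n → d ∣ 1
  gcd≡1⇒common∣1 e d∣m d∣n = subst (_ ∣_) e (gcd-greatest d∣m d∣n)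

  coprime-∸ : ∀ {n d} → d ℕ.≤ n → gcd d n ≡ 1 → gcd (n ℕ.∸ d) n ≡ 1
  coprime-∸ {n} {d} d≤n e = gcd≡1 {n ℕ.∸ d} {n} λ {c} c∣n-d c∣n →
    gcd≡1⇒common∣1 e (∣m+n∣m⇒∣n (subst (c ∣_) (≡.sym (ℕ.m∸n+n≡m d≤n)) c∣n) c∣n-d) c∣n

  -- The pairs k < l < n with gcd (l − k, n) = 1, encoded as (l − k , k).

  module CoprimePairs {n} (1<n : 1 ℕ.< n) where

    coprimes : List ℕ
    coprimes = filter (λ k → gcd k n ℕ.≟ 1) (map suc (upTo n))

    Below : Pred (ℕ × ℕ) _
    Below (d , k) = k ℕ.+ d ℕ.< n

    below? : Decidable Below
    below? (d , k) = k ℕ.+ d ℕ.<? n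

    all-pairs pairs : List (ℕ × ℕ)
    all-pairs = cartesianProduct coprimes (upTo n)
    pairs = filter below? all-pairs

    ∈coprimes⁻ : ∀ {d} → d ∈ₗ coprimes → 0 ℕ.< d × d ℕ.< n × gcd d n ≡ 1
    ∈coprimes⁻ {d} d∈ = go (∈-map⁻ suc (proj₁ filtered))
      where
      filtered : d ∈ₗ map suc (upTo n) × gcd d n ≡ 1
      filtered = ∈-filter⁻ (λ k → gcd k n ℕ.≟ 1) {xs = map suc (upTo n)} d∈
      -- `φ` counts from 1 up to n inclusive. As n > 1, the end point n is not coprime to itself, so
      -- every listed d is a possible difference l - k < n.
      d≢n : d ≢ n
      d≢n refl = ℕ.<⇒≢ 1<n (≡.sym (∣1⇒≡1 (gcd≡1⇒common∣1 (proj₂ filtered) ∣-refl ∣-refl)))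
      go : ∃[ k ] k ∈ₗ upTo n × d ≡ suc k → 0 ℕ.< d × d ℕ.< n × gcd d n ≡ 1
      go (k , k∈ , refl) = s≤s z≤n , ℕ.≤∧≢⇒< (∈-upTo⁻ k∈) d≢n , proj₂ filtered

    ∈coprimes⁺ : ∀ {d} → 0 ℕ.< d → d ℕ.< n → gcd d n ≡ 1 → d ∈ₗ coprimes
    ∈coprimes⁺ {suc d} _ d<n e = ∈-filter⁺ (λ k → gcd k n ℕ.≟ 1) (∈-map⁺ suc (∈-upTo⁺ (ℕ.<-trans (ℕ.n<1+n d) d<n))) e

    ∈all-pairs⁻ : ∀ {d k} → (d , k) ∈ₗ all-pairs → (0 ℕ.< d × d ℕ.< n × gcd d n ≡ 1) × k ℕ.< n
    ∈all-pairs⁻ dk∈ = let d∈ , k∈ = ∈-cartesianProduct⁻ coprimes (upTo n) dk∈ in ∈coprimes⁻ d∈ , ∈-upTo⁻ k∈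

    ∈pairs⁻ : ∀ {d k} → (d , k) ∈ₗ pairs → (0 ℕ.< d × d ℕ.< n × gcd d n ≡ 1) × k ℕ.+ d ℕ.< n
    ∈pairs⁻ {d} {k} dk∈ = let dk∈′ , below = ∈-filter⁻ below? {v = d , k} {xs = all-pairs} dk∈ in proj₁ (∈all-pairs⁻ dk∈′) , below

    ∈pairs⁺ : ∀ {d k} → 0 ℕ.< d → k ℕ.+ d ℕ.< n → gcd d n ≡ 1 → (d , k) ∈ₗ pairs
    ∈pairs⁺ {d} {k} 0<d k+d<n e = ∈-filter⁺ below? (∈-cartesianProduct⁺
      (∈coprimes⁺ 0<d (ℕ.≤-<-trans (ℕ.m≤n+m d k) k+d<n) e) (∈-upTo⁺ (ℕ.≤-<-trans (ℕ.m≤m+n k d) k+d<n))) k+d<n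

    all-pairs-unique : Unique all-pairs
    all-pairs-unique = Unique.cartesianProduct⁺
      (Unique.filter⁺ (λ k → gcd k n ℕ.≟ 1) (Unique.map⁺ ℕ.suc-injective (Unique.upTo⁺ n))) (Unique.upTo⁺ n)

    pairs-unique : Unique pairs
    pairs-unique = Unique.filter⁺ below? all-pairs-unique

    private
      above = filter (¬? ∘ below?) all-pairs

      ∈above⁻ : ∀ {d k} → (d , k) ∈ₗ above → ((0 ℕ.< d × d ℕ.< n × gcd d n ≡ 1) × k ℕ.< n) × n ℕ.≤ k ℕ.+ d
      ∈above⁻ {d} {k} dk∈ = let dk∈′ , not-below = ∈-filter⁻ (¬? ∘ below?) {v = d , k} {xs = all-pairs} dk∈
        in ∈all-pairs⁻ dk∈′ , ℕ.≮⇒≥ not-below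

      ∸-injective : ∀ {d d′} → d ℕ.< n → d′ ℕ.< n → n ℕ.∸ d ≡ n ℕ.∸ d′ → d ≡ d′
      ∸-injective d<n d′<n e = ℕ.∸-cancelˡ-≡ (ℕ.<⇒≤ d<n) (ℕ.<⇒≤ d′<n) e

      -- Exchanging the two ends, (d , k) ↦ (n - d , k + d modulo n), is an involution that
      -- interchanges the pairs with k + d < n and those with k + d ≥ n.
      pairs≤above : length pairs ℕ.≤ length above
      pairs≤above = Unique-injection⇒≤ pairs-unique (λ { (d , k) → n ℕ.∸ d , k ℕ.+ d }) injective image
        where
        injective : ∀ {x y} → x ∈ₗ pairs → y ∈ₗ pairs → _≡_ {A = ℕ × ℕ} (n ℕ.∸ proj₁ x , proj₂ x ℕ.+ proj₁ x) (n ℕ.∸ proj₁ y , proj₂ y ℕ.+ proj₁ y) → x ≡ y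
        injective {d , k} {d′ , k′} x∈ y∈ e = conclude (∸-injective (proj₁ (proj₂ (proj₁ (∈pairs⁻ x∈)))) (proj₁ (proj₂ (proj₁ (∈pairs⁻ y∈)))) (cong proj₁ e)) (cong proj₂ e)
          where
          conclude : d ≡ d′ → k ℕ.+ d ≡ k′ ℕ.+ d′ → (d , k) ≡ (d′ , k′)
          conclude refl e′ = cong (d ,_) (ℕ.+-cancelʳ-≡ d k k′ e′)
        image : ∀ {x} → x ∈ₗ pairs → (n ℕ.∸ proj₁ x , proj₂ x ℕ.+ proj₁ x) ∈ₗ above
        image {d , k} x∈ = let (0<d , d<n , e) , k+d<n = ∈pairs⁻ x∈ in
          ∈-filter⁺ (¬? ∘ below?) (∈-cartesianProduct⁺
            (∈coprimes⁺ (ℕ.m<n⇒0<n∸m d<n) (ℕ.∸-monoʳ-< 0<d (ℕ.<⇒≤ d<n)) (coprime-∸ (ℕ.<⇒≤ d<n) e)) (∈-upTo⁺ k+d<n))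
            (ℕ.≤⇒≯ (subst (n ℕ.≤_) (≡.sym (≡.trans (ℕ.+-assoc k d (n ℕ.∸ d)) (cong (k ℕ.+_) (ℕ.m+[n∸m]≡n (ℕ.<⇒≤ d<n))))) (ℕ.m≤n+m n k)))

      above≤pairs : length above ℕ.≤ length pairs
      above≤pairs = Unique-injection⇒≤ (Unique.filter⁺ (¬? ∘ below?) all-pairs-unique) (λ { (d , k) → n ℕ.∸ d , k ℕ.+ d ℕ.∸ n }) injective image
        where
        injective : ∀ {x y} → x ∈ₗ above → y ∈ₗ above →
          _≡_ {A = ℕ × ℕ} (n ℕ.∸ proj₁ x , proj₂ x ℕ.+ proj₁ x ℕ.∸ n) (n ℕ.∸ proj₁ y , proj₂ y ℕ.+ proj₁ y ℕ.∸ n) → x ≡ y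
        injective {d , k} {d′ , k′} x∈ y∈ e = conclude
          (∸-injective (proj₁ (proj₂ (proj₁ (proj₁ (∈above⁻ x∈))))) (proj₁ (proj₂ (proj₁ (proj₁ (∈above⁻ y∈))))) (cong proj₁ e))
          (ℕ.∸-cancelʳ-≡ (proj₂ (∈above⁻ x∈)) (proj₂ (∈above⁻ y∈)) (cong proj₂ e))
          where
          conclude : d ≡ d′ → k ℕ.+ d ≡ k′ ℕ.+ d′ → (d , k) ≡ (d′ , k′)
          conclude refl e′ = cong (d ,_) (ℕ.+-cancelʳ-≡ d k k′ e′)
        image : ∀ {x} → x ∈ₗ above → (n ℕ.∸ proj₁ x , proj₂ x ℕ.+ proj₁ x ℕ.∸ n) ∈ₗ pairs
        image {d , k} x∈ = let ((0<d , d<n , e) , k<n) , n≤k+d = ∈above⁻ x∈ in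
          ∈pairs⁺ (ℕ.m<n⇒0<n∸m d<n) (subst (ℕ._< n) (≡.sym (back k d d<n n≤k+d)) k<n) (coprime-∸ (ℕ.<⇒≤ d<n) e)
          where
          back : ∀ k d → d ℕ.< n → n ℕ.≤ k ℕ.+ d → k ℕ.+ d ℕ.∸ n ℕ.+ (n ℕ.∸ d) ≡ k
          back k d d<n n≤k+d = ≡.trans (≡.sym (ℕ.+-∸-assoc (k ℕ.+ d ℕ.∸ n) (ℕ.<⇒≤ d<n)))
            (≡.trans (cong (ℕ._∸ d) (ℕ.m∸n+n≡m n≤k+d)) (ℕ.m+n∸n≡m k d))

    -- Pairs of a coprime difference and an arbitrary start k < n number n φ(n); they fall into
    -- `pairs` and `above`, which the involution shows to be equally long.
    pairs-count : 2 ℕ.* length pairs ≡ n ℕ.* φ n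
    pairs-count = begin
      length pairs ℕ.+ (length pairs ℕ.+ 0) ≡⟨ cong (length pairs ℕ.+_) (ℕ.+-identityʳ _) ⟩
      length pairs ℕ.+ length pairs ≡⟨ cong (length pairs ℕ.+_) (ℕ.≤-antisym pairs≤above above≤pairs) ⟩
      length pairs ℕ.+ length above ≡⟨ length-partition below? all-pairs ⟩
      length all-pairs ≡⟨ length-cartesianProduct coprimes (upTo n) ⟩
      φ n ℕ.* length (upTo n) ≡⟨ cong (φ n ℕ.*_) (length-upTo n) ⟩
      φ n ℕ.* n ≡⟨ ℕ.*-comm (φ n) n ⟩
      n ℕ.* φ n ∎
      where open ≡.≡-Reasoning

  ∣∏⇒∣some : ∀ {r} → Prime r → ∀ {m} (d : Vector ℕ m) → r ∣ ∏ d → ∃[ i ] r ∣ d i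
  ∣∏⇒∣some r-prime {zero}  d r∣1 = contradiction r∣1 (prime∤1 r-prime)
  ∣∏⇒∣some r-prime {suc m} d r∣ = [ (λ r∣d₀ → Fin.zero , r∣d₀) , (λ r∣∏ → let i , r∣dᵢ = ∣∏⇒∣some r-prime (d ∘ Fin.suc) r∣∏ in Fin.suc i , r∣dᵢ) ]′
    (euclidsLemma (d Fin.zero) _ r-prime r∣)

  ∏-remove : ∀ {m} (d : Vector ℕ (suc m)) i → ∏ d ≡ d i ℕ.* ∏ (removeAt d i)
  ∏-remove d i = CommutativeMonoidSum.sum-remove ℕ.*-1-commutativeMonoid {i = i} d

  prime∣n⇒∈ : ∀ {n r} → n ≢ 0 → Prime r → r ∣ n → r ∈ₗ filter (λ p → prime? p ×-dec (p ∣? n)) (upTo (suc n))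
  prime∣n⇒∈ n≢0 r-prime r∣n = ∈-filter⁺ (λ p → prime? p ×-dec (p ∣? _)) (∈-upTo⁺ (s≤s (∣⇒≤ {{ℕ.≢-nonZero n≢0}} r∣n))) (r-prime , r∣n)

  -- Integers as rationals.

  fromℤ : ℤ → ℚ
  fromℤ z = z ℚ./ 1

  toℚᵘ-fromℤ : ∀ z → ℚ.toℚᵘ (fromℤ z) ℚᵘ.≃ ℚᵘ.mkℚᵘ z 0
  toℚᵘ-fromℤ z = ℚ.toℚᵘ-fromℚᵘ (ℚᵘ.mkℚᵘ z 0)

  fromℤ-+ : ∀ x y → fromℤ (x ℤ.+ y) ≡ fromℤ x ℚ.+ fromℤ y
  fromℤ-+ x y = ℚ.toℚᵘ-injective (begin
    ℚ.toℚᵘ (fromℤ (x ℤ.+ y)) ≈⟨ toℚᵘ-fromℤ (x ℤ.+ y) ⟩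
    ℚᵘ.mkℚᵘ (x ℤ.+ y) 0 ≈⟨ ℚᵘ.*≡* (cong (ℤ._* (+ 1)) (cong₂ ℤ._+_ (≡.sym (ℤ.*-identityʳ x)) (≡.sym (ℤ.*-identityʳ y)))) ⟩
    ℚᵘ.mkℚᵘ x 0 ℚᵘ.+ ℚᵘ.mkℚᵘ y 0 ≈⟨ ℚᵘ.+-cong (toℚᵘ-fromℤ x) (toℚᵘ-fromℤ y) ⟨
    ℚ.toℚᵘ (fromℤ x) ℚᵘ.+ ℚ.toℚᵘ (fromℤ y) ≈⟨ ℚ.toℚᵘ-homo-+ (fromℤ x) (fromℤ y) ⟨
    ℚ.toℚᵘ (fromℤ x ℚ.+ fromℤ y) ∎)
    where open ℚᵘ.≃-Reasoning

  fromℤ-* : ∀ x y → fromℤ (x ℤ.* y) ≡ fromℤ x ℚ.* fromℤ y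
  fromℤ-* x y = ℚ.toℚᵘ-injective (begin
    ℚ.toℚᵘ (fromℤ (x ℤ.* y)) ≈⟨ toℚᵘ-fromℤ (x ℤ.* y) ⟩
    ℚᵘ.mkℚᵘ x 0 ℚᵘ.* ℚᵘ.mkℚᵘ y 0 ≈⟨ ℚᵘ.*-cong (toℚᵘ-fromℤ x) (toℚᵘ-fromℤ y) ⟨
    ℚ.toℚᵘ (fromℤ x) ℚᵘ.* ℚ.toℚᵘ (fromℤ y) ≈⟨ ℚ.toℚᵘ-homo-* (fromℤ x) (fromℤ y) ⟨
    ℚ.toℚᵘ (fromℤ x ℚ.* fromℤ y) ∎)
    where open ℚᵘ.≃-Reasoning

  fromℤ-injective : ∀ {x y} → fromℤ x ≡ fromℤ y → x ≡ y
  fromℤ-injective {x} {y} eq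
    with ℚᵘ.*≡* e ← ℚᵘ.≃-trans (ℚᵘ.≃-sym (toℚᵘ-fromℤ x)) (ℚᵘ.≃-trans (ℚᵘ.≃-reflexive (cong ℚ.toℚᵘ eq)) (toℚᵘ-fromℤ y)) =
    ≡.trans (≡.sym (ℤ.*-identityʳ x)) (≡.trans e (ℤ.*-identityʳ y))

  numerator : ∀ q → q ℚ.* fromℤ (ℚ.↧ q) ≡ fromℤ (ℚ.↥ q)
  numerator q@(ℚ.mkℚ u v-1 _) = ℚ.toℚᵘ-injective (begin
    ℚ.toℚᵘ (q ℚ.* fromℤ (ℚ.↧ q)) ≈⟨ ℚ.toℚᵘ-homo-* q (fromℤ (ℚ.↧ q)) ⟩
    ℚ.toℚᵘ q ℚᵘ.* ℚ.toℚᵘ (fromℤ (ℚ.↧ q)) ≈⟨ ℚᵘ.*-cong (ℚᵘ.≃-refl {ℚ.toℚᵘ q}) (toℚᵘ-fromℤ (ℚ.↧ q)) ⟩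
    ℚ.toℚᵘ q ℚᵘ.* ℚᵘ.mkℚᵘ (ℚ.↧ q) 0 ≈⟨ ℚᵘ.*≡* (≡.trans (ℤ.*-identityʳ _) (cong (u ℤ.*_) (≡.sym (≡.trans (ℚᵘ.↧[n/d]≡d u (suc v-1 ℕ.* 1)) (cong +_ (ℕ.*-identityʳ (suc v-1))))))) ⟩
    ℚᵘ.mkℚᵘ (ℚ.↥ q) 0 ≈⟨ toℚᵘ-fromℤ (ℚ.↥ q) ⟨
    ℚ.toℚᵘ (fromℤ (ℚ.↥ q)) ∎)
    where open ℚᵘ.≃-Reasoning

  -- Binomial coefficients, units and gcds.

  prime∤! : ∀ {ℓ} → Prime ℓ → ∀ k → k ℕ.< ℓ → ℓ ∤ k ℕ.!
  prime∤! pr zero k<ℓ ℓ∣1 = prime∤1 pr ℓ∣1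
  prime∤! pr (suc k) k<ℓ ℓ∣ with euclidsLemma (suc k) (k ℕ.!) pr ℓ∣
  ... | inj₁ ℓ∣k = ℕ.<⇒≱ k<ℓ (∣⇒≤ ℓ∣k)
  ... | inj₂ ℓ∣! = prime∤! pr k (ℕ.<-trans (ℕ.n<1+n k) k<ℓ) ℓ∣!

  -- In ℓ! = C(ℓ,k) · k! · (ℓ - k)! the two factorials on the right contain only factors below ℓ.
  prime∣C : ∀ {ℓ} → Prime ℓ → ∀ {k} → 0 ℕ.< k → k ℕ.< ℓ → ℓ ∣ ℓ ℕ.C k
  prime∣C {suc ℓ-1} pr {k} 0<k k<ℓ with euclidsLemma (ℓ ℕ.C k) (k ℕ.! ℕ.* (ℓ ℕ.∸ k) ℕ.!) pr (subst (ℓ ∣_) (≡.sym eq) (m∣m*n (ℓ-1 ℕ.!)))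
    where
    ℓ = suc ℓ-1
    instance k!-nonZero = k ℕ.!* (ℓ ℕ.∸ k) !≢0
    eq : (ℓ ℕ.C k) ℕ.* (k ℕ.! ℕ.* (ℓ ℕ.∸ k) ℕ.!) ≡ ℓ ℕ.!
    eq = ≡.trans (cong (λ u → u ℕ.* (k ℕ.! ℕ.* (ℓ ℕ.∸ k) ℕ.!)) (nCk≡n!/k![n-k]! (ℕ.<⇒≤ k<ℓ))) (m/n*n≡m (k![n∸k]!∣n! (ℕ.<⇒≤ k<ℓ)))
  ... | inj₁ ok = ok
  ... | inj₂ bad with euclidsLemma (k ℕ.!) ((suc ℓ-1 ℕ.∸ k) ℕ.!) pr bad
  ...   | inj₁ b = contradiction b (prime∤! pr k k<ℓ)
  ...   | inj₂ b = contradiction b (prime∤! pr _ (ℕ.∸-monoʳ-< 0<k (ℕ.<⇒≤ k<ℓ)))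

  -- A unit congruent to 1 modulo m = n / r but not modulo n.
  unit-congruent-1 : ∀ {r m} → Prime r → r ≢ 2 → 0 ℕ.< m →
    ∃[ j ] 0 ℕ.< j × j ℕ.< r × (∀ {ℓ} → Prime ℓ → ℓ ∣ suc (j ℕ.* m) → ℓ ∤ r ℕ.* m)
  unit-congruent-1 {r} {m} r-prime r≢2 0<m = choose (r ∣? suc (1 ℕ.* m))
    where
    coprime : ∀ j → r ∤ suc (j ℕ.* m) → ∀ {ℓ} → Prime ℓ → ℓ ∣ suc (j ℕ.* m) → ℓ ∤ r ℕ.* m
    coprime j r∤ {ℓ} ℓ-prime ℓ∣t ℓ∣rm = [ ℓ∣r-absurd , ℓ∣m-absurd ]′ (euclidsLemma r m ℓ-prime ℓ∣rm)
      where
      ℓ∣m-absurd : ¬ ℓ ∣ m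
      ℓ∣m-absurd ℓ∣m = prime∤1 ℓ-prime (∣m+n∣m⇒∣n (subst (ℓ ∣_) (ℕ.+-comm 1 (j ℕ.* m)) ℓ∣t) (∣-trans ℓ∣m (n∣m*n j)))
      ℓ∣r-absurd : ¬ ℓ ∣ r
      ℓ∣r-absurd ℓ∣r = [ (λ { refl → prime∤1 ℓ-prime ∣-refl }) , (λ { refl → r∤ ℓ∣t }) ]′ (prime⇒irreducible r-prime ℓ∣r)
    choose : Dec (r ∣ suc (1 ℕ.* m)) →
      ∃[ j ] 0 ℕ.< j × j ℕ.< r × (∀ {ℓ} → Prime ℓ → ℓ ∣ suc (j ℕ.* m) → ℓ ∤ r ℕ.* m)
    -- A prime dividing both 1 + jm and rm can only be r. So j = 1 works unless r ∣ 1 + m, and then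
    -- j = 2 does: r ∣ 1 + 2m as well would give r ∣ m and r ∣ 1. The choice j = 2 needs r > 2; for
    -- r = 2 and odd m there is no such unit.
    choose (no r∤)  = 1 , s≤s z≤n , 1<prime r-prime , coprime 1 r∤
    choose (yes r∣) = 2 , s≤s z≤n , ℕ.≤∧≢⇒< (1<prime r-prime) (r≢2 ∘ ≡.sym) , coprime 2 r∤2
      where
      r∤2 : r ∤ suc (2 ℕ.* m)
      r∤2 r∣′ = prime∤1 r-prime (∣m+n∣m⇒∣n (subst (r ∣_) (≡.trans (cong suc (ℕ.+-identityʳ m)) (ℕ.+-comm 1 m)) r∣) r∣m)
        where
        r∣m : r ∣ m
        r∣m = ∣m+n∣m⇒∣n (subst (r ∣_) (cong suc (ℕ.+-comm m (1 ℕ.* m))) r∣′) r∣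

  i+[j-i]≡j : ∀ i j → i ℤ.+ (j ℤ.- i) ≡ j
  i+[j-i]≡j i j = ≡.trans (ℤ.+-comm i (j ℤ.- i)) (≡.trans (ℤ.+-assoc j (ℤ.- i) i) (≡.trans (cong (ℤ._+_ j) (ℤ.+-inverseˡ i)) (ℤ.+-identityʳ j)))

  gcdDifferences≥0 : ∀ n {m} (b : Vector ℤ (suc m)) → gcdDifferences n b ≡ + ℤ.∣ gcdDifferences n b ∣
  gcdDifferences≥0 n {zero}  b = refl
  gcdDifferences≥0 n {suc m} b = refl

  gcd-fold∣n : ∀ n {m} (v : Vector ℤ m) → ℤ.∣ Vector.foldr ℤ.gcd (+ n) v ∣ ∣ n
  gcd-fold∣n n {zero}  v = ∣-refl
  gcd-fold∣n n {suc m} v = ∣-trans (gcd[m,n]∣n ℤ.∣ v Fin.zero ∣ _) (gcd-fold∣n n (v ∘ Fin.suc))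

  gcd-fold∣entry : ∀ n {m} (v : Vector ℤ m) i → ℤ.∣ Vector.foldr ℤ.gcd (+ n) v ∣ ∣ ℤ.∣ v i ∣
  gcd-fold∣entry n v Fin.zero    = gcd[m,n]∣m ℤ.∣ v Fin.zero ∣ _
  gcd-fold∣entry n v (Fin.suc i) = ∣-trans (gcd[m,n]∣n ℤ.∣ v Fin.zero ∣ _) (gcd-fold∣entry n (v ∘ Fin.suc) i)

  ∣gcdDifferences⇒∣difference : ∀ n {m} (b : Vector ℤ (suc m)) {r} → r ∣ ℤ.∣ gcdDifferences n b ∣ → ∀ i → + r ∣ℤ b i ℤ.- b Fin.zero
  ∣gcdDifferences⇒∣difference n b r∣ Fin.zero    = subst (_ ∣ℤ_) (≡.sym (ℤ.+-inverseʳ (b Fin.zero))) (∣ᵤ⇒∣ (_ ∣0))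
  ∣gcdDifferences⇒∣difference n b r∣ (Fin.suc i) =
    ∣ᵤ⇒∣ (∣-trans r∣ (gcd-fold∣entry n (λ i → b (Fin.suc i) ℤ.- b Fin.zero) i))

  -- Turns a failed gcd condition into the obstruction used everywhere below: one prime divisor of n
  -- modulo which all exponents agree.
  gcdDifferences≢1⇒prime : ∀ {n} → n ≢ 0 → ∀ {m} (b : Vector ℤ (suc m)) → gcdDifferences n b ≢ 1ℤ →
    ∃[ r ] Prime r × r ∣ n × (∀ i → + r ∣ℤ b i ℤ.- b Fin.zero)
  gcdDifferences≢1⇒prime {n} n≢0 b g≢1 =
    let r , r-prime , r∣g = prime-divisor g≢0 (λ e → g≢1 (≡.trans (gcdDifferences≥0 n b) (cong +_ e)))
    in r , r-prime , ∣-trans r∣g g∣n , ∣gcdDifferences⇒∣difference n b r∣g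
    where
    g∣n : ℤ.∣ gcdDifferences n b ∣ ∣ n
    g∣n = gcd-fold∣n n (λ i → b (Fin.suc i) ℤ.- b Fin.zero)
    g≢0 : ℤ.∣ gcdDifferences n b ∣ ≢ 0
    g≢0 e = n≢0 (0∣⇒≡0 (subst (_∣ n) e g∣n))

  gcdDifferences-pair : ∀ n {k l} → k ℕ.≤ l → gcdDifferences n (+ k Vector.∷ + l Vector.∷ Vector.[]) ≡ + gcd (l ℕ.∸ k) n
  gcdDifferences-pair n {k} {l} k≤l = cong (λ u → + gcd u n) (cong ℤ.∣_∣ (≡.trans (ℤ.m-n≡m⊖n l k) (ℤ.⊖-≥ k≤l)))

-- Field arithmetic, polynomials and minimal polynomials in ℚ̄.

module RadicalExtensions {c ℓ₁ ℓ₂ p} (ℚ̄ : AlgebraicClosureOfℚ c ℓ₁ ℓ₂ p) where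

  open import Data.List.Base using (List; []; _∷_; map; foldr; length; lookup)
  open import Data.List.Relation.Unary.All as All using (All; []; _∷_)
  open Arithmetic

  open AlgebraicClosureOfℚ ℚ̄ public
  module CR = CommutativeRing commutativeRing
  open CR public
    using (+-cong; *-cong; +-congˡ; +-congʳ; *-congˡ; *-congʳ; -‿cong; setoid;
           +-identityˡ; +-identityʳ; *-identityˡ; *-identityʳ; zeroˡ; zeroʳ;
           *-comm; *-assoc; +-comm; +-assoc)
    renaming (refl to ≈-refl; sym to ≈-sym; trans to ≈-trans; reflexive to ≈-reflexive)
  open Exp CR.commutativeSemiring public
    using (^-congˡ; ^-cong; ^-congʳ; ^-homo-*; ^-assocʳ; ^-distrib-*)
  open SetoidReasoning setoid public
  open RingMorphisms.IsRingHomomorphism ι-hom public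
    renaming (⟦⟧-cong to ι-cong; +-homo to ι-+; *-homo to ι-*; -‿homo to ι-neg; 0#-homo to ι-0; 1#-homo to ι-1)

  opaque
    int : ℤ → Carrier
    int z = ι (fromℤ z)

    int≈ι : ∀ z → int z ≈ ι (fromℤ z)
    int≈ι z = ≈-refl

  int-+ : ∀ x y → int (x ℤ.+ y) ≈ int x + int y
  int-+ x y = begin
    int (x ℤ.+ y) ≈⟨ int≈ι _ ⟩
    ι (fromℤ (x ℤ.+ y)) ≈⟨ ι-cong (fromℤ-+ x y) ⟩
    ι (fromℤ x ℚ.+ fromℤ y) ≈⟨ ι-+ _ _ ⟩
    ι (fromℤ x) + ι (fromℤ y) ≈⟨ +-cong (int≈ι x) (int≈ι y) ⟨
    int x + int y ∎

  int-* : ∀ x y → int (x ℤ.* y) ≈ int x * int y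
  int-* x y = begin
    int (x ℤ.* y) ≈⟨ int≈ι _ ⟩
    ι (fromℤ (x ℤ.* y)) ≈⟨ ι-cong (fromℤ-* x y) ⟩
    ι (fromℤ x ℚ.* fromℤ y) ≈⟨ ι-* _ _ ⟩
    ι (fromℤ x) * ι (fromℤ y) ≈⟨ *-cong (int≈ι x) (int≈ι y) ⟨
    int x * int y ∎

  int-0 : int (+ 0) ≈ 0#
  int-0 = ≈-trans (int≈ι _) ι-0

  int-1 : int (+ 1) ≈ 1#
  int-1 = ≈-trans (int≈ι _) ι-1

  int-neg : ∀ x → int (ℤ.- x) ≈ - int x
  int-neg x = RP.+-inverseˡ-unique _ _ (≈-trans (≈-sym (int-+ (ℤ.- x) x)) (≈-trans (≈-reflexive (cong int (ℤ.+-inverseˡ x))) int-0))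
    where module RP = RingProperties CR.ring

  private
    -- Agrees with int, but the solver's constants 0 and 1 must denote 0# and 1# definitionally.
    coefficient : ℤ → Carrier
    coefficient (+ 0) = 0#
    coefficient (+ 1) = 1#
    coefficient z     = int z

    coefficient≈int : ∀ z → coefficient z ≈ int z
    coefficient≈int (+ 0)           = ≈-sym int-0
    coefficient≈int (+ 1)           = ≈-sym int-1
    coefficient≈int (+ suc (suc _)) = ≈-refl
    coefficient≈int -[1+ _ ]        = ≈-refl

    ℤ⟶K : ACR._-Raw-AlmostCommutative⟶_ ℤ.+-*-rawRing (ACR.fromCommutativeRing commutativeRing)
    ℤ⟶K = record
      { ⟦_⟧    = coefficient
      ; +-homo = λ x y → ≈-trans (coefficient≈int (x ℤ.+ y)) (≈-trans (int-+ x y)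
                   (≈-sym (+-cong (coefficient≈int x) (coefficient≈int y))))
      ; *-homo = λ x y → ≈-trans (coefficient≈int (x ℤ.* y)) (≈-trans (int-* x y)
                   (≈-sym (*-cong (coefficient≈int x) (coefficient≈int y))))
      ; -‿homo = λ x → ≈-trans (coefficient≈int (ℤ.- x)) (≈-trans (int-neg x)
                   (≈-sym (-‿cong (coefficient≈int x))))
      ; 0-homo = ≈-refl
      ; 1-homo = ≈-refl
      }

    coefficient≟ : ∀ x y → Maybe (coefficient x ≈ coefficient y)
    coefficient≟ x y with x ℤ.≟ y
    ... | yes refl = just ≈-refl
    ... | no _     = nothing

  module Solver = RingSolver ℤ.+-*-rawRing (ACR.fromCommutativeRing commutativeRing) ℤ⟶K coefficient≟
  open Solver public using (solve; _:=_; _:+_; _:*_; _:-_; :-_; _:^_; con)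

  infix 4 _≉_ _≈?_
  _≉_ : Carrier → Carrier → Set ℓ₁
  x ≉ y = ¬ (x ≈ y)

  private module HF = HeytingField heytingField

  -- Apartness is decidable and tight. Decidability of equality is what allows an equation to be
  -- concluded from a minimal polynomial that exists only under a double negation.
  _≈?_ : ∀ x y → Dec (x ≈ y)
  x ≈? y with (x - y) #? 0#
  ... | yes x-y#0 = no λ x≈y → proj₂ (HF.tight _ _) (≈-trans (+-congʳ x≈y) (CR.-‿inverseʳ y)) x-y#0
  ... | no ¬x-y#0 = yes (≈-trans (solve 2 (λ u v → u := (u :- v) :+ v) ≈-refl x y)
                          (≈-trans (+-congʳ (proj₁ (HF.tight _ _) ¬x-y#0)) (+-identityˡ y)))

  ≉0⇒# : ∀ {x} → x ≉ 0# → x # 0#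
  ≉0⇒# {x} x≉0 with x #? 0#
  ... | no ¬x#0 = contradiction (proj₁ (HF.tight x 0#) ¬x#0) x≉0
  ... | yes x#0 = x#0

  #⇒inverse : ∀ {x} (x#0 : x # 0#) → x * proj₁ (#⇒invertible x#0) ≈ 1#
  #⇒inverse {x} x#0 = ≈-trans (*-congʳ (solve 1 (λ u → u := u :- con (+ 0)) ≈-refl x)) (proj₂ (proj₂ (#⇒invertible x#0)))

  invertible : ∀ {x} → x ≉ 0# → ∃[ y ] x * y ≈ 1#
  invertible x≉0 = _ , #⇒inverse (≉0⇒# x≉0)

  -- In the zero ring 0 - 0 would be invertible, which would make 0 apart from itself.
  1≉0 : 1# ≉ 0#
  1≉0 1≈0 = HF.#-irrefl ≈-refl (HF.invertible⇒# {0#} {0#} (0# , collapse _ _ , collapse _ _))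
    where
    collapse : ∀ x y → x ≈ y
    collapse x y = begin
      x ≈⟨ *-identityʳ x ⟨
      x * 1# ≈⟨ *-congˡ 1≈0 ⟩
      x * 0# ≈⟨ zeroʳ x ⟩
      0# ≈⟨ zeroʳ y ⟨
      y * 0# ≈⟨ *-congˡ 1≈0 ⟨
      y * 1# ≈⟨ *-identityʳ y ⟩
      y ∎

  x-y≈0⇒x≈y : ∀ {x y} → x - y ≈ 0# → x ≈ y
  x-y≈0⇒x≈y {x} {y} e = ≈-trans (solve 2 (λ u v → u := (u :- v) :+ v) ≈-refl x y) (≈-trans (+-congʳ e) (+-identityˡ y))

  x≈y⇒x-y≈0 : ∀ {x y} → x ≈ y → x - y ≈ 0#
  x≈y⇒x-y≈0 {x} {y} e = ≈-trans (+-congʳ e) (CR.-‿inverseʳ y)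

  neg≈0⇒≈0 : ∀ {x} → - x ≈ 0# → x ≈ 0#
  neg≈0⇒≈0 {x} e = ≈-trans (solve 1 (λ x → x := con (+ 0) :- :- x) ≈-refl x) (x≈y⇒x-y≈0 (≈-sym e))

  neg-zero : ∀ {x} → x ≈ 0# → - x ≈ 0#
  neg-zero e = ≈-trans (-‿cong e) (solve 0 (:- con (+ 0) := con (+ 0)) ≈-refl)

  *-zero⇒zeroʳ : ∀ {x y} → x ≉ 0# → x * y ≈ 0# → y ≈ 0#
  *-zero⇒zeroʳ {x} {y} x≉0 xy≈0 with x⁻¹ , xx⁻¹≈1 ← invertible x≉0 = begin
    y ≈⟨ *-identityʳ y ⟨
    y * 1# ≈⟨ *-congˡ xx⁻¹≈1 ⟨
    y * (x * x⁻¹) ≈⟨ solve 3 (λ x y z → y :* (x :* z) := x :* y :* z) ≈-refl x y x⁻¹ ⟩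
    x * y * x⁻¹ ≈⟨ *-congʳ xy≈0 ⟩
    0# * x⁻¹ ≈⟨ zeroˡ x⁻¹ ⟩
    0# ∎

  *-zero⇒zeroˡ : ∀ {x y} → y ≉ 0# → x * y ≈ 0# → x ≈ 0#
  *-zero⇒zeroˡ y≉0 xy≈0 = *-zero⇒zeroʳ y≉0 (≈-trans (*-comm _ _) xy≈0)

  *-≉0 : ∀ {x y} → x ≉ 0# → y ≉ 0# → x * y ≉ 0#
  *-≉0 x≉0 y≉0 xy≈0 = y≉0 (*-zero⇒zeroʳ x≉0 xy≈0)

  *-cancelˡ : ∀ {x y z} → x ≉ 0# → x * y ≈ x * z → y ≈ z
  *-cancelˡ {x} {y} {z} x≉0 xy≈xz = x-y≈0⇒x≈y (*-zero⇒zeroʳ x≉0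
    (≈-trans (solve 3 (λ x y z → x :* (y :- z) := x :* y :- x :* z) ≈-refl x y z) (x≈y⇒x-y≈0 xy≈xz)))

  invertible⇒≉0 : ∀ {x y} → x * y ≈ 1# → x ≉ 0#
  invertible⇒≉0 xy≈1 x≈0 = 1≉0 (≈-trans (≈-sym xy≈1) (≈-trans (*-congʳ x≈0) (zeroˡ _)))

  ^-≉0 : ∀ {x} n → x ≉ 0# → x ^ n ≉ 0#
  ^-≉0 zero    x≉0 = 1≉0
  ^-≉0 (suc n) x≉0 = *-≉0 x≉0 (^-≉0 n x≉0)

  0^n : ∀ {n} → 0 ℕ.< n → 0# ^ n ≈ 0#
  0^n (ℕ.s≤s _) = zeroˡ _

  1^n : ∀ n → 1# ^ n ≈ 1#
  1^n zero    = ≈-refl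
  1^n (suc n) = ≈-trans (*-identityˡ _) (1^n n)

  ι-≉0 : ∀ {q} → q ≢ 0ℚ → ι q ≉ 0#
  ι-≉0 {q} q≢0 = invertible⇒≉0 (≈-trans (≈-sym (ι-* q _)) (≈-trans (ι-cong (ℚ.*-inverseʳ q)) ι-1))
    where instance q-nonZero = ℚ.≢-nonZero q≢0

  ι-injective : ∀ {x y} → ι x ≈ ι y → x ≡ y
  ι-injective {x} {y} e with (x ℚ.- y) ℚ.≟ 0ℚ
  ... | yes z = ℚR.x∙y⁻¹≈ε⇒x≈y x y z
    where module ℚR = GroupProperties ℚ.+-0-group
  ... | no nz = contradiction (≈-trans (ι-+ x (ℚ.- y)) (≈-trans (+-congˡ (ι-neg y)) (x≈y⇒x-y≈0 e))) (ι-≉0 nz)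

  int-injective : ∀ {x y} → int x ≈ int y → x ≡ y
  int-injective {x} {y} e = fromℤ-injective (ι-injective (≈-trans (≈-sym (int≈ι x)) (≈-trans e (int≈ι y))))

  nat : ℕ → Carrier
  nat k = int (+ k)

  nat-suc : ∀ k → nat (suc k) ≈ 1# + nat k
  nat-suc k = ≈-trans (int-+ (+ 1) (+ k)) (+-congʳ int-1)

  nat-≉0 : ∀ {k} → k ≢ 0 → nat k ≉ 0#
  nat-≉0 k≢0 e = k≢0 (ℤ.+-injective (int-injective (≈-trans e (≈-sym int-0))))

  -- Predicates on the one ambient field, so that ℚ, ℤ₍ℓ₎, ℚ(ζ), E(α) and the real elements share
  -- the same polynomial lemmas without coercions.
  record IsSubring {s} (P : Pred Carrier s) : Set (c ⊔ ℓ₁ ⊔ s) where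
    field
      resp : ∀ {x y} → x ≈ y → P x → P y
      0∈   : P 0#
      1∈   : P 1#
      +∈   : ∀ {x y} → P x → P y → P (x + y)
      *∈   : ∀ {x y} → P x → P y → P (x * y)
      -∈   : ∀ {x} → P x → P (- x)

    -⁺∈ : ∀ {x y} → P x → P y → P (x - y)
    -⁺∈ px py = +∈ px (-∈ py)

    ^∈ : ∀ {x} n → P x → P (x ^ n)
    ^∈ zero    px = 1∈
    ^∈ (suc n) px = *∈ px (^∈ n px)

  Rational : Pred Carrier ℓ₁
  Rational x = ∃[ q ] x ≈ ι q

  Rational-isSubring : IsSubring Rational
  Rational-isSubring = record
    { resp = λ { x≈y (q , e) → q , ≈-trans (≈-sym x≈y) e }
    ; 0∈   = 0ℚ , ≈-sym ι-0
    ; 1∈   = 1ℚ , ≈-sym ι-1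
    ; +∈   = λ { (q , e) (r , e′) → q ℚ.+ r , ≈-trans (+-cong e e′) (≈-sym (ι-+ q r)) }
    ; *∈   = λ { (q , e) (r , e′) → q ℚ.* r , ≈-trans (*-cong e e′) (≈-sym (ι-* q r)) }
    ; -∈   = λ { (q , e) → ℚ.- q , ≈-trans (-‿cong e) (≈-sym (ι-neg q)) }
    }

  open K[X] public using (Poly; coeff; _⊕_; _⊗_; eval) renaming (X to 𝕏)

  module _ {r ℓ} {R : RawRing r ℓ} {h : RawRing.Carrier R → Carrier}
           (h-hom : RingMorphisms.IsRingHomomorphism R rawRing h) where
    private
      module R[X] = Polynomial R
      module h = RingMorphisms.IsRingHomomorphism h-hom

    -- Evaluation along a homomorphism covers both K[X], through the identity, and ℚ[X], through
    -- `ι`.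
    evalₕ : R[X].Poly → Carrier → Carrier
    evalₕ p x = foldr (λ a v → h a + x * v) 0# p

    evalₕ-⊕ : ∀ p q x → evalₕ (p R[X].⊕ q) x ≈ evalₕ p x + evalₕ q x
    evalₕ-⊕ []      q       x = ≈-sym (+-identityˡ _)
    evalₕ-⊕ (a ∷ p) []      x = ≈-sym (+-identityʳ _)
    evalₕ-⊕ (a ∷ p) (b ∷ q) x = ≈-trans (+-cong (h.+-homo a b) (*-congˡ (evalₕ-⊕ p q x)))
      (solve 5 (λ a b x u v → a :+ b :+ x :* (u :+ v) := a :+ x :* u :+ (b :+ x :* v)) ≈-refl _ _ _ _ _)

    evalₕ-scale : ∀ a q x → evalₕ (map (RawRing._*_ R a) q) x ≈ h a * evalₕ q x
    evalₕ-scale a []      x = ≈-sym (zeroʳ _)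
    evalₕ-scale a (b ∷ q) x = ≈-trans (+-cong (h.*-homo a b) (*-congˡ (evalₕ-scale a q x)))
      (solve 4 (λ a b x u → a :* b :+ x :* (a :* u) := a :* (b :+ x :* u)) ≈-refl _ _ _ _)

    evalₕ-⊗ : ∀ p q x → evalₕ (p R[X].⊗ q) x ≈ evalₕ p x * evalₕ q x
    evalₕ-⊗ []      q x = ≈-sym (zeroˡ _)
    evalₕ-⊗ (a ∷ p) q x = begin
      evalₕ (map (RawRing._*_ R a) q R[X].⊕ (_ ∷ (p R[X].⊗ q))) x
        ≈⟨ evalₕ-⊕ (map (RawRing._*_ R a) q) _ x ⟩
      evalₕ (map (RawRing._*_ R a) q) x + (h (RawRing.0# R) + x * evalₕ (p R[X].⊗ q) x)
        ≈⟨ +-cong (evalₕ-scale a q x) (+-cong h.0#-homo (*-congˡ (evalₕ-⊗ p q x))) ⟩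
      h a * evalₕ q x + (0# + x * (evalₕ p x * evalₕ q x))
        ≈⟨ solve 4 (λ a x u v → a :* v :+ (con (+ 0) :+ x :* (u :* v)) := (a :+ x :* u) :* v) ≈-refl _ _ _ _ ⟩
      (h a + x * evalₕ p x) * evalₕ q x ∎

  private
    id-hom : RingMorphisms.IsRingHomomorphism rawRing rawRing id
    id-hom = record
      { isSemiringHomomorphism = record
        { isNearSemiringHomomorphism = record
          { +-isMonoidHomomorphism = record
            { isMagmaHomomorphism = record
              { isRelHomomorphism = record { cong = id }
              ; homo = λ _ _ → ≈-refl }
            ; ε-homo = ≈-refl }
          ; *-homo = λ _ _ → ≈-refl }
        ; 1#-homo = ≈-refl }
      ; -‿homo = λ _ → ≈-refl }

  eval-⊕ : ∀ p q x → eval (p ⊕ q) x ≈ eval p x + eval q x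
  eval-⊕ = evalₕ-⊕ id-hom

  eval-scale : ∀ a q x → eval (map (a *_) q) x ≈ a * eval q x
  eval-scale = evalₕ-scale id-hom

  eval-⊗ : ∀ p q x → eval (p ⊗ q) x ≈ eval p x * eval q x
  eval-⊗ = evalₕ-⊗ id-hom

  eval-const : ∀ a x → eval (a ∷ []) x ≈ a
  eval-const a x = solve 2 (λ a x → a :+ x :* con (+ 0) := a) ≈-refl a x

  eval-congʳ : ∀ p {x y} → x ≈ y → eval p x ≈ eval p y
  eval-congʳ []      x≈y = ≈-refl
  eval-congʳ (a ∷ p) x≈y = +-congˡ (*-cong x≈y (eval-congʳ p x≈y))

  eval-zero : ∀ {p} → All (_≈ 0#) p → ∀ x → eval p x ≈ 0#
  eval-zero []       x = ≈-refl
  eval-zero (e ∷ es) x = ≈-trans (+-cong e (≈-trans (*-congˡ (eval-zero es x)) (zeroʳ x))) (+-identityˡ 0#)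

  -- Equality of polynomials ignores trailing zeros, so a degree cannot be read off from it. Here
  -- the list ends exactly at the leading coefficient, which ties the degree to the length.
  data Monic : ℕ → Poly → Set (c ⊔ ℓ₁) where
    lead : ∀ {u} → u ≈ 1# → Monic 0 (u ∷ [])
    _∷_  : ∀ {d p} a → Monic d p → Monic (suc d) (a ∷ p)

  Monic-length : ∀ {d p} → Monic d p → length p ≡ suc d
  Monic-length (lead _) = refl
  Monic-length (_ ∷ m)  = cong suc (Monic-length m)

  -- Polynomials over subrings of ℚ̄

  suffixValues : Carrier → Poly → Poly
  suffixValues y []        = []
  suffixValues y q@(_ ∷ r) = eval q y ∷ suffixValues y r

  -- Synthetic division by X − y.
  quotient : Carrier → Poly → Poly
  quotient y []      = []
  quotient y (_ ∷ q) = suffixValues y q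

  -- The values of the suffixes of q at y are the intermediate results of Horner's rule; they are
  -- the coefficients of (X q - y q(y)) / (X - y). For a + X q the same list is the quotient by X -
  -- y, which is why `quotient` skips the head.
  suffixValues-eval : ∀ y q x → x * eval q x - y * eval q y ≈ (x - y) * eval (suffixValues y q) x
  suffixValues-eval y []      x =
    solve 2 (λ x y → x :* con (+ 0) :- y :* con (+ 0) := (x :- y) :* con (+ 0)) ≈-refl x y
  suffixValues-eval y (a ∷ q) x = begin
    x * (a + x * eval q x) - y * (a + y * eval q y)
      ≈⟨ solve 5 (λ x y a u v → x :* (a :+ x :* u) :- y :* (a :+ y :* v)
                             := (x :- y) :* (a :+ y :* v) :+ x :* (x :* u :- y :* v)) ≈-refl x y a _ _ ⟩
    (x - y) * (a + y * eval q y) + x * (x * eval q x - y * eval q y)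
      ≈⟨ +-congˡ (*-congˡ (suffixValues-eval y q x)) ⟩
    (x - y) * (a + y * eval q y) + x * ((x - y) * eval (suffixValues y q) x)
      ≈⟨ solve 4 (λ x y u v → (x :- y) :* u :+ x :* ((x :- y) :* v) := (x :- y) :* (u :+ x :* v)) ≈-refl x y _ _ ⟩
    (x - y) * ((a + y * eval q y) + x * eval (suffixValues y q) x) ∎

  quotient-eval : ∀ y q x → eval q x ≈ (x - y) * eval (quotient y q) x + eval q y
  quotient-eval y []      x = solve 2 (λ x y → con (+ 0) := (x :- y) :* con (+ 0) :+ con (+ 0)) ≈-refl x y
  quotient-eval y (a ∷ q) x = begin
    a + x * eval q x
      ≈⟨ solve 4 (λ x y a u → a :+ u := u :- y :+ (a :+ y)) ≈-refl x (y * eval q y) a (x * eval q x) ⟩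
    (x * eval q x - y * eval q y) + (a + y * eval q y)
      ≈⟨ +-congʳ (suffixValues-eval y q x) ⟩
    (x - y) * eval (suffixValues y q) x + (a + y * eval q y) ∎

  quotient-root : ∀ {y} q → eval q y ≈ 0# → ∀ x → eval q x ≈ (x - y) * eval (quotient y q) x
  quotient-root {y} q root x = ≈-trans (quotient-eval y q x) (≈-trans (+-congˡ root) (+-identityʳ _))

  suffixValues-length : ∀ y q → length (suffixValues y q) ≡ length q
  suffixValues-length y []      = refl
  suffixValues-length y (_ ∷ q) = cong suc (suffixValues-length y q)

  suffixValues-monic : ∀ y {d q} → Monic d q → Monic d (suffixValues y q)
  suffixValues-monic y (lead u≈1) = lead (≈-trans (eval-const _ y) u≈1)
  suffixValues-monic y (a ∷ m)    = _ ∷ suffixValues-monic y m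

  quotient-monic : ∀ y {d q} → Monic (suc d) q → Monic d (quotient y q)
  quotient-monic y (_ ∷ m) = suffixValues-monic y m

  suffixValues-zero : ∀ y q → All (_≈ 0#) (suffixValues y q) → All (_≈ 0#) q
  suffixValues-zero y []      []       = []
  suffixValues-zero y (a ∷ q) (e ∷ es) = a≈0 ∷ q≈0
    where
    q≈0 = suffixValues-zero y q es
    a≈0 = ≈-trans (≈-sym (≈-trans (+-congˡ (≈-trans (*-congˡ (eval-zero q≈0 y)) (zeroʳ y))) (+-identityʳ a))) e

  quotient-zero : ∀ y q → eval q y ≈ 0# → All (_≈ 0#) (quotient y q) → All (_≈ 0#) q
  quotient-zero y []      _ _  = []
  quotient-zero y (a ∷ q) e es = a≈0 ∷ q≈0
    where
    q≈0 = suffixValues-zero y q es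
    a≈0 = ≈-trans (≈-sym (≈-trans (+-congˡ (≈-trans (*-congˡ (eval-zero q≈0 y)) (zeroʳ y))) (+-identityʳ a))) e

  quotient-length : ∀ y {q n} → length q ℕ.≤ suc n → length (quotient y q) ℕ.≤ n
  quotient-length y {[]}    _         = z≤n
  quotient-length y {_ ∷ q} (s≤s q≤n) = subst (ℕ._≤ _) (≡.sym (suffixValues-length y q)) q≤n

  -- Dividing by X - x₀ shortens the list by one and keeps the remaining roots, as they differ from
  -- x₀.
  roots≥length⇒zero : ∀ n q (x : ℕ → Carrier) → length q ℕ.≤ n →
    (∀ {i j} → i ℕ.< j → j ℕ.< n → x i ≉ x j) →
    (∀ {i} → i ℕ.< n → eval q (x i) ≈ 0#) → All (_≈ 0#) q
  roots≥length⇒zero zero    []  x _   _        _    = []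
  roots≥length⇒zero (suc n) q x q≤n distinct root =
    quotient-zero (x 0) q (root (s≤s z≤n)) (roots≥length⇒zero n (quotient (x 0) q) (λ i → x (suc i))
      (quotient-length (x 0) {q} q≤n)
      (λ i<j j<n → distinct (s≤s i<j) (s≤s j<n))
      (λ {i} i<n → *-zero⇒zeroʳ
        (λ e → distinct {0} {suc i} (s≤s z≤n) (s≤s i<n) (≈-sym (x-y≈0⇒x≈y e)))
        (≈-trans (≈-sym (quotient-root q (root (s≤s z≤n)) (x (suc i)))) (root (s≤s i<n)))))

  nat-injective : ∀ {i j} → nat i ≈ nat j → i ≡ j
  nat-injective e = ℤ.+-injective (int-injective e)

  -- The points y + 1, y + 2, ... are distinct in characteristic zero and avoid y. One point may be
  -- left out so that identities can first be cancelled by x - y.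
  vanishing⇒zero : ∀ q y → (∀ x → x ≉ y → eval q x ≈ 0#) → All (_≈ 0#) q
  vanishing⇒zero q y vanish = roots≥length⇒zero (length q) q (λ i → y + nat (suc i)) ℕ.≤-refl
    (λ i<j _ e → ℕ.<⇒≢ i<j (ℕ.suc-injective (nat-injective (+-cancelˡ e))))
    (λ {i} _ → vanish _ λ e → nat-≉0 {suc i} (λ ()) (+-cancelˡ (≈-trans e (≈-sym (+-identityʳ y)))))
    where
    +-cancelˡ : ∀ {u v w} → u + v ≈ u + w → v ≈ w
    +-cancelˡ {u} {v} {w} e = x-y≈0⇒x≈y (≈-trans (solve 3 (λ u v w → v :- w := (u :+ v) :- (u :+ w)) ≈-refl u v w) (x≈y⇒x-y≈0 e))

  zero⇒coeff : ∀ {q} → All (_≈ 0#) q → ∀ k → coeff q k ≈ 0#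
  zero⇒coeff []       k       = ≈-refl
  zero⇒coeff (e ∷ es) zero    = e
  zero⇒coeff (e ∷ es) (suc k) = zero⇒coeff es k

  infix 21 ⊖_
  ⊖_ : Poly → Poly
  ⊖ q = map (- 1# *_) q

  eval-⊖ : ∀ q x → eval (⊖ q) x ≈ - eval q x
  eval-⊖ q x = ≈-trans (eval-scale (- 1#) q x) (solve 1 (λ u → (:- con (+ 1)) :* u := :- u) ≈-refl _)

  eval-minus : ∀ p q x → eval (p ⊕ ⊖ q) x ≈ eval p x - eval q x
  eval-minus p q x = ≈-trans (eval-⊕ p (⊖ q) x) (+-congˡ (eval-⊖ q x))

  eval≈⇒≈ : ∀ {p q y} → (∀ x → x ≉ y → eval p x ≈ eval q x) → eval p y ≈ eval q y
  eval≈⇒≈ {p} {q} {y} e = x-y≈0⇒x≈y (≈-trans (≈-sym (eval-minus p q y)) (eval-zero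
    (vanishing⇒zero (p ⊕ ⊖ q) y λ x x≉y → ≈-trans (eval-minus p q x) (x≈y⇒x-y≈0 (e x x≉y))) y))

  coeff-⊕ : ∀ p q k → coeff (p ⊕ q) k ≈ coeff p k + coeff q k
  coeff-⊕ []      q       k       = ≈-sym (+-identityˡ _)
  coeff-⊕ (a ∷ p) []      k       = ≈-sym (+-identityʳ _)
  coeff-⊕ (a ∷ p) (b ∷ q) zero    = ≈-refl
  coeff-⊕ (a ∷ p) (b ∷ q) (suc k) = coeff-⊕ p q k

  coeff-scale : ∀ a q k → coeff (map (a *_) q) k ≈ a * coeff q k
  coeff-scale a []      k       = ≈-sym (zeroʳ a)
  coeff-scale a (b ∷ q) zero    = ≈-refl
  coeff-scale a (b ∷ q) (suc k) = coeff-scale a q k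

  -- Values at infinitely many points determine the coefficients. Products of coefficient lists are
  -- therefore compared pointwise.
  eval≈⇒coeff≈ : ∀ p q → (∀ x → eval p x ≈ eval q x) → ∀ k → coeff p k ≈ coeff q k
  eval≈⇒coeff≈ p q e k = x-y≈0⇒x≈y (begin
    coeff p k - coeff q k ≈⟨ solve 2 (λ u v → u :- v := u :+ :- con (+ 1) :* v) ≈-refl (coeff p k) (coeff q k) ⟩
    coeff p k + - 1# * coeff q k ≈⟨ +-congˡ (coeff-scale (- 1#) q k) ⟨
    coeff p k + coeff (⊖ q) k ≈⟨ coeff-⊕ p (⊖ q) k ⟨
    coeff (p ⊕ ⊖ q) k ≈⟨ zero⇒coeff (vanishing⇒zero (p ⊕ ⊖ q) 0# λ x _ →
                                      ≈-trans (eval-minus p q x) (x≈y⇒x-y≈0 (e x))) k ⟩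
    0# ∎)

  ⊗-comm : ∀ p q k → coeff (p ⊗ q) k ≈ coeff (q ⊗ p) k
  ⊗-comm p q = eval≈⇒coeff≈ (p ⊗ q) (q ⊗ p) λ x → ≈-trans (eval-⊗ p q x) (≈-trans (*-comm _ _) (≈-sym (eval-⊗ q p x)))

  coeff∈ : ∀ {s} {P : Pred Carrier s} → P 0# → ∀ {q} → All P q → ∀ k → P (coeff q k)
  coeff∈ 0∈ []       k       = 0∈
  coeff∈ 0∈ (a ∷ qs) zero    = a
  coeff∈ 0∈ (a ∷ qs) (suc k) = coeff∈ 0∈ qs k

  length-⊕ : ∀ {n} p q → length p ℕ.≤ n → length q ℕ.≤ n → length (p ⊕ q) ℕ.≤ n
  length-⊕ []      q       _       q≤n     = q≤n
  length-⊕ (_ ∷ p) []      p≤n     _       = p≤n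
  length-⊕ (_ ∷ p) (_ ∷ q) (s≤s l) (s≤s m) = s≤s (length-⊕ p q l m)

  monomial : ℕ → Carrier → Poly
  monomial zero    u = u ∷ []
  monomial (suc k) u = 0# ∷ monomial k u

  eval-monomial : ∀ k u x → eval (monomial k u) x ≈ u * x ^ k
  eval-monomial zero    u x = solve 2 (λ u x → u :+ x :* con (+ 0) := u :* con (+ 1)) ≈-refl u x
  eval-monomial (suc k) u x = ≈-trans (+-congˡ (*-congˡ (eval-monomial k u x)))
    (solve 3 (λ u x v → con (+ 0) :+ x :* (u :* v) := u :* (x :* v)) ≈-refl u x _)

  monomial-monic : ∀ k → Monic k (monomial k 1#)
  monomial-monic zero    = lead ≈-refl
  monomial-monic (suc k) = 0# ∷ monomial-monic k

  binomialPoly : ℕ → Carrier → Poly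
  binomialPoly zero    u = 1# - u ∷ []
  binomialPoly (suc n) u = - u ∷ monomial n 1#

  eval-binomialPoly : ∀ n u x → eval (binomialPoly n u) x ≈ x ^ n - u
  eval-binomialPoly zero    u x = eval-const _ x
  eval-binomialPoly (suc n) u x = ≈-trans (+-congˡ (*-congˡ (eval-monomial n 1# x)))
    (solve 3 (λ u x v → :- u :+ x :* (con (+ 1) :* v) := x :* v :- u) ≈-refl u x _)

  binomialPoly-monic : ∀ {n} u → 0 ℕ.< n → Monic n (binomialPoly n u)
  binomialPoly-monic {suc n} u _ = - u ∷ monomial-monic n

  Monic-coeff : ∀ {d p} → Monic d p → coeff p d ≈ 1#
  Monic-coeff (lead u≈1) = u≈1
  Monic-coeff (_ ∷ m)    = Monic-coeff m

  Monic-coeff> : ∀ {d p k} → Monic d p → d ℕ.< k → coeff p k ≈ 0#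
  Monic-coeff> {k = suc _} (lead _) _         = ≈-refl
  Monic-coeff>             (_ ∷ m)  (s≤s d<k) = Monic-coeff> m d<k

  Monic-⊕ : ∀ {d p q} → length p ℕ.≤ d → Monic d q → Monic d (p ⊕ q)
  Monic-⊕ {p = []}    _         m       = m
  Monic-⊕ {p = _ ∷ _} (s≤s p≤d) (_ ∷ m) = _ ∷ Monic-⊕ p≤d m

  Monic-⊗ : ∀ {d e p q} → Monic d p → Monic e q → Monic (d ℕ.+ e) (p ⊗ q)
  Monic-⊗ {p = a ∷ _} (lead u≈1) m = plus-zero (scale m)
    where
    scale : ∀ {e q} → Monic e q → Monic e (map (a *_) q)
    scale (lead v≈1) = lead (≈-trans (*-cong u≈1 v≈1) (*-identityˡ 1#))
    scale (_ ∷ m)    = _ ∷ scale m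
    plus-zero : ∀ {e q} → Monic e q → Monic e (q ⊕ (0# ∷ []))
    plus-zero (lead v≈1)   = lead (≈-trans (+-identityʳ _) v≈1)
    plus-zero (_ ∷ lead v) = _ ∷ lead v
    plus-zero (_ ∷ b ∷ m)  = _ ∷ b ∷ m
  Monic-⊗ {suc d} {e} {q = q} (a ∷ m) m′ = Monic-⊕ q≤ (0# ∷ Monic-⊗ m m′)
    where
    q≤ : length (map (a *_) q) ℕ.≤ suc (d ℕ.+ e)
    q≤ rewrite length-map (a *_) q | Monic-length m′ = s≤s (ℕ.m≤n+m e d)

  -- Compare the coefficients at the larger of the two degrees: different degrees would give a = 0
  -- or 1 = 0.
  Monic-scale-unique : ∀ {d e p q a} → Monic d p → Monic e q → a ≉ 0# → (∀ k → coeff p k ≈ a * coeff q k) → a ≈ 1#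
  Monic-scale-unique {d} {e} {p} {q} {a} m m′ a≉0 eq with ℕ.<-cmp d e
  ... | tri< d<e _ _ = contradiction (begin
          a ≈⟨ *-identityʳ a ⟨
          a * 1# ≈⟨ *-congˡ (Monic-coeff m′) ⟨
          a * coeff q e ≈⟨ eq e ⟨
          coeff p e ≈⟨ Monic-coeff> m d<e ⟩
          0# ∎) a≉0
  ... | tri≈ _ refl _ = begin
          a ≈⟨ *-identityʳ a ⟨
          a * 1# ≈⟨ *-congˡ (Monic-coeff m′) ⟨
          a * coeff q d ≈⟨ eq d ⟨
          coeff p d ≈⟨ Monic-coeff m ⟩
          1# ∎
  ... | tri> _ _ e<d = contradiction (begin
          1# ≈⟨ Monic-coeff m ⟨
          coeff p d ≈⟨ eq d ⟩
          a * coeff q d ≈⟨ *-congˡ (Monic-coeff> m′ e<d) ⟩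
          a * 0# ≈⟨ zeroʳ a ⟩
          0# ∎) 1≉0

  module Over {s} {P : Pred Carrier s} (P-subring : IsSubring P) where

    open IsSubring P-subring

    ⊕∈ : ∀ {p q} → All P p → All P q → All P (p ⊕ q)
    ⊕∈ []         qs         = qs
    ⊕∈ (a ∷ ps)   []         = a ∷ ps
    ⊕∈ (a ∷ ps)   (b ∷ qs)   = +∈ a b ∷ ⊕∈ ps qs

    scale∈ : ∀ {a q} → P a → All P q → All P (map (a *_) q)
    scale∈ a []       = []
    scale∈ a (b ∷ qs) = *∈ a b ∷ scale∈ a qs

    ⊖∈ : ∀ {q} → All P q → All P (⊖ q)
    ⊖∈ = scale∈ (-∈ 1∈)

    ⊗∈ : ∀ {p q} → All P p → All P q → All P (p ⊗ q)
    ⊗∈ []       qs = []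
    ⊗∈ (a ∷ ps) qs = ⊕∈ (scale∈ a qs) (0∈ ∷ ⊗∈ ps qs)

    eval∈ : ∀ {q x} → All P q → P x → P (eval q x)
    eval∈ []       x = 0∈
    eval∈ (a ∷ qs) x = +∈ a (*∈ x (eval∈ qs x))

    suffixValues∈ : ∀ {y q} → P y → All P q → All P (suffixValues y q)
    suffixValues∈ y []           = []
    suffixValues∈ y q@(_ ∷ qs) = eval∈ q y ∷ suffixValues∈ y qs

    quotient∈ : ∀ {y q} → P y → All P q → All P (quotient y q)
    quotient∈ y []       = []
    quotient∈ y (_ ∷ qs) = suffixValues∈ y qs

    monomial∈ : ∀ k {u} → P u → All P (monomial k u)
    monomial∈ zero    u = u ∷ []
    monomial∈ (suc k) u = 0∈ ∷ monomial∈ k u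

    binomialPoly∈ : ∀ n {u} → P u → All P (binomialPoly n u)
    binomialPoly∈ zero    u = -⁺∈ 1∈ u ∷ []
    binomialPoly∈ (suc n) u = -∈ u ∷ monomial∈ n 1∈

    reduce : ∀ {d m} → Monic d m → All P m → ∀ {r} → length r ℕ.≤ suc d → All P r →
      ∃[ t ] ∃[ r′ ] P t × length r′ ℕ.≤ d × All P r′ × (∀ x → eval r x ≈ t * eval m x + eval r′ x)
    reduce {m = m} _ _ {[]} _ [] = 0# , [] , 0∈ , z≤n , [] , λ x → solve 1 (λ u → con (+ 0) := con (+ 0) :* u :+ con (+ 0)) ≈-refl _
    reduce (lead {u} u≈1) (_ ∷ []) {t ∷ []} _ (t∈ ∷ []) = t , [] , t∈ , z≤n , [] , λ x → begin
      t + x * 0# ≈⟨ solve 2 (λ t x → t :+ x :* con (+ 0) := t :* (con (+ 1) :+ x :* con (+ 0)) :+ con (+ 0)) ≈-refl t x ⟩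
      t * (1# + x * 0#) + 0# ≈⟨ +-congʳ (*-congˡ (+-congʳ u≈1)) ⟨
      t * (u + x * 0#) + 0# ∎
    reduce (lead _) _ {_ ∷ _ ∷ _} (s≤s ())
    reduce (b ∷ m) (b∈ ∷ m∈) {a ∷ r} (s≤s r≤) (a∈ ∷ r∈)
      with t , r′ , t∈ , r′≤ , r′∈ , e ← reduce m m∈ r≤ r∈ =
      t , (a - t * b) ∷ r′ , t∈ , s≤s r′≤ , -⁺∈ a∈ (*∈ t∈ b∈) ∷ r′∈ , λ x → ≈-trans (+-congˡ (*-congˡ (e x)))
        (solve 6 (λ a b t x m r → a :+ x :* (t :* m :+ r) := t :* (b :+ x :* m) :+ (a :- t :* b :+ x :* r)) ≈-refl a b t x _ _)

    -- If q = a + X q′ and q′ = m k + r, what is left of q modulo m is a + X r, only one coefficient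
    -- too long, and `reduce` removes that coefficient. Since m is monic nothing is inverted, so
    -- this also works over ℤ₍ℓ₎.
    divide : ∀ {d m} → Monic d m → All P m → ∀ {q} → All P q →
      ∃[ k ] ∃[ r ] All P k × length r ℕ.≤ d × All P r × (∀ x → eval q x ≈ eval m x * eval k x + eval r x)
    divide m m∈ [] = [] , [] , [] , z≤n , [] , λ x → solve 1 (λ u → con (+ 0) := u :* con (+ 0) :+ con (+ 0)) ≈-refl _
    divide {m = m′} m m∈ {a ∷ q} (a∈ ∷ q∈)
      with k , r , k∈ , r≤ , r∈ , e ← divide m m∈ q∈
      with t , r′ , t∈ , r′≤ , r′∈ , e′ ← reduce m m∈ (s≤s r≤) (a∈ ∷ r∈) =
      t ∷ k , r′ , t∈ ∷ k∈ , r′≤ , r′∈ , λ x → begin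
        a + x * eval q x ≈⟨ +-congˡ (*-congˡ (e x)) ⟩
        a + x * (eval m′ x * eval k x + eval r x)
          ≈⟨ solve 5 (λ a x m k r → a :+ x :* (m :* k :+ r) := m :* (x :* k) :+ (a :+ x :* r)) ≈-refl a x _ _ _ ⟩
        eval m′ x * (x * eval k x) + (a + x * eval r x) ≈⟨ +-congˡ (e′ x) ⟩
        eval m′ x * (x * eval k x) + (t * eval m′ x + eval r′ x)
          ≈⟨ solve 5 (λ x m k t r → m :* (x :* k) :+ (t :* m :+ r) := m :* (t :+ x :* k) :+ r) ≈-refl x _ _ t _ ⟩
        eval m′ x * (t + x * eval k x) + eval r′ x ∎

    compose : ∀ {h u} → All P h → All P u → ∃[ w ] All P w × (∀ x → eval w x ≈ eval h (eval u x))
    compose [] u∈ = [] , [] , λ x → ≈-refl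
    compose {a ∷ h} {u} (a∈ ∷ h∈) u∈ with w , w∈ , e ← compose h∈ u∈ =
      (a ∷ []) ⊕ (u ⊗ w) , ⊕∈ (a∈ ∷ []) (⊗∈ u∈ w∈) , λ x → ≈-trans (eval-⊕ (a ∷ []) (u ⊗ w) x)
        (+-cong (eval-const a x) (≈-trans (eval-⊗ u w x) (*-congˡ (e x))))

  -- The ring P[x]. When P contains ℚ it is closed under inverses by `⊇ℚ⇒HasInverses`, so over a
  -- field P it is P(x).
  Generated : ∀ {s} → Pred Carrier s → Carrier → Pred Carrier (c ⊔ ℓ₁ ⊔ s)
  Generated P x y = ∃[ h ] All P h × y ≈ eval h x

  module _ {s} {P : Pred Carrier s} (P-subring : IsSubring P) (x : Carrier) where

    open IsSubring P-subring
    open Over P-subring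

    Generated-const : ∀ {y} → P y → Generated P x y
    Generated-const {y} y∈ = y ∷ [] , y∈ ∷ [] , ≈-sym (eval-const y x)

    Generated-generator : Generated P x x
    Generated-generator = 0# ∷ 1# ∷ [] , 0∈ ∷ 1∈ ∷ [] ,
      solve 1 (λ x → x := con (+ 0) :+ x :* (con (+ 1) :+ x :* con (+ 0))) ≈-refl x

    Generated-isSubring : IsSubring (Generated P x)
    Generated-isSubring = record
      { resp = λ { e (h , h∈ , e′) → h , h∈ , ≈-trans (≈-sym e) e′ }
      ; 0∈   = [] , [] , ≈-refl
      ; 1∈   = Generated-const 1∈
      ; +∈   = λ { (h , h∈ , e) (h′ , h′∈ , e′) → h ⊕ h′ , ⊕∈ h∈ h′∈ , ≈-trans (+-cong e e′) (≈-sym (eval-⊕ h h′ x)) }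
      ; *∈   = λ { (h , h∈ , e) (h′ , h′∈ , e′) → h ⊗ h′ , ⊗∈ h∈ h′∈ , ≈-trans (*-cong e e′) (≈-sym (eval-⊗ h h′ x)) }
      ; -∈   = λ { (h , h∈ , e) → ⊖ h , ⊖∈ h∈ , ≈-trans (-‿cong e) (≈-sym (eval-⊖ h x)) }
      }

  HasInverses : ∀ {s} → Pred Carrier s → Set _
  HasInverses P = ∀ {x y} → P x → x * y ≈ 1# → P y

  -- As every element of ℚ̄ is algebraic, subrings containing ℚ are subfields.
  ⊇ℚ⇒HasInverses : ∀ {s} {P : Pred Carrier s} → IsSubring P → (∀ q → P (ι q)) → HasInverses P
  ⊇ℚ⇒HasInverses {P = P} P-subring ℚ⊆P {x} {y} x∈ xy≈1
    with r , r≢0 , root ← algebraic x = go r r≢0 root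
    where
    open IsSubring P-subring
    open Over P-subring
    over : ∀ r → All P (map ι r)
    over []      = []
    over (q ∷ r) = ℚ⊆P q ∷ over r
    go : ∀ r → ¬ (r ℚ[X].≋ []) → eval (map ι r) x ≈ 0# → P y
    go []      r≢0 _    = contradiction (λ _ → refl) r≢0
    -- Zero constant terms are cancelled, since x ≠ 0. Once the constant term q is nonzero, the
    -- relation q + x w = 0 gives x⁻¹ = - w / q, where w is a polynomial in x.
    go (q ∷ r) r≢0 root with q ℚ.≟ 0ℚ
    ... | yes refl = go r (λ r≡0 → r≢0 λ { zero → refl ; (suc k) → r≡0 k })
          (*-zero⇒zeroʳ (invertible⇒≉0 xy≈1) (≈-trans (≈-sym (≈-trans (+-congʳ ι-0) (+-identityˡ _))) root))
    ... | no q≢0 = resp y≈ (*∈ (-∈ (eval∈ (over r) x∈)) (ℚ⊆P (ℚ.1/ q)))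
      where
      instance q-nonZero = ℚ.≢-nonZero q≢0
      y≈ : - eval (map ι r) x * ι (ℚ.1/ q) ≈ y
      y≈ = begin
        - eval (map ι r) x * ι (ℚ.1/ q)
          ≈⟨ solve 3 (λ w z o → :- w :* z := :- (w :* con (+ 1)) :* z) ≈-refl _ _ 1# ⟩
        - (eval (map ι r) x * 1#) * ι (ℚ.1/ q)
          ≈⟨ *-congʳ (-‿cong (*-congˡ xy≈1)) ⟨
        - (eval (map ι r) x * (x * y)) * ι (ℚ.1/ q)
          ≈⟨ solve 5 (λ w x y z q → :- (w :* (x :* y)) :* z := (q :- (q :+ x :* w)) :* y :* z) ≈-refl _ _ _ _ (ι q) ⟩
        (ι q - (ι q + x * eval (map ι r) x)) * y * ι (ℚ.1/ q)
          ≈⟨ *-congʳ (*-congʳ (+-congˡ (-‿cong root))) ⟩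
        (ι q - 0#) * y * ι (ℚ.1/ q)
          ≈⟨ solve 3 (λ q y z → (q :- con (+ 0)) :* y :* z := q :* z :* y) ≈-refl _ _ _ ⟩
        ι q * ι (ℚ.1/ q) * y
          ≈⟨ *-congʳ (≈-trans (≈-sym (ι-* q _)) (≈-trans (ι-cong (ℚ.*-inverseʳ q)) ι-1)) ⟩
        1# * y
          ≈⟨ *-identityˡ y ⟩
        y ∎

  -- With d the degree, `minimal` says that 1, x, ..., xᵈ⁻¹ are linearly independent over P: lists
  -- of length at most d are the polynomials of degree below d.
  record MinimalPolynomial {s} (P : Pred Carrier s) (x : Carrier) : Set (c ⊔ ℓ₁ ⊔ s) where
    field
      degree  : ℕ
      poly    : Poly
      monic   : Monic degree poly
      over    : All P poly
      root    : eval poly x ≈ 0#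
      minimal : ∀ r → length r ℕ.≤ degree → All P r → eval r x ≈ 0# → All (_≈ 0#) r

  module _ {s} {P : Pred Carrier s} (P-subring : IsSubring P) where

    open IsSubring P-subring
    open Over P-subring

    -- Testing coefficients for zero from the end of the list finds the leading one; inverses in P
    -- then make the polynomial monic.
    zero⊎monic : HasInverses P → ∀ {r} → All P r → All (_≈ 0#) r ⊎
      (∃[ a ] ∃[ d ] ∃[ m ] a ≉ 0# × P a × d ℕ.< length r × Monic d m × All P m × (∀ x → eval r x ≈ a * eval m x))
    zero⊎monic inv [] = inj₁ []
    zero⊎monic inv {t ∷ r} (t∈ ∷ r∈) with zero⊎monic inv r∈ | t ≈? 0#
    ... | inj₁ r≈0 | yes t≈0 = inj₁ (t≈0 ∷ r≈0)
    ... | inj₁ r≈0 | no t≉0  = inj₂ (t , 0 , 1# ∷ [] , t≉0 , t∈ , s≤s z≤n , lead ≈-refl , 1∈ ∷ [] , λ x →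
          ≈-trans (+-congˡ (*-congˡ (eval-zero r≈0 x)))
            (solve 2 (λ t x → t :+ x :* con (+ 0) := t :* (con (+ 1) :+ x :* con (+ 0))) ≈-refl t x))
    ... | inj₂ (a , d , m , a≉0 , a∈ , d< , m-monic , m∈ , e) | _ with a⁻¹ , aa⁻¹≈1 ← invertible a≉0 =
          inj₂ (a , suc d , a⁻¹ * t ∷ m , a≉0 , a∈ , s≤s d< , _ ∷ m-monic , *∈ (inv a∈ aa⁻¹≈1) t∈ ∷ m∈ , λ x → begin
            t + x * eval r x ≈⟨ +-cong (≈-sym (*-identityˡ t)) (*-congˡ (e x)) ⟩
            1# * t + x * (a * eval m x) ≈⟨ +-congʳ (*-congʳ aa⁻¹≈1) ⟨
            a * a⁻¹ * t + x * (a * eval m x) ≈⟨ solve 5 (λ a b t x m → a :* b :* t :+ x :* (a :* m) := a :* (b :* t :+ x :* m)) ≈-refl _ _ _ _ _ ⟩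
            a * (a⁻¹ * t + x * eval m x) ∎)

    -- Whether a shorter relation exists over P is not decidable. But if no minimal polynomial
    -- existed, any nonzero shorter relation would be refuted by descent on the degree, and so m
    -- itself would be minimal.
    minimalPolynomial-exists : HasInverses P → ∀ {x d m} → Monic d m → All P m → eval m x ≈ 0# →
      ¬ ¬ MinimalPolynomial P x
    minimalPolynomial-exists inv {x} {d} {m} = go d ℕ.≤-refl
      where
      go : ∀ n {d m} → d ℕ.≤ n → Monic d m → All P m → eval m x ≈ 0# → ¬ ¬ MinimalPolynomial P x
      go n {d} {m} d≤n m-monic m∈ m-root none = none (record
        { degree = d ; poly = m ; monic = m-monic ; over = m∈ ; root = m-root ; minimal = minimal })
        where
        minimal : ∀ r → length r ℕ.≤ d → All P r → eval r x ≈ 0# → All (_≈ 0#) r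
        minimal r r≤d r∈ r-root with zero⊎monic inv r∈
        ... | inj₁ r≈0 = r≈0
        ... | inj₂ (a , d′ , m′ , a≉0 , _ , d′< , m′-monic , m′∈ , e) = contradiction none (smaller n (ℕ.<-≤-trans d′< (ℕ.≤-trans r≤d d≤n)))
          where
          smaller : ∀ n → d′ ℕ.< n → ¬ ¬ MinimalPolynomial P x
          smaller (suc n) (s≤s d′≤n) = go n d′≤n m′-monic m′∈ (*-zero⇒zeroʳ a≉0 (≈-trans (≈-sym (e x)) r-root))

    minimalPolynomial-divides : ∀ {x} (m : MinimalPolynomial P x) → ∀ {q} → All P q → eval q x ≈ 0# →
      ∃[ k ] All P k × (∀ z → eval q z ≈ eval (MinimalPolynomial.poly m) z * eval k z)
    minimalPolynomial-divides {x} m {q} q∈ q-root with k , r , k∈ , r≤ , r∈ , e ← divide (MinimalPolynomial.monic m) (MinimalPolynomial.over m) q∈ =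
      k , k∈ , λ z → ≈-trans (e z) (≈-trans (+-congˡ (eval-zero r≈0 z)) (+-identityʳ _))
      where
      open MinimalPolynomial m
      r≈0 : All (_≈ 0#) r
      r≈0 = minimal r r≤ r∈ (begin
        eval r x ≈⟨ solve 2 (λ k r → r := con (+ 0) :* k :+ r) ≈-refl (eval k x) _ ⟩
        0# * eval k x + eval r x ≈⟨ +-congʳ (*-congʳ root) ⟨
        eval poly x * eval k x + eval r x ≈⟨ e x ⟨
        eval q x ≈⟨ q-root ⟩
        0# ∎)

    -- The cofactor is a scalar times a monic polynomial, and leading coefficients force the scalar
    -- to be 1. A monic cofactor is what Gauss's lemma needs in `monic-factors-local`.
    minimalPolynomial-monic-divides : HasInverses P → ∀ {x} (m : MinimalPolynomial P x) →
      ∀ {d q} → Monic d q → All P q → eval q x ≈ 0# →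
      ∃[ e ] ∃[ k ] Monic e k × All P k × (∀ z → eval q z ≈ eval (MinimalPolynomial.poly m) z * eval k z)
    minimalPolynomial-monic-divides inv {x} m {d} {q} q-monic q∈ q-root
      with k , k∈ , e ← minimalPolynomial-divides m q∈ q-root
      with zero⊎monic inv k∈
    ... | inj₁ k≈0 = contradiction (≈-trans (≈-sym (Monic-coeff q-monic)) (zero⇒coeff (vanishing⇒zero q 0# λ z _ →
            ≈-trans (e z) (≈-trans (*-congˡ (eval-zero k≈0 z)) (zeroʳ _))) d)) 1≉0
    ... | inj₂ (a , d′ , k′ , a≉0 , _ , _ , k′-monic , k′∈ , e′) = d′ , k′ , k′-monic , k′∈ , λ z → begin
            eval q z ≈⟨ q≈ z ⟩
            a * eval (poly ⊗ k′) z ≈⟨ *-congʳ a≈1 ⟩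
            1# * eval (poly ⊗ k′) z ≈⟨ *-identityˡ _ ⟩
            eval (poly ⊗ k′) z ≈⟨ eval-⊗ poly k′ z ⟩
            eval poly z * eval k′ z ∎
      where
      open MinimalPolynomial m
      q≈ : ∀ z → eval q z ≈ a * eval (poly ⊗ k′) z
      q≈ z = begin
        eval q z ≈⟨ e z ⟩
        eval poly z * eval k z ≈⟨ *-congˡ (e′ z) ⟩
        eval poly z * (a * eval k′ z) ≈⟨ solve 3 (λ u a v → u :* (a :* v) := a :* (u :* v)) ≈-refl (eval poly z) a (eval k′ z) ⟩
        a * (eval poly z * eval k′ z) ≈⟨ *-congˡ (eval-⊗ poly k′ z) ⟨
        a * eval (poly ⊗ k′) z ∎
      a≈1 : a ≈ 1#
      a≈1 = Monic-scale-unique q-monic (Monic-⊗ monic k′-monic) a≉0 λ j → ≈-trans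
        (eval≈⇒coeff≈ q (map (a *_) (poly ⊗ k′)) (λ z → ≈-trans (q≈ z) (≈-sym (eval-scale a (poly ⊗ k′) z))) j)
        (coeff-scale a (poly ⊗ k′) j)

    minimalPolynomial-degree>0 : ∀ {x} (m : MinimalPolynomial P x) → 0 ℕ.< MinimalPolynomial.degree m
    minimalPolynomial-degree>0 {x} m with MinimalPolynomial.monic m | MinimalPolynomial.root m
    ... | _ ∷ _    | _ = s≤s z≤n
    ... | lead u≈1 | e = contradiction (≈-trans (≈-sym u≈1) (≈-trans (≈-sym (eval-const _ x)) e)) 1≉0

  -- Arithmetic modulo ℓ: localisation, Frobenius and Gauss's lemma.

  module Localisation {ℓ} (ℓ-prime : Prime ℓ) where

    private
      instance ℓ-nonZero = prime⇒nonZero ℓ-prime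

    infix 25 ℓ·_
    -- The ideal ℓP of a subring P. Congruence modulo ℓ is expressed by membership of a difference.
    record ℓ·_ {s} (P : Pred Carrier s) (x : Carrier) : Set (c ⊔ ℓ₁ ⊔ s) where
      constructor multiple
      field
        {cofactor} : Carrier
        cofactor∈  : P cofactor
        equation   : x ≈ nat ℓ * cofactor

    ℓ·-map : ∀ {s t} {P : Pred Carrier s} {Q : Pred Carrier t} → (∀ {x} → P x → Q x) → ∀ {x} → (ℓ· P) x → (ℓ· Q) x
    ℓ·-map P⊆Q (multiple y∈ e) = multiple (P⊆Q y∈) e

    ℓ≉0 : nat ℓ ≉ 0#
    ℓ≉0 = nat-≉0 (ℕ.≢-nonZero⁻¹ ℓ)

    -- The local ring ℤ₍ℓ₎ as a subset of ℚ̄. Denominators prime to ℓ are allowed, so only powers of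
    -- ℓ ever have to be cleared.
    Local : Pred Carrier ℓ₁
    Local x = ∃[ u ] ∃[ v ] ℓ ∤ v × nat v * x ≈ int u

    module Multiples {s} {P : Pred Carrier s} (P-subring : IsSubring P) where
      open IsSubring P-subring

      ℓ·-resp : ∀ {x y} → x ≈ y → (ℓ· P) x → (ℓ· P) y
      ℓ·-resp x≈y (multiple z∈ e) = multiple z∈ $ ≈-trans (≈-sym x≈y) e

      ℓ·-0 : (ℓ· P) 0#
      ℓ·-0 = multiple 0∈ (≈-sym (zeroʳ _))

      ℓ·-+ : ∀ {x y} → (ℓ· P) x → (ℓ· P) y → (ℓ· P) (x + y)
      ℓ·-+ (multiple {u} u∈ e) (multiple {v} v∈ e′) = multiple (+∈ u∈ v∈) $ ≈-trans (+-cong e e′)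
        (solve 3 (λ ℓ u v → ℓ :* u :+ ℓ :* v := ℓ :* (u :+ v)) ≈-refl _ u v)

      ℓ·-neg : ∀ {x} → (ℓ· P) x → (ℓ· P) (- x)
      ℓ·-neg (multiple {u} u∈ e) = multiple (-∈ u∈) $ ≈-trans (-‿cong e) (solve 2 (λ ℓ u → :- (ℓ :* u) := ℓ :* (:- u)) ≈-refl _ u)

      ℓ·-*ˡ : ∀ {x y} → P x → (ℓ· P) y → (ℓ· P) (x * y)
      ℓ·-*ˡ {x} x∈ (multiple {u} u∈ e) = multiple (*∈ x∈ u∈) $ ≈-trans (*-congˡ e) (solve 3 (λ ℓ x u → x :* (ℓ :* u) := ℓ :* (x :* u)) ≈-refl _ x u)

      ℓ·-*ʳ : ∀ {x y} → (ℓ· P) x → P y → (ℓ· P) (x * y)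
      ℓ·-*ʳ x∈ y∈ = ℓ·-resp (*-comm _ _) (ℓ·-*ˡ y∈ x∈)

      ℓ·-cancel : ∀ {x} → (ℓ· P) (nat ℓ * x) → P x
      ℓ·-cancel (multiple y∈ e) = resp (≈-sym (*-cancelˡ ℓ≉0 e)) y∈

      nat∈ : ∀ k → P (nat k)
      nat∈ zero    = resp (≈-sym int-0) 0∈
      nat∈ (suc k) = resp (≈-sym (nat-suc k)) (+∈ 1∈ (nat∈ k))

      private
        open Mult CR.semiring using () renaming (_×_ to _·_; ×-assoc-* to ·-assoc-*)
        open Sum CR.semiring using (sum; sum-init-last; sum-cong-≋)

        ·≈nat* : ∀ k x → k · x ≈ nat k * x
        ·≈nat* zero    x = ≈-sym (≈-trans (*-congʳ int-0) (zeroˡ x))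
        ·≈nat* (suc k) x = ≈-trans (+-congˡ (·≈nat* k x)) (≈-trans
          (solve 2 (λ k x → x :+ k :* x := (con (+ 1) :+ k) :* x) ≈-refl _ x) (*-congʳ (≈-sym (nat-suc k))))

        sum∈ : ∀ {n} (t : Fin n → Carrier) → (∀ i → (ℓ· P) (t i)) → (ℓ· P) (sum t)
        sum∈ {zero}  t t∈ = ℓ·-0
        sum∈ {suc n} t t∈ = ℓ·-+ (t∈ Fin.zero) (sum∈ (t ∘ Fin.suc) (t∈ ∘ Fin.suc))

      -- By the binomial theorem: ℓ divides every binomial coefficient strictly between the two
      -- ends.
      frobenius-+ : ∀ {x y} → P x → P y → (ℓ· P) ((x + y) ^ ℓ - (x ^ ℓ + y ^ ℓ))
      frobenius-+ {x} {y} x∈ y∈ = go ℓ refl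
        where
        go : ∀ l → l ≡ ℓ → (ℓ· P) ((x + y) ^ l - (x ^ l + y ^ l))
        go zero          0≡ℓ = contradiction (≡.sym 0≡ℓ) (ℕ.≢-nonZero⁻¹ ℓ)
        go (suc l) refl = ℓ·-resp (≈-sym (begin
            (x + y) ^ ℓ - (x ^ ℓ + y ^ ℓ)
              ≈⟨ +-congʳ (Binomial.theorem CR.commutativeSemiring ℓ x y) ⟩
            (t Fin.zero + sum (t ∘ Fin.suc)) - (x ^ ℓ + y ^ ℓ)
              ≈⟨ +-congʳ (+-cong first (≈-trans (sum-init-last (t ∘ Fin.suc)) (+-congˡ final))) ⟩
            (y ^ ℓ + (sum middle + x ^ ℓ)) - (x ^ ℓ + y ^ ℓ)
              ≈⟨ solve 3 (λ u s v → (v :+ (s :+ u)) :- (u :+ v) := s) ≈-refl _ (sum middle) _ ⟩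
            sum middle ∎)) (sum∈ middle middle∈)
          where
          t : Fin (suc (suc l)) → Carrier
          t k = (suc l ℕ.C toℕ k) · (x ^ toℕ k * y ^ (suc l ℕ.∸ toℕ k))
          middle : Fin l → Carrier
          middle i = t (Fin.suc (Fin.inject₁ i))
          first : t Fin.zero ≈ y ^ suc l
          first = solve 1 (λ u → con (+ 1) :* u :+ con (+ 0) := u) ≈-refl _
          final : t (Fin.suc (Fin.fromℕ l)) ≈ x ^ suc l
          final rewrite Fin.toℕ-fromℕ l | nCn≡1 (suc l) | ℕ.n∸n≡0 l =
            solve 1 (λ u → u :* con (+ 1) :+ con (+ 0) := u) ≈-refl _
          middle∈ : ∀ i → (ℓ· P) (middle i)
          middle∈ i with prime∣C ℓ-prime {suc (toℕ (Fin.inject₁ i))} (s≤s z≤n) (s≤s (subst (ℕ._< l) (≡.sym (Fin.toℕ-inject₁ i)) (Fin.toℕ<n i)))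
          ... | divides q eq = multiple (*∈ (nat∈ q) (*∈ (^∈ (suc (toℕ (Fin.inject₁ i))) x∈) (^∈ (l ℕ.∸ toℕ (Fin.inject₁ i)) y∈))) $
            ≈-trans (·≈nat* (suc l ℕ.C suc (toℕ (Fin.inject₁ i))) z) (≈-trans (*-congʳ (≈-trans (≈-reflexive (cong nat eq)) (≈-trans (≈-reflexive (cong int (ℤ.pos-* q (suc l)))) (int-* (+ q) (+ suc l)))))
              (solve 3 (λ q ℓ z → q :* ℓ :* z := ℓ :* (q :* z)) ≈-refl _ _ z))
            where z = x ^ suc (toℕ (Fin.inject₁ i)) * y ^ (l ℕ.∸ toℕ (Fin.inject₁ i))

    private
      ∤-* : ∀ {v w} → ℓ ∤ v → ℓ ∤ w → ℓ ∤ v ℕ.* w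
      ∤-* {v} {w} v∤ w∤ ∣vw = [ v∤ , w∤ ]′ (euclidsLemma v w ℓ-prime ∣vw)

      nat-* : ∀ v w → nat (v ℕ.* w) ≈ nat v * nat w
      nat-* v w = ≈-trans (≈-reflexive (cong int (ℤ.pos-* v w))) (int-* (+ v) (+ w))

    int-Local : ∀ z → Local (int z)
    int-Local z = z , 1 , prime∤1 ℓ-prime ,
      ≈-trans (*-congʳ int-1) (*-identityˡ _)

    Local-isSubring : IsSubring Local
    Local-isSubring = record
      { resp = resp
      ; 0∈   = resp int-0 (int-Local (+ 0))
      ; 1∈   = resp int-1 (int-Local (+ 1))
      ; +∈   = λ { {x} {y} (u , v , v∤ , e) (u′ , v′ , v′∤ , e′) →
          (+ v′) ℤ.* u ℤ.+ (+ v) ℤ.* u′ , v ℕ.* v′ , ∤-* v∤ v′∤ , (begin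
            nat (v ℕ.* v′) * (x + y) ≈⟨ *-congʳ (nat-* v v′) ⟩
            nat v * nat v′ * (x + y)
              ≈⟨ solve 4 (λ v w x y → v :* w :* (x :+ y) := w :* (v :* x) :+ v :* (w :* y)) ≈-refl _ _ x y ⟩
            nat v′ * (nat v * x) + nat v * (nat v′ * y) ≈⟨ +-cong (*-congˡ e) (*-congˡ e′) ⟩
            nat v′ * int u + nat v * int u′ ≈⟨ +-cong (int-* (+ v′) u) (int-* (+ v) u′) ⟨
            int ((+ v′) ℤ.* u) + int ((+ v) ℤ.* u′) ≈⟨ int-+ _ _ ⟨
            int ((+ v′) ℤ.* u ℤ.+ (+ v) ℤ.* u′) ∎) }
      ; *∈   = λ { {x} {y} (u , v , v∤ , e) (u′ , v′ , v′∤ , e′) →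
          u ℤ.* u′ , v ℕ.* v′ , ∤-* v∤ v′∤ , (begin
            nat (v ℕ.* v′) * (x * y) ≈⟨ *-congʳ (nat-* v v′) ⟩
            nat v * nat v′ * (x * y)
              ≈⟨ solve 4 (λ v w x y → v :* w :* (x :* y) := (v :* x) :* (w :* y)) ≈-refl _ _ x y ⟩
            (nat v * x) * (nat v′ * y) ≈⟨ *-cong e e′ ⟩
            int u * int u′ ≈⟨ int-* u u′ ⟨
            int (u ℤ.* u′) ∎) }
      ; -∈   = λ { {x} (u , v , v∤ , e) → ℤ.- u , v , v∤ ,
          ≈-trans (solve 2 (λ v x → v :* :- x := :- (v :* x)) ≈-refl _ x) (≈-trans (-‿cong e) (≈-sym (int-neg u))) }
      }
      where
      resp : ∀ {x y} → x ≈ y → Local x → Local y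
      resp x≈y (u , v , v∤ , e) = u , v , v∤ , ≈-trans (*-congˡ (≈-sym x≈y)) e

    open Multiples Local-isSubring

    Local⊆Rational : ∀ {x} → Local x → Rational x
    Local⊆Rational {x} (u , v , v∤ , e) = fromℤ u ℚ.* w , (begin
      x ≈⟨ *-identityˡ x ⟨
      1# * x ≈⟨ *-congʳ nat-v*w ⟨
      nat v * ι w * x ≈⟨ solve 3 (λ v w x → v :* w :* x := v :* x :* w) ≈-refl _ _ x ⟩
      nat v * x * ι w ≈⟨ *-congʳ (≈-trans e (int≈ι u)) ⟩
      ι (fromℤ u) * ι w ≈⟨ ι-* _ w ⟨
      ι (fromℤ u ℚ.* w) ∎)
      where
      v≢0 : fromℤ (+ v) ≢ 0ℚ
      v≢0 eq with refl ← ℤ.+-injective (fromℤ-injective {+ v} {+ 0} eq) = v∤ (divides 0 refl)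
      instance v-nonZero = ℚ.≢-nonZero v≢0
      w = ℚ.1/ fromℤ (+ v)
      nat-v*w : nat v * ι w ≈ 1#
      nat-v*w = ≈-trans (*-congʳ (int≈ι (+ v))) (≈-trans (≈-sym (ι-* _ w)) (≈-trans (ι-cong (ℚ.*-inverseʳ (fromℤ (+ v)))) ι-1))

    ℓ·Local⇒∣ : ∀ {x u v} → nat v * x ≈ int u → (ℓ· Local) x → ℓ ∣ ℤ.∣ u ∣
    ℓ·Local⇒∣ {x} {u} {v} e (multiple {y} (u′ , v′ , v′∤ , e′) x≈ℓy) =
      [ (λ ∣v′ → contradiction ∣v′ v′∤) , id ]′ (euclidsLemma v′ ℤ.∣ u ∣ ℓ-prime ℓ∣)
      where
      eq : (+ v′) ℤ.* u ≡ ((+ v) ℤ.* u′) ℤ.* (+ ℓ)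
      eq = int-injective (begin
        int ((+ v′) ℤ.* u) ≈⟨ int-* (+ v′) u ⟩
        nat v′ * int u ≈⟨ *-congˡ (≈-trans (≈-sym e) (*-congˡ x≈ℓy)) ⟩
        nat v′ * (nat v * (nat ℓ * y)) ≈⟨ solve 4 (λ w v ℓ y → w :* (v :* (ℓ :* y)) := v :* (w :* y) :* ℓ) ≈-refl _ _ _ y ⟩
        nat v * (nat v′ * y) * nat ℓ ≈⟨ *-congʳ (*-congˡ e′) ⟩
        nat v * int u′ * nat ℓ ≈⟨ *-congʳ (int-* (+ v) u′) ⟨
        int ((+ v) ℤ.* u′) * nat ℓ ≈⟨ int-* _ (+ ℓ) ⟨
        int (((+ v) ℤ.* u′) ℤ.* (+ ℓ)) ∎)
      ℓ∣ : ℓ ∣ v′ ℕ.* ℤ.∣ u ∣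
      ℓ∣ = subst (ℓ ∣_) (ℤ.abs-* (+ v′) u) (∣⇒∣ᵤ {+ ℓ} (dividesℤ ((+ v) ℤ.* u′) eq))

    ∣⇒ℓ·Local : ∀ {x u v} → nat v * x ≈ int u → ℓ ∤ v → ℓ ∣ ℤ.∣ u ∣ → (ℓ· Local) x
    ∣⇒ℓ·Local {x} {u} {v} e v∤ ℓ∣u with w , ℓw≈1 ← invertible ℓ≉0 | dividesℤ u′ u≡ ← ∣ᵤ⇒∣ {+ ℓ} {u} ℓ∣u =
      multiple (u′ , v , v∤ , *-cancelˡ ℓ≉0 (begin
        nat ℓ * (nat v * (x * w)) ≈⟨ solve 4 (λ ℓ v x w → ℓ :* (v :* (x :* w)) := (v :* x) :* (ℓ :* w)) ≈-refl _ _ x w ⟩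
        nat v * x * (nat ℓ * w) ≈⟨ *-cong e ℓw≈1 ⟩
        int u * 1# ≈⟨ *-identityʳ _ ⟩
        int u ≈⟨ ≈-reflexive (cong int u≡) ⟩
        int (u′ ℤ.* (+ ℓ)) ≈⟨ int-* u′ (+ ℓ) ⟩
        int u′ * nat ℓ ≈⟨ *-comm _ _ ⟩
        nat ℓ * int u′ ∎)) $
      ≈-sym (≈-trans (solve 3 (λ ℓ x w → ℓ :* (x :* w) := ℓ :* w :* x) ≈-refl _ x w) (≈-trans (*-congʳ ℓw≈1) (*-identityˡ x)))

    -- Membership in ℓ ℤ₍ℓ₎ depends only on numerators, where Euclid's lemma applies.
    ℓ·Local-prime : ∀ {x y} → Local x → Local y → (ℓ· Local) (x * y) → (ℓ· Local) x ⊎ (ℓ· Local) y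
    ℓ·Local-prime {x} {y} (u , v , v∤ , e) (u′ , v′ , v′∤ , e′) xy∈ =
      [ (λ ∣u → inj₁ (∣⇒ℓ·Local {x} {u} {v} e v∤ ∣u)) , (λ ∣u′ → inj₂ (∣⇒ℓ·Local {y} {u′} {v′} e′ v′∤ ∣u′)) ]′
        (euclidsLemma ℤ.∣ u ∣ ℤ.∣ u′ ∣ ℓ-prime (subst (ℓ ∣_) (ℤ.abs-* u u′) (ℓ·Local⇒∣ {x * y} {u ℤ.* u′} {v ℕ.* v′} vv′xy xy∈)))
      where
      vv′xy : nat (v ℕ.* v′) * (x * y) ≈ int (u ℤ.* u′)
      vv′xy = begin
        nat (v ℕ.* v′) * (x * y) ≈⟨ *-congʳ (nat-* v v′) ⟩
        nat v * nat v′ * (x * y)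
          ≈⟨ solve 4 (λ v w x y → v :* w :* (x :* y) := (v :* x) :* (w :* y)) ≈-refl _ _ x y ⟩
        (nat v * x) * (nat v′ * y) ≈⟨ *-cong e e′ ⟩
        int u * int u′ ≈⟨ int-* u u′ ⟨
        int (u ℤ.* u′) ∎

    nat∈ℓ·Local⇒∣ : ∀ {k} → (ℓ· Local) (nat k) → ℓ ∣ k
    nat∈ℓ·Local⇒∣ {k} = ℓ·Local⇒∣ {nat k} {+ k} {1} (≈-trans (*-congʳ int-1) (*-identityˡ _))

    1∉ℓ·Local : ¬ (ℓ· Local) 1#
    1∉ℓ·Local 1∈ = prime∤1 ℓ-prime (nat∈ℓ·Local⇒∣ (ℓ·-resp (≈-sym int-1) 1∈))

    private
      Frobenius-fixed : Pred Carrier (c ⊔ ℓ₁)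
      Frobenius-fixed x = (ℓ· Local) (x ^ ℓ - x)

      fixed-+ : ∀ {x y} → Local x → Local y → Frobenius-fixed x → Frobenius-fixed y → Frobenius-fixed (x + y)
      fixed-+ x∈ y∈ fx fy = ℓ·-resp
        (solve 5 (λ p q r x y → (p :- (q :+ r)) :+ ((q :- x) :+ (r :- y)) := p :- (x :+ y)) ≈-refl _ _ _ _ _)
        (ℓ·-+ (frobenius-+ x∈ y∈) (ℓ·-+ fx fy))

      fixed-resp : ∀ {x y} → x ≈ y → Frobenius-fixed x → Frobenius-fixed y
      fixed-resp x≈y = ℓ·-resp (+-cong (^-congˡ ℓ x≈y) (-‿cong x≈y))

      fixed-0 : Frobenius-fixed 0#
      fixed-0 = ℓ·-resp (≈-sym (x≈y⇒x-y≈0 (0^n (ℕ.>-nonZero⁻¹ ℓ)))) ℓ·-0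

      fixed-nat : ∀ k → Frobenius-fixed (nat k)
      fixed-nat zero    = fixed-resp (≈-sym int-0) fixed-0
      fixed-nat (suc k) = fixed-resp (≈-sym (nat-suc k)) (fixed-+ 1∈ (nat∈ k)
        (ℓ·-resp (≈-sym (x≈y⇒x-y≈0 (1^n ℓ))) ℓ·-0) (fixed-nat k))
        where open IsSubring Local-isSubring

      -- 0 = (x + (− x))^ℓ ≡ x^ℓ + (− x)^ℓ, whatever the parity of ℓ.
      fixed-neg : ∀ {x} → Local x → Frobenius-fixed x → Frobenius-fixed (- x)
      fixed-neg {x} x∈ fx = ℓ·-resp
        (solve 4 (λ z a b x → (:- (z :- (a :+ b)) :+ :- (a :- x)) :+ (z :- con (+ 0)) := b :- :- x)
          ≈-refl ((x + - x) ^ ℓ) (x ^ ℓ) ((- x) ^ ℓ) x)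
        (ℓ·-+ (ℓ·-+ (ℓ·-neg (frobenius-+ x∈ (-∈ x∈))) (ℓ·-neg fx))
              (ℓ·-resp (+-cong (^-congˡ ℓ (≈-sym (CR.-‿inverseʳ x))) ≈-refl) fixed-0))
        where open IsSubring Local-isSubring

      fixed-int : ∀ z → Frobenius-fixed (int z)
      fixed-int (+ k)    = fixed-nat k
      fixed-int -[1+ k ] = fixed-resp (≈-sym (int-neg (+ suc k))) (fixed-neg (nat∈ (suc k)) (fixed-nat (suc k)))

    -- Fermat's little theorem extends from integers to a fraction x with v x = u: since uˡ ≡ u and
    -- vˡ ≡ v for l = ℓ, the prime ℓ divides vˡ (xˡ - x), and it does not divide vˡ.
    fermat : ∀ {x} → Local x → (ℓ· Local) (x ^ ℓ - x)
    fermat {x} x∈@(u , v , v∤ , e) =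
      [ (λ bad → contradiction (nat∈ℓ·Local⇒∣ (ℓ·-resp v≈ (ℓ·-+ bad (ℓ·-neg (fixed-nat v))))) v∤) , id ]′
        (ℓ·Local-prime (^∈ ℓ (nat∈ v)) (-⁺∈ (^∈ ℓ x∈) x∈) (ℓ·-resp difference-product (ℓ·-+ u-fixed (ℓ·-neg (ℓ·-*ʳ (fixed-nat v) x∈)))))
      where
      open IsSubring Local-isSubring
      v≈ : nat v ^ ℓ + - (nat v ^ ℓ - nat v) ≈ nat v
      v≈ = solve 2 (λ w v → w :+ :- (w :- v) := v) ≈-refl (nat v ^ ℓ) (nat v)
      u-fixed : (ℓ· Local) ((nat v * x) ^ ℓ - nat v * x)
      u-fixed = fixed-resp (≈-sym e) (fixed-int u)
      difference-product : ((nat v * x) ^ ℓ - nat v * x) + - ((nat v ^ ℓ - nat v) * x) ≈ nat v ^ ℓ * (x ^ ℓ - x)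
      difference-product = begin
        ((nat v * x) ^ ℓ - nat v * x) + - ((nat v ^ ℓ - nat v) * x)
          ≈⟨ +-congʳ (+-congʳ (^-distrib-* (nat v) x ℓ)) ⟩
        (nat v ^ ℓ * x ^ ℓ - nat v * x) + - ((nat v ^ ℓ - nat v) * x)
          ≈⟨ solve 4 (λ w y v x → (w :* y :- v :* x) :+ :- ((w :- v) :* x) := w :* (y :- x)) ≈-refl (nat v ^ ℓ) (x ^ ℓ) (nat v) x ⟩
        nat v ^ ℓ * (x ^ ℓ - x) ∎

    module _ {s} {P : Pred Carrier s} (P-subring : IsSubring P) (Local⊆P : ∀ {x} → Local x → P x) where
      private
        module P = IsSubring P-subring
        module ℓP = Multiples P-subring
      open Over P-subring

      -- Frobenius is additive and multiplicative modulo ℓ and fixes the coefficients of h by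
      -- `fermat`; the induction follows Horner's rule.
      frobenius-eval : ∀ {h} → All Local h → ∀ {x} → P x → (ℓ· P) (eval h (x ^ ℓ) - eval h x ^ ℓ)
      frobenius-eval [] x∈ = ℓP.ℓ·-resp (≈-sym (x≈y⇒x-y≈0 (≈-sym (0^n (ℕ.>-nonZero⁻¹ ℓ))))) ℓP.ℓ·-0
      frobenius-eval {a ∷ h} (a∈ ∷ h∈) {x} x∈ = ℓP.ℓ·-resp rearrange
        (ℓP.ℓ·-+ (ℓP.ℓ·-+ (ℓP.ℓ·-*ˡ (P.^∈ ℓ x∈) (frobenius-eval h∈ x∈)) (ℓP.ℓ·-neg (ℓ·-map Local⊆P (fermat a∈))))
                 (ℓP.ℓ·-neg (ℓP.frobenius-+ (Local⊆P a∈) (P.*∈ x∈ (eval∈ (All.map Local⊆P h∈) x∈)))))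
        where
        u = eval h (x ^ ℓ)
        v = eval h x
        rearrange : (x ^ ℓ * (u - v ^ ℓ) + - (a ^ ℓ - a)) + - ((a + x * v) ^ ℓ - (a ^ ℓ + (x * v) ^ ℓ)) ≈ (a + x ^ ℓ * u) - (a + x * v) ^ ℓ
        rearrange = begin
          (x ^ ℓ * (u - v ^ ℓ) + - (a ^ ℓ - a)) + - ((a + x * v) ^ ℓ - (a ^ ℓ + (x * v) ^ ℓ))
            ≈⟨ +-congˡ (-‿cong (+-congˡ (-‿cong (+-congˡ (^-distrib-* x v ℓ))))) ⟩
          (x ^ ℓ * (u - v ^ ℓ) + - (a ^ ℓ - a)) + - ((a + x * v) ^ ℓ - (a ^ ℓ + x ^ ℓ * v ^ ℓ))
            ≈⟨ solve 6 (λ y u v b a z → (y :* (u :- v) :+ :- (b :- a)) :+ :- (z :- (b :+ y :* v)) := a :+ y :* u :- z)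
                 ≈-refl (x ^ ℓ) u (v ^ ℓ) (a ^ ℓ) a ((a + x * v) ^ ℓ) ⟩
          (a + x ^ ℓ * u) - (a + x * v) ^ ℓ ∎

    private
      drop-multiple : ∀ {a p q} → (ℓ· Local) a → All Local q →
        (∀ k → (ℓ· Local) (coeff ((a ∷ p) ⊗ q) k)) → ∀ k → (ℓ· Local) (coeff (p ⊗ q) k)
      drop-multiple {a} {p} {q} a∈ q∈ apq∈ k = ℓ·-resp e
        (ℓ·-+ (apq∈ (suc k)) (ℓ·-neg (ℓ·-*ʳ a∈ (coeff∈ (IsSubring.0∈ Local-isSubring) q∈ (suc k)))))
        where
        e : coeff ((a ∷ p) ⊗ q) (suc k) + - (a * coeff q (suc k)) ≈ coeff (p ⊗ q) k
        e = begin
          coeff ((a ∷ p) ⊗ q) (suc k) + - (a * coeff q (suc k))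
            ≈⟨ +-congʳ (coeff-⊕ (map (a *_) q) (0# ∷ (p ⊗ q)) (suc k)) ⟩
          (coeff (map (a *_) q) (suc k) + coeff (p ⊗ q) k) + - (a * coeff q (suc k))
            ≈⟨ +-congʳ (+-congʳ (coeff-scale a q (suc k))) ⟩
          (a * coeff q (suc k) + coeff (p ⊗ q) k) + - (a * coeff q (suc k))
            ≈⟨ solve 2 (λ u v → u :+ v :+ :- u := v) ≈-refl (a * coeff q (suc k)) (coeff (p ⊗ q) k) ⟩
          coeff (p ⊗ q) k ∎

    -- The constant term of the product is the product of the constant terms, so ℓ divides one of
    -- these. Dropping it shortens one factor, and the product stays zero modulo ℓ.
    gauss : ∀ {p q} → All Local p → All Local q → (∀ k → (ℓ· Local) (coeff (p ⊗ q) k)) →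
      All (ℓ· Local) p ⊎ All (ℓ· Local) q
    gauss {[]}    {_}     _         _         _   = inj₁ []
    gauss {_ ∷ _} {[]}    _         _         _   = inj₂ []
    gauss {a ∷ p} {b ∷ q} (a∈ ∷ p∈) (b∈ ∷ q∈) pq∈ =
      [ (λ a∈ℓ → [ (λ p∈ℓ → inj₁ (a∈ℓ ∷ p∈ℓ)) , inj₂ ]′ (gauss p∈ (b∈ ∷ q∈) (drop-multiple {a} {p} {b ∷ q} a∈ℓ (b∈ ∷ q∈) pq∈)))
      , (λ b∈ℓ → [ inj₁ , (λ q∈ℓ → inj₂ (b∈ℓ ∷ q∈ℓ)) ]′ (gauss (a∈ ∷ p∈) q∈ λ k → ℓ·-resp (⊗-comm q (a ∷ p) k)
          (drop-multiple {b} {q} {a ∷ p} b∈ℓ (a∈ ∷ p∈) (λ k → ℓ·-resp (⊗-comm (a ∷ p) (b ∷ q) k) (pq∈ k)) k)))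
      ]′ (ℓ·Local-prime a∈ b∈ (ℓ·-resp ab+0 (pq∈ 0)))
      where
      ab+0 : coeff ((a ∷ p) ⊗ (b ∷ q)) 0 ≈ a * b
      ab+0 = +-identityʳ (a * b)

  -- Integrality of minimal polynomials of roots of unity

  Rational-hasInverses : HasInverses Rational
  Rational-hasInverses = ⊇ℚ⇒HasInverses Rational-isSubring (λ q → q , ≈-refl)

  suffixValues-monomial : ∀ k y → eval (suffixValues y (monomial k 1#)) y ≈ nat (suc k) * y ^ k
  suffixValues-monomial zero    y = ≈-trans
    (solve 1 (λ y → (con (+ 1) :+ y :* con (+ 0)) :+ y :* con (+ 0) := con (+ 1) :* con (+ 1)) ≈-refl y)
    (*-congʳ (≈-sym int-1))
  suffixValues-monomial (suc k) y = begin
    eval (monomial (suc k) 1#) y + y * eval (suffixValues y (monomial k 1#)) y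
      ≈⟨ +-cong (eval-monomial (suc k) 1# y) (*-congˡ (suffixValues-monomial k y)) ⟩
    1# * (y * y ^ k) + y * (nat (suc k) * y ^ k)
      ≈⟨ solve 3 (λ y u n → con (+ 1) :* (y :* u) :+ y :* (n :* u) := (con (+ 1) :+ n) :* (y :* u)) ≈-refl y (y ^ k) (nat (suc k)) ⟩
    (1# + nat (suc k)) * (y * y ^ k)
      ≈⟨ *-congʳ (nat-suc (suc k)) ⟨
    nat (suc (suc k)) * y ^ suc k ∎

  -- The value at y of the cofactor of X − y in Xⁿ − u is the derivative n yⁿ⁻¹.
  binomial-cofactor : ∀ {n u y} r → (∀ x → x ^ suc n - u ≈ (x - y) * eval r x) → eval r y ≈ nat (suc n) * y ^ n
  binomial-cofactor {n} {u} {y} r e = ≈-trans (eval≈⇒≈ {r} {suffixValues y (monomial n 1#)} away) (suffixValues-monomial n y)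
    where
    bp = binomialPoly (suc n) u
    bp-root : eval bp y ≈ 0#
    bp-root = ≈-trans (eval-binomialPoly (suc n) u y) (≈-trans (e y) (≈-trans (*-congʳ (CR.-‿inverseʳ y)) (zeroˡ _)))
    -- Cancelling x - y determines the cofactor only for x ≠ y; `eval≈⇒≈` extends the equality to y.
    away : ∀ x → x ≉ y → eval r x ≈ eval (suffixValues y (monomial n 1#)) x
    away x x≉y = *-cancelˡ (λ x-y≈0 → x≉y (x-y≈0⇒x≈y x-y≈0)) (begin
      (x - y) * eval r x ≈⟨ e x ⟨
      x ^ suc n - u ≈⟨ eval-binomialPoly (suc n) u x ⟨
      eval bp x ≈⟨ quotient-root bp bp-root x ⟩
      (x - y) * eval (suffixValues y (monomial n 1#)) x ∎)

  module Integrality {ℓ} (ℓ-prime : Prime ℓ) where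

    open Localisation ℓ-prime
    open Multiples Local-isSubring
    open IsSubring Local-isSubring
    open Over Local-isSubring

    private
      instance ℓ-nonZero = prime⇒nonZero ℓ-prime

      -- Each factor ℓ of the denominator v is moved over to x, until what remains of v is prime to
      -- ℓ.
      clear : ∀ v → Acc ℕ._<_ v → v ≢ 0 → ∀ {x u} → nat v * x ≈ int u → ∃[ s ] Local (nat ℓ ^ s * x)
      clear v (acc rec) v≢0 {x} {u} e with ℓ ∣? v
      ... | no ℓ∤v = 0 , u , v , ℓ∤v , ≈-trans (*-congˡ (*-identityˡ x)) e
      ... | yes (divides k refl) = let s , ℓˢℓx∈ = clear k (rec k<kℓ) k≢0 {nat ℓ * x} e′ in
            suc s , resp (solve 3 (λ a b x → a :* (b :* x) := b :* a :* x) ≈-refl (nat ℓ ^ s) (nat ℓ) x) ℓˢℓx∈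
        where
        k≢0 : k ≢ 0
        k≢0 refl = v≢0 refl
        instance k-nonZero = ℕ.≢-nonZero k≢0
        k<kℓ : k ℕ.< k ℕ.* ℓ
        k<kℓ = ℕ.m<m*n k ℓ (1<prime ℓ-prime)
        e′ : nat k * (nat ℓ * x) ≈ int u
        e′ = begin
          nat k * (nat ℓ * x) ≈⟨ *-assoc _ _ _ ⟨
          nat k * nat ℓ * x ≈⟨ *-congʳ (int-* (+ k) (+ ℓ)) ⟨
          int (+ k ℤ.* + ℓ) * x ≈⟨ *-congʳ (≈-reflexive (cong int (≡.sym (ℤ.pos-* k ℓ)))) ⟩
          nat (k ℕ.* ℓ) * x ≈⟨ e ⟩
          int u ∎

    scaled : ℕ → Poly → Poly
    scaled s = map (nat ℓ ^ s *_)

    Rational⇒Local : ∀ {x} → Rational x → ∃[ s ] Local (nat ℓ ^ s * x)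
    Rational⇒Local {x} (q , x≈q) = clear (ℚ.↧ₙ q) (<-wellFounded _) (λ ()) {x} {ℚ.↥ q} (begin
      nat (ℚ.↧ₙ q) * x ≈⟨ *-cong (int≈ι (ℚ.↧ q)) x≈q ⟩
      ι (fromℤ (ℚ.↧ q)) * ι q ≈⟨ *-comm _ _ ⟩
      ι q * ι (fromℤ (ℚ.↧ q)) ≈⟨ ι-* q _ ⟨
      ι (q ℚ.* fromℤ (ℚ.↧ q)) ≈⟨ ι-cong (numerator q) ⟩
      ι (fromℤ (ℚ.↥ q)) ≈⟨ int≈ι (ℚ.↥ q) ⟨
      int (ℚ.↥ q) ∎)

    private
      raise : ∀ t {s x} → Local (nat ℓ ^ s * x) → Local (nat ℓ ^ (t ℕ.+ s) * x)
      raise t {s} {x} x∈ = resp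
        (≈-trans (≈-sym (*-assoc _ _ x)) (*-congʳ (≈-sym (^-homo-* (nat ℓ) t s)))) (*∈ (^∈ t (nat∈ ℓ)) x∈)

      raise-all : ∀ t {s} q → All Local (scaled s q) → All Local (scaled (t ℕ.+ s) q)
      raise-all t {s} []      []         = []
      raise-all t {s} (_ ∷ q) (a∈ ∷ q∈) = raise t {s} a∈ ∷ raise-all t {s} q q∈

    clear-denominators : ∀ {q} → All Rational q → ∃[ s ] All Local (scaled s q)
    clear-denominators [] = 0 , []
    clear-denominators {a ∷ q} (a∈ ∷ q∈) =
      let s , sa∈ = Rational⇒Local a∈
          t , tq∈ = clear-denominators q∈
      in t ℕ.+ s , raise t {s} {a} sa∈ ∷ subst (λ e → All Local (scaled e q)) (ℕ.+-comm s t) (raise-all s q tq∈)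

    private
      unscale : ∀ q → All Local (scaled 0 q) → All Local q
      unscale []      []        = []
      unscale (_ ∷ q) (a∈ ∷ q∈) = resp (*-identityˡ _) a∈ ∷ unscale q q∈

      divide-ℓ : ∀ s q → All (ℓ· Local) (scaled (suc s) q) → All Local (scaled s q)
      divide-ℓ s []      []        = []
      divide-ℓ s (_ ∷ q) (a∈ ∷ q∈) = ℓ·-cancel (ℓ·-resp (*-assoc _ _ _) a∈) ∷ divide-ℓ s q q∈

      monic-nonmultiple : ∀ {d q} → Monic d q → ¬ All (ℓ· Local) (scaled 0 q)
      monic-nonmultiple (lead u≈1) (u∈ ∷ [])  = 1∉ℓ·Local (ℓ·-resp (≈-trans (*-identityˡ _) u≈1) u∈)
      monic-nonmultiple (_ ∷ m)    (_ ∷ q∈)   = monic-nonmultiple m q∈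

    -- A factor common to all coefficients of the integral polynomial ℓˢp · ℓᵗq = ℓˢ⁺ᵗr
    -- divides out of one of the two, so that both exponents descend to 0.
    monic-factors-local : ∀ {d e p q r} → Monic d p → Monic e q → All Local r →
      (∀ x → eval r x ≈ eval p x * eval q x) →
      ∀ s t → All Local (scaled s p) → All Local (scaled t q) → All Local p × All Local q
    monic-factors-local {p = p} {q} {r} p-monic q-monic r∈ r≈pq = descend
      where
      product-coeff : ∀ s t k → nat ℓ ^ (s ℕ.+ t) * coeff r k ≈ coeff (scaled s p ⊗ scaled t q) k
      product-coeff s t k = ≈-trans (≈-sym (coeff-scale (nat ℓ ^ (s ℕ.+ t)) r k))
        (eval≈⇒coeff≈ (scaled (s ℕ.+ t) r) (scaled s p ⊗ scaled t q) values k)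
        where
        values : ∀ x → eval (scaled (s ℕ.+ t) r) x ≈ eval (scaled s p ⊗ scaled t q) x
        values x = begin
          eval (scaled (s ℕ.+ t) r) x ≈⟨ eval-scale (nat ℓ ^ (s ℕ.+ t)) r x ⟩
          nat ℓ ^ (s ℕ.+ t) * eval r x ≈⟨ *-cong (^-homo-* (nat ℓ) s t) (r≈pq x) ⟩
          (nat ℓ ^ s * nat ℓ ^ t) * (eval p x * eval q x)
            ≈⟨ solve 4 (λ a b u v → (a :* b) :* (u :* v) := (a :* u) :* (b :* v)) ≈-refl (nat ℓ ^ s) (nat ℓ ^ t) (eval p x) (eval q x) ⟩
          (nat ℓ ^ s * eval p x) * (nat ℓ ^ t * eval q x) ≈⟨ *-cong (eval-scale (nat ℓ ^ s) p x) (eval-scale (nat ℓ ^ t) q x) ⟨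
          eval (scaled s p) x * eval (scaled t q) x ≈⟨ eval-⊗ (scaled s p) (scaled t q) x ⟨
          eval (scaled s p ⊗ scaled t q) x ∎

      gauss-at : ∀ s t k → s ℕ.+ t ≡ suc k → All Local (scaled s p) → All Local (scaled t q) →
        All (ℓ· Local) (scaled s p) ⊎ All (ℓ· Local) (scaled t q)
      gauss-at s t k eq p∈ q∈ = gauss {scaled s p} {scaled t q} p∈ q∈ λ j → ℓ·-resp (product-coeff s t j) (ℓ·-*ʳ ℓ-power (coeff∈ 0∈ r∈ j))
        where
        ℓ-power : (ℓ· Local) (nat ℓ ^ (s ℕ.+ t))
        ℓ-power = multiple {cofactor = nat ℓ ^ k} (^∈ k (nat∈ ℓ)) (^-congʳ (nat ℓ) eq)

      descend : ∀ s t → All Local (scaled s p) → All Local (scaled t q) → All Local p × All Local q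
      descend zero    zero    p∈ q∈ = unscale p p∈ , unscale q q∈
      -- At exponent 0 the second factor is the monic q itself, which ℓ does not divide, so only the
      -- exponent of p can drop.
      descend (suc s) zero    p∈ q∈ =
        [ (λ ℓ∣p → descend s zero (divide-ℓ s p ℓ∣p) q∈)
        , (λ ℓ∣q → contradiction ℓ∣q (monic-nonmultiple q-monic))
        ]′ (gauss-at (suc s) zero (s ℕ.+ zero) refl p∈ q∈)
      descend zero    (suc t) p∈ q∈ =
        [ (λ ℓ∣p → contradiction ℓ∣p (monic-nonmultiple p-monic))
        , (λ ℓ∣q → descend zero t p∈ (divide-ℓ t q ℓ∣q))
        ]′ (gauss-at zero (suc t) t refl p∈ q∈)
      descend (suc s) (suc t) p∈ q∈ =
        [ (λ ℓ∣p → descend s (suc t) (divide-ℓ s p ℓ∣p) q∈)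
        , (λ ℓ∣q → descend (suc s) t p∈ (divide-ℓ t q ℓ∣q))
        ]′ (gauss-at (suc s) (suc t) (s ℕ.+ suc t) refl p∈ q∈)

  -- Dedekind's argument: from ζ to its prime powers.

  module RootOfUnity {n-1} {ζ : Carrier} (ζⁿ≈1 : ζ ^ suc n-1 ≈ 1#) (min : MinimalPolynomial Rational ζ) where

    open MinimalPolynomial min public

    private
      n = suc n-1
      Xⁿ-1 = binomialPoly n 1#

    cofactor : ∃[ e ] ∃[ g ] Monic e g × All Rational g × (∀ z → eval Xⁿ-1 z ≈ eval poly z * eval g z)
    cofactor = minimalPolynomial-monic-divides Rational-isSubring Rational-hasInverses min
      (binomialPoly-monic 1# (s≤s z≤n)) (Over.binomialPoly∈ Rational-isSubring n (IsSubring.1∈ Rational-isSubring))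
      (≈-trans (eval-binomialPoly n 1# ζ) (x≈y⇒x-y≈0 ζⁿ≈1))

    module _ {ℓ} (ℓ-prime : Prime ℓ) (ℓ∤n : ℓ ∤ n) where

      open Localisation ℓ-prime
      open Integrality ℓ-prime
      private
        instance ℓ-nonZero = prime⇒nonZero ℓ-prime
        g = proj₁ (proj₂ cofactor)
        y = ζ ^ ℓ
        S = Generated Local ζ
        S-subring = Generated-isSubring Local-isSubring ζ
        module S = IsSubring S-subring
        module ℓS = Multiples S-subring
        module L = IsSubring Local-isSubring

        yⁿ≈1 : y ^ n ≈ 1#
        yⁿ≈1 = begin
          (ζ ^ ℓ) ^ n ≈⟨ ^-assocʳ ζ ℓ n ⟩
          ζ ^ (ℓ ℕ.* n) ≈⟨ ^-congʳ ζ (ℕ.*-comm ℓ n) ⟩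
          ζ ^ (n ℕ.* ℓ) ≈⟨ ^-assocʳ ζ n ℓ ⟨
          (ζ ^ n) ^ ℓ ≈⟨ ^-congˡ ℓ ζⁿ≈1 ⟩
          1# ^ ℓ ≈⟨ 1^n ℓ ⟩
          1# ∎

        local : All Local poly × All Local g
        local =
          let e , g , g-monic , g∈ , eq = cofactor
              s , p∈ = clear-denominators over
              t , q∈ = clear-denominators g∈
          in monic-factors-local {r = Xⁿ-1} monic g-monic (Over.binomialPoly∈ Local-isSubring n L.1∈) eq s t p∈ q∈

        Local⊆S : ∀ {x} → Local x → S x
        Local⊆S = Generated-const Local-isSubring ζ

        ζ∈ : S ζ
        ζ∈ = Generated-generator Local-isSubring ζ

        y∈ : S y
        y∈ = S.^∈ ℓ ζ∈

        poly-y∈ : (ℓ· S) (eval poly y)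
        poly-y∈ = ℓS.ℓ·-resp (≈-trans (+-congˡ (neg-zero (≈-trans (^-congˡ ℓ root) (0^n (ℕ.>-nonZero⁻¹ ℓ))))) (+-identityʳ _))
          (frobenius-eval S-subring Local⊆S (proj₁ local) ζ∈)

        -- Write n = ℓ w with w in ℤ₍ℓ₎[ζ], and reduce w modulo the integral `poly` to r(ζ). The
        -- polynomial ℓ r - n is too short to vanish at ζ without being zero, so its constant term
        -- shows ℓ ∣ n.
        n∉ℓS : ¬ (ℓ· S) (nat n)
        n∉ℓS (multiple {w} (h , h∈ , w≈) n≈ℓw) =
          let k , r , k∈ , r≤ , r∈ , e = Over.divide Local-isSubring monic (proj₁ local) h∈
          in reduced r r≤ r∈ (begin
            w ≈⟨ w≈ ⟩
            eval h ζ ≈⟨ e ζ ⟩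
            eval poly ζ * eval k ζ + eval r ζ ≈⟨ +-congʳ (≈-trans (*-congʳ root) (zeroˡ _)) ⟩
            0# + eval r ζ ≈⟨ +-identityˡ _ ⟩
            eval r ζ ∎)
          where
          reduced : ∀ r → length r ℕ.≤ degree → All Local r → w ≈ eval r ζ → ⊥
          reduced r r≤ r∈ w≈r = ℓ∤n (nat∈ℓ·Local⇒∣ (conclude r r∈ zero-poly))
           where
           q = (- nat n ∷ []) ⊕ map (nat ℓ *_) r
           q∈ : All Local q
           q∈ = Over.⊕∈ Local-isSubring (L.-∈ (int-Local (+ n)) ∷ []) (Over.scale∈ Local-isSubring (int-Local (+ ℓ)) r∈)
           zero-poly : All (_≈ 0#) q
           zero-poly = minimal q
             (length-⊕ (- nat n ∷ []) (map (nat ℓ *_) r) (minimalPolynomial-degree>0 Rational-isSubring min)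
               (subst (ℕ._≤ degree) (≡.sym (length-map (nat ℓ *_) r)) r≤))
             (All.map Local⊆Rational q∈)
             (begin
               eval q ζ ≈⟨ eval-⊕ (- nat n ∷ []) (map (nat ℓ *_) r) ζ ⟩
               eval (- nat n ∷ []) ζ + eval (map (nat ℓ *_) r) ζ ≈⟨ +-cong (eval-const _ ζ) (eval-scale _ r ζ) ⟩
               - nat n + nat ℓ * eval r ζ ≈⟨ +-cong (-‿cong n≈ℓw) (*-congˡ (≈-sym w≈r)) ⟩
               - (nat ℓ * w) + nat ℓ * w ≈⟨ CR.-‿inverseˡ _ ⟩
               0# ∎)
           conclude : ∀ r → All Local r → All (_≈ 0#) ((- nat n ∷ []) ⊕ map (nat ℓ *_) r) → (ℓ· Local) (nat n)
           conclude [] _ (n≈0 ∷ []) = contradiction (neg≈0⇒≈0 n≈0) (nat-≉0 {n} (λ ()))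
           conclude (r₀ ∷ _) (r₀∈ ∷ _) (e ∷ _) = multiple r₀∈ (≈-sym (x-y≈0⇒x≈y (≈-trans (+-comm _ _) e)))

      -- Otherwise ζ^ℓ is a root of the cofactor g, and differentiating Xⁿ − 1 = poly · g there
      -- gives n ∈ ℓ ℤ₍ℓ₎[ζ], because poly(ζ^ℓ) ≡ poly(ζ)^ℓ = 0 modulo ℓ.
      root-^prime : eval poly (ζ ^ ℓ) ≈ 0#
      root-^prime = decidable-stable (eval poly y ≈? 0#) λ poly-y≉0 → n∉ℓS (n∈ℓS poly-y≉0)
        where
        eq = proj₂ (proj₂ (proj₂ (proj₂ cofactor)))
        module _ (poly-y≉0 : eval poly y ≉ 0#) where
         g-root : eval g y ≈ 0#
         g-root = *-zero⇒zeroʳ poly-y≉0 (≈-trans (≈-sym (eq y)) (≈-trans (eval-binomialPoly n 1# y) (x≈y⇒x-y≈0 yⁿ≈1)))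
         g₁ = quotient y g
         derivative : eval (poly ⊗ g₁) y ≈ nat n * y ^ n-1
         derivative = binomial-cofactor {n-1} {1#} {y} (poly ⊗ g₁) λ x → begin
           x ^ n - 1# ≈⟨ eval-binomialPoly n 1# x ⟨
           eval Xⁿ-1 x ≈⟨ eq x ⟩
           eval poly x * eval g x ≈⟨ *-congˡ (quotient-root g g-root x) ⟩
           eval poly x * ((x - y) * eval g₁ x) ≈⟨ solve 3 (λ u v w → u :* (v :* w) := v :* (u :* w)) ≈-refl (eval poly x) (x - y) (eval g₁ x) ⟩
           (x - y) * (eval poly x * eval g₁ x) ≈⟨ *-congˡ (eval-⊗ poly g₁ x) ⟨
           (x - y) * eval (poly ⊗ g₁) x ∎
         n≈ : y * (eval poly y * eval g₁ y) ≈ nat n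
         n≈ = begin
           y * (eval poly y * eval g₁ y) ≈⟨ *-congˡ (eval-⊗ poly g₁ y) ⟨
           y * eval (poly ⊗ g₁) y ≈⟨ *-congˡ derivative ⟩
           y * (nat n * y ^ n-1) ≈⟨ solve 3 (λ y n z → y :* (n :* z) := n :* (y :* z)) ≈-refl y (nat n) (y ^ n-1) ⟩
           nat n * y ^ n ≈⟨ *-congˡ yⁿ≈1 ⟩
           nat n * 1# ≈⟨ *-identityʳ _ ⟩
           nat n ∎
         n∈ℓS : (ℓ· S) (nat n)
         n∈ℓS = ℓS.ℓ·-resp n≈ (ℓS.ℓ·-*ˡ y∈ (ℓS.ℓ·-*ʳ poly-y∈ g₁-y∈))
           where
           g₁-y∈ : S (eval g₁ y)
           g₁-y∈ = Over.eval∈ S-subring (Over.quotient∈ S-subring y∈ (All.map Local⊆S (proj₂ local))) y∈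

  -- Real elements and complex conjugation.

  module Conjugation {a : Carrier} (a>0 : Positive a) where

    private
      neg-neg : ∀ x → - - x ≈ x
      neg-neg x = solve 1 (λ x → :- :- x := x) ≈-refl x

    real-resp : ∀ {x y} → x ≈ y → Real x → Real y
    real-resp e (inj₁ x>0)        = inj₁ (positive-resp e x>0)
    real-resp e (inj₂ (inj₁ x≈0)) = inj₂ (inj₁ (≈-trans (≈-sym e) x≈0))
    real-resp e (inj₂ (inj₂ x<0)) = inj₂ (inj₂ (positive-resp (-‿cong e) x<0))

    real-neg : ∀ {x} → Real x → Real (- x)
    real-neg (inj₁ x>0)        = inj₂ (inj₂ (positive-resp (≈-sym (neg-neg _)) x>0))
    real-neg (inj₂ (inj₁ x≈0)) = inj₂ (inj₁ (neg-zero x≈0))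
    real-neg (inj₂ (inj₂ x<0)) = inj₁ x<0

    real-0 : Real 0#
    real-0 = inj₂ (inj₁ ≈-refl)

    private
      real-*₊ : ∀ {x y} → Positive x → Real y → Real (x * y)
      real-*₊ x>0 (inj₁ y>0)        = inj₁ (positive-* x>0 y>0)
      real-*₊ x>0 (inj₂ (inj₁ y≈0)) = inj₂ (inj₁ (≈-trans (*-congˡ y≈0) (zeroʳ _)))
      real-*₊ x>0 (inj₂ (inj₂ y<0)) = inj₂ (inj₂ (positive-resp (solve 2 (λ x y → x :* :- y := :- (x :* y)) ≈-refl _ _) (positive-* x>0 y<0)))

    real-* : ∀ {x y} → Real x → Real y → Real (x * y)
    real-* (inj₁ x>0)        y = real-*₊ x>0 y
    real-* (inj₂ (inj₁ x≈0)) y = inj₂ (inj₁ (≈-trans (*-congʳ x≈0) (zeroˡ _)))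
    real-* (inj₂ (inj₂ x<0)) y = real-resp (solve 2 (λ x y → :- (:- x :* y) := x :* y) ≈-refl _ _) (real-neg (real-*₊ x<0 y))

    -- The axioms on the positive cone do not state that 1 is real; it is obtained as a a⁻¹ from the
    -- given positive a.
    real-1 : Real 1#
    real-1 = let _ , e = invertible (positive-≉0 a>0) in real-resp e (real-* (inj₁ a>0) (real-inverse (inj₁ a>0) e))

    square-positive : ∀ {x} → Real x → x ≉ 0# → Positive (x * x)
    square-positive (inj₁ x>0)        _   = positive-* x>0 x>0
    square-positive (inj₂ (inj₁ x≈0)) x≉0 = contradiction x≈0 x≉0
    square-positive (inj₂ (inj₂ x<0)) _   = positive-resp (solve 1 (λ x → :- x :* :- x := x :* x) ≈-refl _) (positive-* x<0 x<0)

    1>0 : Positive 1#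
    1>0 = positive-resp (*-identityˡ 1#) (square-positive real-1 1≉0)

    -- Otherwise i² = -1 would be a positive square, and then 1 + (-1) = 0 would be positive.
    i-not-real : ¬ Real i
    i-not-real i-real = positive-≉0 (positive-+ 1>0 (positive-resp i²≈-1 (square-positive i-real i≉0))) (CR.-‿inverseʳ 1#)
      where
      i≉0 : i ≉ 0#
      i≉0 i≈0 = 1≉0 (begin
        1# ≈⟨ neg-neg 1# ⟨
        - - 1# ≈⟨ -‿cong i²≈-1 ⟨
        - (i * i) ≈⟨ neg-zero (≈-trans (*-congʳ i≈0) (zeroˡ i)) ⟩
        0# ∎)

    real-isSubring : IsSubring Real
    real-isSubring = record { resp = real-resp ; 0∈ = real-0 ; 1∈ = real-1 ; +∈ = real-+ ; *∈ = real-* ; -∈ = real-neg }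

    open IsSubring real-isSubring using () renaming (-⁺∈ to real-sub)

    -- If y ≠ y′, the equation exhibits i as the real number (x′ - x) / (y - y′).
    imaginary-unique : ∀ {x y x′ y′} → Real x → Real y → Real x′ → Real y′ → x + i * y ≈ x′ + i * y′ → y ≈ y′
    imaginary-unique {x} {y} {x′} {y′} xr yr xr′ yr′ e = decidable-stable (y ≈? y′) λ y≉y′ →
      let w , dw≈1 = invertible {y - y′} (λ d≈0 → y≉y′ (x-y≈0⇒x≈y d≈0))
      in i-not-real (real-resp (i≈ w dw≈1) (real-* (real-sub xr′ xr) (real-inverse (real-sub yr yr′) dw≈1)))
      where
      i≈ : ∀ w → (y - y′) * w ≈ 1# → (x′ - x) * w ≈ i
      i≈ w dw≈1 = begin
        (x′ - x) * w
          ≈⟨ solve 6 (λ x y x′ y′ i w → (x′ :- x) :* w := ((x′ :+ i :* y′) :- (x :+ i :* y)) :* w :+ i :* ((y :- y′) :* w)) ≈-refl x y x′ y′ i w ⟩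
        ((x′ + i * y′) - (x + i * y)) * w + i * ((y - y′) * w)
          ≈⟨ +-cong (*-congʳ (x≈y⇒x-y≈0 (≈-sym e))) (*-congˡ dw≈1) ⟩
        0# * w + i * 1#
          ≈⟨ solve 2 (λ w i → con (+ 0) :* w :+ i :* con (+ 1) := i) ≈-refl w i ⟩
        i ∎

    opaque
      conj : Carrier → Carrier
      conj z = let x , y , _ = real+i*real z in x - i * y

      conj-decomposition : ∀ z → ∃[ x ] ∃[ y ] Real x × Real y × z ≈ x + i * y × conj z ≈ x - i * y
      conj-decomposition z = let x , y , xr , yr , e = real+i*real z in x , y , xr , yr , e , ≈-refl

    -- `real+i*real` picks some decomposition and is not assumed to respect equality. Uniqueness is
    -- what makes `conj` well defined and compatible with sums and products.
    conj-unique : ∀ {z x y} → Real x → Real y → z ≈ x + i * y → conj z ≈ x - i * y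
    conj-unique {z} {x} {y} xr yr e = ≈-trans conj≈ (+-cong x′≈x (-‿cong (*-congˡ y′≈y)))
      where
      d = conj-decomposition z
      x′ = proj₁ d
      y′ = proj₁ (proj₂ d)
      xr′ : Real x′
      xr′ = proj₁ (proj₂ (proj₂ d))
      yr′ : Real y′
      yr′ = proj₁ (proj₂ (proj₂ (proj₂ d)))
      e′ : z ≈ x′ + i * y′
      e′ = proj₁ (proj₂ (proj₂ (proj₂ (proj₂ d))))
      conj≈ : conj z ≈ x′ - i * y′
      conj≈ = proj₂ (proj₂ (proj₂ (proj₂ (proj₂ d))))
      y′≈y : y′ ≈ y
      y′≈y = imaginary-unique xr′ yr′ xr yr (≈-trans (≈-sym e′) e)
      x′≈x : x′ ≈ x
      x′≈x = begin
        x′ ≈⟨ solve 2 (λ x u → x := (x :+ u) :- u) ≈-refl x′ (i * y′) ⟩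
        (x′ + i * y′) - i * y′ ≈⟨ +-cong (≈-trans (≈-sym e′) e) (-‿cong (*-congˡ y′≈y)) ⟩
        (x + i * y) - i * y ≈⟨ solve 2 (λ x u → (x :+ u) :- u := x) ≈-refl x (i * y) ⟩
        x ∎

    conj-real : ∀ {x} → Real x → conj x ≈ x
    conj-real {x} xr = ≈-trans (conj-unique xr real-0 (solve 2 (λ x i → x := x :+ i :* con (+ 0)) ≈-refl x i))
      (solve 2 (λ x i → x :- i :* con (+ 0) := x) ≈-refl x i)

    conj-cong : ∀ {z w} → z ≈ w → conj z ≈ conj w
    conj-cong {z} {w} z≈w = let x , y , xr , yr , e , e′ = conj-decomposition w
      in ≈-trans (conj-unique xr yr (≈-trans z≈w e)) (≈-sym e′)

    conj-+ : ∀ z w → conj (z + w) ≈ conj z + conj w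
    conj-+ z w =
      let x , y , xr , yr , e , e′ = conj-decomposition z
          u , v , ur , vr , f , f′ = conj-decomposition w
      in ≈-trans (conj-unique (real-+ xr ur) (real-+ yr vr)
           (≈-trans (+-cong e f) (solve 5 (λ x y u v i → (x :+ i :* y) :+ (u :+ i :* v) := (x :+ u) :+ i :* (y :+ v)) ≈-refl x y u v i)))
         (≈-trans (solve 5 (λ x y u v i → (x :+ u) :- i :* (y :+ v) := (x :- i :* y) :+ (u :- i :* v)) ≈-refl x y u v i)
           (≈-sym (+-cong e′ f′)))

    conj-* : ∀ z w → conj (z * w) ≈ conj z * conj w
    conj-* z w =
      let x , y , xr , yr , e , e′ = conj-decomposition z
          u , v , ur , vr , f , f′ = conj-decomposition w
      in begin
        conj (z * w)
          ≈⟨ conj-unique (real-sub (real-* xr ur) (real-* yr vr)) (real-+ (real-* xr vr) (real-* yr ur)) (begin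
              z * w
                ≈⟨ *-cong e f ⟩
              (x + i * y) * (u + i * v)
                ≈⟨ solve 5 (λ x y u v i → (x :+ i :* y) :* (u :+ i :* v) := (x :* u :+ (i :* i) :* (y :* v)) :+ i :* (x :* v :+ y :* u)) ≈-refl x y u v i ⟩
              (x * u + (i * i) * (y * v)) + i * (x * v + y * u)
                ≈⟨ +-congʳ (+-congˡ (≈-trans (*-congʳ i²≈-1) (solve 1 (λ t → (:- con (+ 1)) :* t := :- t) ≈-refl (y * v)))) ⟩
              (x * u - y * v) + i * (x * v + y * u) ∎) ⟩
        (x * u - y * v) - i * (x * v + y * u)
          ≈⟨ +-congʳ (+-congˡ (≈-trans (solve 1 (λ t → :- t := (:- con (+ 1)) :* t) ≈-refl (y * v)) (*-congʳ (≈-sym i²≈-1)))) ⟩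
        (x * u + (i * i) * (y * v)) - i * (x * v + y * u)
          ≈⟨ solve 5 (λ x y u v i → (x :* u :+ (i :* i) :* (y :* v)) :- i :* (x :* v :+ y :* u) := (x :- i :* y) :* (u :- i :* v)) ≈-refl x y u v i ⟩
        (x - i * y) * (u - i * v)
          ≈⟨ *-cong e′ f′ ⟨
        conj z * conj w ∎

    conj-^ : ∀ z k → conj (z ^ k) ≈ conj z ^ k
    conj-^ z zero    = conj-real real-1
    conj-^ z (suc k) = ≈-trans (conj-* z (z ^ k)) (*-congˡ (conj-^ z k))

    Rational⊆Real : ∀ {x} → Rational x → Real x
    Rational⊆Real {x} (q , e) = real-resp (≈-sym e) (real-ι q)
      where
      real-nat : ∀ k → Real (nat k)
      real-nat zero    = real-resp (≈-sym int-0) real-0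
      real-nat (suc k) = real-resp (≈-sym (nat-suc k)) (real-+ real-1 (real-nat k))
      real-int : ∀ z → Real (int z)
      real-int (+ k)    = real-nat k
      real-int -[1+ k ] = real-resp (≈-sym (int-neg (+ suc k))) (real-neg (real-nat (suc k)))
      real-ι : ∀ q → Real (ι q)
      real-ι q = let w , vw≈1 = invertible {int (ℚ.↧ q)} (nat-≉0 {ℚ.↧ₙ q} λ ()) in
        real-resp (begin
          int (ℚ.↥ q) * w ≈⟨ *-congʳ (≈-trans (int≈ι (ℚ.↥ q)) (≈-trans (ι-cong (≡.sym (numerator q))) (ι-* q _))) ⟩
          (ι q * ι (fromℤ (ℚ.↧ q))) * w ≈⟨ *-congʳ (*-congˡ (int≈ι (ℚ.↧ q))) ⟨
          (ι q * int (ℚ.↧ q)) * w ≈⟨ *-assoc _ _ w ⟩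
          ι q * (int (ℚ.↧ q) * w) ≈⟨ *-congˡ vw≈1 ⟩
          ι q * 1# ≈⟨ *-identityʳ _ ⟩
          ι q ∎)
        (real-* (real-int (ℚ.↥ q)) (real-inverse (real-int (ℚ.↧ q)) vw≈1))

    conj-eval : ∀ {h} → All Rational h → ∀ z → conj (eval h z) ≈ eval h (conj z)
    conj-eval []       z = conj-real real-0
    conj-eval {b ∷ h} (b∈ ∷ h∈) z = begin
      conj (b + z * eval h z) ≈⟨ conj-+ b (z * eval h z) ⟩
      conj b + conj (z * eval h z) ≈⟨ +-cong (conj-real (Rational⊆Real b∈)) (conj-* z (eval h z)) ⟩
      b + conj z * conj (eval h z) ≈⟨ +-congˡ (*-congˡ (conj-eval h∈ z)) ⟩
      b + conj z * eval h (conj z) ∎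

    -- The cofactor s = 1 + ρ + ... + ρⁿ is positive, hence nonzero; so 1 is the only positive root
    -- of unity.
    geometric-sum : ∀ {ρ} → Positive ρ → ∀ n → ∃[ s ] Positive s × ρ ^ suc n - 1# ≈ (ρ - 1#) * s
    geometric-sum {ρ} ρ>0 zero    = 1# , 1>0 , solve 1 (λ r → r :* con (+ 1) :- con (+ 1) := (r :- con (+ 1)) :* con (+ 1)) ≈-refl ρ
    geometric-sum {ρ} ρ>0 (suc n) = let s , s>0 , e = geometric-sum ρ>0 n in
      ρ * s + 1# , positive-+ (positive-* ρ>0 s>0) 1>0 , (begin
        ρ * ρ ^ suc n - 1#
          ≈⟨ solve 2 (λ r t → r :* t :- con (+ 1) := r :* (t :- con (+ 1)) :+ (r :- con (+ 1))) ≈-refl ρ (ρ ^ suc n) ⟩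
        ρ * (ρ ^ suc n - 1#) + (ρ - 1#)
          ≈⟨ +-congʳ (*-congˡ e) ⟩
        ρ * ((ρ - 1#) * s) + (ρ - 1#)
          ≈⟨ solve 2 (λ r s → r :* ((r :- con (+ 1)) :* s) :+ (r :- con (+ 1)) := (r :- con (+ 1)) :* (r :* s :+ con (+ 1))) ≈-refl ρ s ⟩
        (ρ - 1#) * (ρ * s + 1#) ∎)

    norm-positive : ∀ {z} → z ≉ 0# → Positive (z * conj z)
    norm-positive {z} z≉0 = go (conj-decomposition z)
      where
      sum-of-squares : ∀ {x y} → Real x → Real y → ¬ (x ≈ 0# × y ≈ 0#) → Dec (x ≈ 0#) → Dec (y ≈ 0#) → Positive (x * x + y * y)
      sum-of-squares xr yr nz (yes x≈0) (yes y≈0) = contradiction (x≈0 , y≈0) nz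
      sum-of-squares xr yr nz (yes x≈0) (no y≉0)  = positive-resp (≈-sym (≈-trans (+-congʳ (≈-trans (*-congʳ x≈0) (zeroˡ _))) (+-identityˡ _))) (square-positive yr y≉0)
      sum-of-squares xr yr nz (no x≉0)  (yes y≈0) = positive-resp (≈-sym (≈-trans (+-congˡ (≈-trans (*-congʳ y≈0) (zeroˡ _))) (+-identityʳ _))) (square-positive xr x≉0)
      sum-of-squares xr yr nz (no x≉0)  (no y≉0)  = positive-+ (square-positive xr x≉0) (square-positive yr y≉0)
      go : ∃[ x ] ∃[ y ] Real x × Real y × z ≈ x + i * y × conj z ≈ x - i * y → Positive (z * conj z)
      go (x , y , xr , yr , e , e′) = positive-resp (≈-sym (begin
        z * conj z ≈⟨ *-cong e e′ ⟩
        (x + i * y) * (x - i * y) ≈⟨ solve 3 (λ x y i → (x :+ i :* y) :* (x :- i :* y) := x :* x :- (i :* i) :* (y :* y)) ≈-refl x y i ⟩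
        x * x - (i * i) * (y * y) ≈⟨ +-congˡ (-‿cong (*-congʳ i²≈-1)) ⟩
        x * x - (- 1#) * (y * y) ≈⟨ solve 2 (λ x y → x :- (:- con (+ 1)) :* y := x :+ y) ≈-refl (x * x) (y * y) ⟩
        x * x + y * y ∎))
        (sum-of-squares xr yr (λ { (x≈0 , y≈0) → z≉0 (≈-trans e (≈-trans (+-cong x≈0 (≈-trans (*-congˡ y≈0) (zeroʳ i))) (+-identityˡ 0#))) }) (x ≈? 0#) (y ≈? 0#))

    -- The norm of z is positive and again a root of unity, so it equals 1. Conjugation thus inverts
    -- z, and becomes the polynomial operation z ↦ zⁿ, where n + 1 is the exponent with value 1.
    conj-root-of-unity : ∀ {n z} → z ^ suc n ≈ 1# → z * conj z ≈ 1#
    conj-root-of-unity {n} {z} zⁿ≈1 =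
      let s , s>0 , e = geometric-sum ρ>0 n
      in x-y≈0⇒x≈y (*-zero⇒zeroˡ (positive-≉0 s>0) (≈-trans (≈-sym e) (x≈y⇒x-y≈0 ρⁿ≈1)))
      where
      z≉0 : z ≉ 0#
      z≉0 = invertible⇒≉0 zⁿ≈1
      ρ>0 : Positive (z * conj z)
      ρ>0 = norm-positive z≉0
      ρⁿ≈1 : (z * conj z) ^ suc n ≈ 1#
      ρⁿ≈1 = begin
        (z * conj z) ^ suc n ≈⟨ ^-distrib-* z (conj z) (suc n) ⟩
        z ^ suc n * conj z ^ suc n ≈⟨ *-cong zⁿ≈1 (≈-trans (≈-sym (conj-^ z (suc n))) (≈-trans (conj-cong zⁿ≈1) (conj-real real-1))) ⟩
        1# * 1# ≈⟨ *-identityˡ 1# ⟩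
        1# ∎

    -- A conjugation-invariant root of unity w satisfies w² = w · conj w = 1.
    real-odd-root-unique : ∀ {k u v} → conj u ≈ u → conj v ≈ v → v ≉ 0# → u ^ suc (2 ℕ.* k) ≈ v ^ suc (2 ℕ.* k) → u ≈ v
    real-odd-root-unique {k} {u} {v} cu cv v≉0 uⁿ≈vⁿ = begin
      u ≈⟨ *-identityʳ u ⟨
      u * 1# ≈⟨ *-congˡ vv⁻¹≈1 ⟨
      u * (v * v⁻¹) ≈⟨ solve 3 (λ u v w → u :* (v :* w) := (u :* w) :* v) ≈-refl u v v⁻¹ ⟩
      w * v ≈⟨ *-congʳ w≈1 ⟩
      1# * v ≈⟨ *-identityˡ v ⟩
      v ∎
      where
      n = suc (2 ℕ.* k)
      v⁻¹ = proj₁ (invertible v≉0)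
      vv⁻¹≈1 : v * v⁻¹ ≈ 1#
      vv⁻¹≈1 = proj₂ (invertible v≉0)
      w = u * v⁻¹
      wv≈u : v * w ≈ u
      wv≈u = ≈-trans (solve 3 (λ u v w → v :* (u :* w) := u :* (v :* w)) ≈-refl u v v⁻¹) (≈-trans (*-congˡ vv⁻¹≈1) (*-identityʳ u))
      wⁿ≈1 : w ^ n ≈ 1#
      wⁿ≈1 = begin
        (u * v⁻¹) ^ n ≈⟨ ^-distrib-* u v⁻¹ n ⟩
        u ^ n * v⁻¹ ^ n ≈⟨ *-congʳ uⁿ≈vⁿ ⟩
        v ^ n * v⁻¹ ^ n ≈⟨ ^-distrib-* v v⁻¹ n ⟨
        (v * v⁻¹) ^ n ≈⟨ ^-congˡ n vv⁻¹≈1 ⟩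
        1# ^ n ≈⟨ 1^n n ⟩
        1# ∎
      conj-w : conj w ≈ w
      conj-w = *-cancelˡ v≉0 (begin
        v * conj w ≈⟨ *-congʳ cv ⟨
        conj v * conj w ≈⟨ conj-* v w ⟨
        conj (v * w) ≈⟨ conj-cong wv≈u ⟩
        conj u ≈⟨ cu ⟩
        u ≈⟨ wv≈u ⟨
        v * w ∎)
      w²≈1 : w ^ 2 ≈ 1#
      w²≈1 = begin
        w * (w * 1#) ≈⟨ *-congˡ (≈-trans (*-identityʳ w) (≈-sym conj-w)) ⟩
        w * conj w ≈⟨ conj-root-of-unity {2 ℕ.* k} wⁿ≈1 ⟩
        1# ∎
      -- Oddness of the exponent enters: w = w (w²)ᵏ = wⁿ = 1.
      w≈1 : w ≈ 1#
      w≈1 = begin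
        w ≈⟨ *-identityʳ w ⟨
        w * 1# ≈⟨ *-congˡ (≈-trans (^-congˡ k w²≈1) (1^n k)) ⟨
        w * (w ^ 2) ^ k ≈⟨ *-congˡ (^-assocʳ w 2 k) ⟩
        w * w ^ (2 ℕ.* k) ≈⟨ wⁿ≈1 ⟩
        1# ∎

  -- Polynomials with rational coefficients

  evalℚ : ℚ[X].Poly → Carrier → Carrier
  evalℚ h = eval (map ι h)

  evalℚ≡ : ∀ h x → evalℚ h x ≡ evalₕ ι-hom h x
  evalℚ≡ h x = foldr-map (λ a v → a + x * v) ι 0# h

  evalℚ-⊕ : ∀ h k x → evalℚ (h ℚ[X].⊕ k) x ≈ evalℚ h x + evalℚ k x
  evalℚ-⊕ h k x rewrite evalℚ≡ (h ℚ[X].⊕ k) x | evalℚ≡ h x | evalℚ≡ k x = evalₕ-⊕ ι-hom h k x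

  evalℚ-⊗ : ∀ h k x → evalℚ (h ℚ[X].⊗ k) x ≈ evalℚ h x * evalℚ k x
  evalℚ-⊗ h k x rewrite evalℚ≡ (h ℚ[X].⊗ k) x | evalℚ≡ h x | evalℚ≡ k x = evalₕ-⊗ ι-hom h k x

  evalℚ-1 : ∀ x → evalℚ (1ℚ ∷ []) x ≈ 1#
  evalℚ-1 x = ≈-trans (eval-const (ι 1ℚ) x) ι-1

  evalℚ-X^ : ∀ n x → evalℚ (ℚ[X].X ℚ[X].^ n) x ≈ x ^ n
  evalℚ-X^ zero    x = evalℚ-1 x
  evalℚ-X^ (suc n) x = ≈-trans (evalℚ-⊗ ℚ[X].X (ℚ[X].X ℚ[X].^ n) x) (*-cong
    (≈-trans (+-cong ι-0 (*-congˡ (evalℚ-1 x))) (solve 1 (λ x → con (+ 0) :+ x :* con (+ 1) := x) ≈-refl x))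
    (evalℚ-X^ n x))

  evalℚ-binomial : ∀ n q x → evalℚ (binomial n q) x ≈ x ^ n - ι q
  evalℚ-binomial n q x = ≈-trans (evalℚ-⊕ (ℚ[X].X ℚ[X].^ n) (ℚ.- q ∷ []) x)
    (+-cong (evalℚ-X^ n x) (≈-trans (eval-const (ι (ℚ.- q)) x) (ι-neg q)))

  evalℚ-cong : ∀ h k → h ℚ[X].≋ k → ∀ x → evalℚ h x ≈ evalℚ k x
  evalℚ-cong []      []      e x = ≈-refl
  evalℚ-cong []      (b ∷ k) e x = ≈-sym (≈-trans (+-cong (≈-trans (ι-cong (≡.sym (e 0))) ι-0) (*-congˡ (≈-sym (evalℚ-cong [] k (e ∘ suc) x))))
    (solve 1 (λ x → con (+ 0) :+ x :* con (+ 0) := con (+ 0)) ≈-refl x))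
  evalℚ-cong (a ∷ h) []      e x = ≈-trans (+-cong (≈-trans (ι-cong (e 0)) ι-0) (*-congˡ (evalℚ-cong h [] (e ∘ suc) x)))
    (solve 1 (λ x → con (+ 0) :+ x :* con (+ 0) := con (+ 0)) ≈-refl x)
  evalℚ-cong (a ∷ h) (b ∷ k) e x = +-cong (ι-cong (e 0)) (*-congˡ (evalℚ-cong h k (e ∘ suc) x))

  coeff-map-ι : ∀ h k → coeff (map ι h) k ≈ ι (ℚ[X].coeff h k)
  coeff-map-ι []      k       = ≈-sym ι-0
  coeff-map-ι (a ∷ h) zero    = ≈-refl
  coeff-map-ι (a ∷ h) (suc k) = coeff-map-ι h k

  evalℚ≈⇒≋ : ∀ h k → (∀ x → evalℚ h x ≈ evalℚ k x) → h ℚ[X].≋ k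
  evalℚ≈⇒≋ h k e j = ι-injective (begin
    ι (ℚ[X].coeff h j) ≈⟨ coeff-map-ι h j ⟨
    coeff (map ι h) j ≈⟨ eval≈⇒coeff≈ (map ι h) (map ι k) e j ⟩
    coeff (map ι k) j ≈⟨ coeff-map-ι k j ⟩
    ι (ℚ[X].coeff k j) ∎)

  rationalise : ∀ {h} → All Rational h → ∃[ h′ ] (∀ x → evalℚ h′ x ≈ eval h x)
  rationalise [] = [] , λ x → ≈-refl
  rationalise ((q , e) ∷ h∈) = let h′ , e′ = rationalise h∈ in
    q ∷ h′ , λ x → +-cong (≈-sym e) (*-congˡ (e′ x))

  -- Roots of unity

  ^-unity : ∀ {n ζ} t → ζ ^ n ≈ 1# → (ζ ^ t) ^ n ≈ 1#
  ^-unity {n} {ζ} t ζⁿ≈1 = begin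
    (ζ ^ t) ^ n ≈⟨ ^-assocʳ ζ t n ⟩
    ζ ^ (t ℕ.* n) ≈⟨ ^-congʳ ζ (ℕ.*-comm t n) ⟩
    ζ ^ (n ℕ.* t) ≈⟨ ^-assocʳ ζ n t ⟨
    (ζ ^ n) ^ t ≈⟨ ^-congˡ t ζⁿ≈1 ⟩
    1# ^ t ≈⟨ 1^n t ⟩
    1# ∎

  primitive-distinct : ∀ {n ζ} → IsPrimitiveRootOfUnity ℚ̄ n ζ → 0 ℕ.< n → ∀ {i j} → i ℕ.< j → j ℕ.< n → ζ ^ i ≉ ζ ^ j
  primitive-distinct {suc n} {ζ} (ζⁿ≈1 , minimal) _ {i} {j} i<j j<n ζⁱ≈ζʲ =
    minimal (j ℕ.∸ i) (ℕ.m<n⇒0<n∸m i<j) (ℕ.≤-<-trans (ℕ.m∸n≤m j i) j<n)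
      (*-cancelˡ (^-≉0 i (invertible⇒≉0 ζⁿ≈1)) (begin
        ζ ^ i * ζ ^ (j ℕ.∸ i) ≈⟨ ^-homo-* ζ i (j ℕ.∸ i) ⟨
        ζ ^ (i ℕ.+ (j ℕ.∸ i)) ≈⟨ ^-congʳ ζ (ℕ.m+[n∸m]≡n (ℕ.<⇒≤ i<j)) ⟩
        ζ ^ j ≈⟨ ζⁱ≈ζʲ ⟨
        ζ ^ i ≈⟨ *-identityʳ _ ⟨
        ζ ^ i * 1# ∎))

  module _ {n-1} {ζ : Carrier} (ζⁿ≈1 : ζ ^ suc n-1 ≈ 1#) (distinct : ∀ {i j} → i ℕ.< j → j ℕ.< suc n-1 → ζ ^ i ≉ ζ ^ j) where
    private n = suc n-1

    ^-periodic : ∀ j i → ζ ^ (j ℕ.* n ℕ.+ i) ≈ ζ ^ i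
    ^-periodic j i = begin
      ζ ^ (j ℕ.* n ℕ.+ i) ≈⟨ ^-homo-* ζ (j ℕ.* n) i ⟩
      ζ ^ (j ℕ.* n) * ζ ^ i ≈⟨ *-congʳ (≈-trans (^-congʳ ζ (ℕ.*-comm j n)) (≈-sym (^-assocʳ ζ n j))) ⟩
      (ζ ^ n) ^ j * ζ ^ i ≈⟨ *-congʳ (≈-trans (^-congˡ j ζⁿ≈1) (1^n j)) ⟩
      1# * ζ ^ i ≈⟨ *-identityˡ _ ⟩
      ζ ^ i ∎

    -- A bounded search over the powers of ζ decides the matter; if it failed, Xⁿ - 1 would have the
    -- n + 1 distinct roots x, 1, ζ, ..., ζⁿ⁻¹.
    root-of-unity-power : ∀ {x} → x ^ n ≈ 1# → ∃[ j ] j ℕ.< n × x ≈ ζ ^ j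
    root-of-unity-power {x} xⁿ≈1 = decide (ℕ.anyUpTo? (λ j → x ≈? ζ ^ j) n)
      where
      decide : Dec (∃[ j ] j ℕ.< n × x ≈ ζ ^ j) → ∃[ j ] j ℕ.< n × x ≈ ζ ^ j
      decide (yes found) = found
      decide (no none)   = contradiction (≈-trans (≈-sym (Monic-coeff monic)) (zero⇒coeff zero-poly n)) 1≉0
        where
        monic = binomialPoly-monic {n} 1# (s≤s z≤n)
        points : ℕ → Carrier
        points zero    = x
        points (suc j) = ζ ^ j
        points-distinct : ∀ {i j} → i ℕ.< j → j ℕ.< suc n → points i ≉ points j
        points-distinct {zero}  {suc j} _         (s≤s j<n) e = none (j , j<n , e)
        points-distinct {suc i} {suc j} (s≤s i<j) (s≤s j<n) e = distinct i<j j<n e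
        vanish : ∀ {i} → i ℕ.< suc n → eval (binomialPoly n 1#) (points i) ≈ 0#
        vanish {zero}  _ = ≈-trans (eval-binomialPoly n 1# x) (x≈y⇒x-y≈0 xⁿ≈1)
        vanish {suc j} _ = ≈-trans (eval-binomialPoly n 1# (ζ ^ j)) (x≈y⇒x-y≈0 (^-unity {n} j ζⁿ≈1))
        zero-poly : All (_≈ 0#) (binomialPoly n 1#)
        zero-poly = roots≥length⇒zero (suc n) (binomialPoly n 1#) points (ℕ.≤-reflexive (Monic-length monic)) points-distinct vanish

  root-exists : ∀ {d f} → Monic (suc d) f → ∃[ y ] eval f y ≈ 0#
  root-exists {d} {f} m = algebraicallyClosed f (d , ≉0⇒# (λ e → 1≉0 (≈-trans (≈-sym (Monic-coeff m)) e)))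

  -- As f divides Xⁿ − 1, its roots are simple.
  vanishing-at-simple-roots : ∀ {n d f} g k → Monic d f → (∀ x → x ^ suc n - 1# ≈ eval f x * eval g x) →
    length k ℕ.≤ d → (∀ y → eval f y ≈ 0# → eval k y ≈ 0#) → All (_≈ 0#) k
  vanishing-at-simple-roots {d = zero} g [] m e k≤d vanish = []
  vanishing-at-simple-roots {n} {suc d} {f} g k m e k≤d vanish = go (root-exists m)
    where
    go : ∃[ y ] eval f y ≈ 0# → All (_≈ 0#) k
    go (y , fy≈0) = quotient-zero y k (vanish y fy≈0)
      (vanishing-at-simple-roots {n} g₁ (quotient y k) (quotient-monic y m) e₁ (quotient-length y {k} k≤d) vanish₁)
      where
      f₁ = quotient y f
      -- The factor X - y passes from f to the cofactor, so that f₁ divides the same binomial and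
      -- the induction applies to it.
      linear = - y ∷ 1# ∷ []
      g₁ = linear ⊗ g
      eval-linear : ∀ x → eval linear x ≈ x - y
      eval-linear x = solve 2 (λ x y → :- y :+ x :* (con (+ 1) :+ x :* con (+ 0)) := x :- y) ≈-refl x y
      e′ : ∀ x → x ^ suc n - 1# ≈ (x - y) * eval (f₁ ⊗ g) x
      e′ x = begin
        x ^ suc n - 1# ≈⟨ e x ⟩
        eval f x * eval g x ≈⟨ *-congʳ (quotient-root f fy≈0 x) ⟩
        (x - y) * eval f₁ x * eval g x ≈⟨ *-assoc _ _ _ ⟩
        (x - y) * (eval f₁ x * eval g x) ≈⟨ *-congˡ (eval-⊗ f₁ g x) ⟨
        (x - y) * eval (f₁ ⊗ g) x ∎
      e₁ : ∀ x → x ^ suc n - 1# ≈ eval f₁ x * eval g₁ x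
      e₁ x = begin
        x ^ suc n - 1# ≈⟨ e′ x ⟩
        (x - y) * eval (f₁ ⊗ g) x ≈⟨ *-congˡ (eval-⊗ f₁ g x) ⟩
        (x - y) * (eval f₁ x * eval g x) ≈⟨ solve 3 (λ u v w → u :* (v :* w) := v :* (u :* w)) ≈-refl (x - y) (eval f₁ x) (eval g x) ⟩
        eval f₁ x * ((x - y) * eval g x) ≈⟨ *-congˡ (*-congʳ (eval-linear x)) ⟨
        eval f₁ x * (eval linear x * eval g x) ≈⟨ *-congˡ (eval-⊗ linear g x) ⟨
        eval f₁ x * eval g₁ x ∎
      yⁿ≈1 : y ^ suc n ≈ 1#
      yⁿ≈1 = x-y≈0⇒x≈y (≈-trans (e y) (≈-trans (*-congʳ fy≈0) (zeroˡ _)))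
      -- A second zero of f at y would make the derivative of the binomial vanish there, although y
      -- is invertible and the characteristic is zero.
      f₁y≉0 : eval f₁ y ≉ 0#
      f₁y≉0 f₁y≈0 = *-≉0 (nat-≉0 {suc n} (λ ())) (^-≉0 n (invertible⇒≉0 yⁿ≈1)) (begin
        nat (suc n) * y ^ n ≈⟨ binomial-cofactor (f₁ ⊗ g) e′ ⟨
        eval (f₁ ⊗ g) y ≈⟨ eval-⊗ f₁ g y ⟩
        eval f₁ y * eval g y ≈⟨ *-congʳ f₁y≈0 ⟩
        0# * eval g y ≈⟨ zeroˡ _ ⟩
        0# ∎)
      vanish₁ : ∀ z → eval f₁ z ≈ 0# → eval (quotient y k) z ≈ 0#
      vanish₁ z f₁z≈0 = *-zero⇒zeroʳ
        (λ z-y≈0 → f₁y≉0 (≈-trans (eval-congʳ f₁ (≈-sym (x-y≈0⇒x≈y z-y≈0))) f₁z≈0))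
        (≈-trans (≈-sym (quotient-root k (vanish y fy≈0) z))
          (vanish z (≈-trans (quotient-root f fy≈0 z) (≈-trans (*-congˡ f₁z≈0) (zeroʳ _)))))

  neg-^odd : ∀ k x → (- x) ^ suc (2 ℕ.* k) ≈ - (x ^ suc (2 ℕ.* k))
  neg-^odd k x = begin
    - x * (- x) ^ (2 ℕ.* k) ≈⟨ *-congˡ (^-assocʳ (- x) 2 k) ⟨
    - x * ((- x) ^ 2) ^ k ≈⟨ *-congˡ (^-congˡ k (solve 1 (λ x → :- x :* (:- x :* con (+ 1)) := x :* (x :* con (+ 1))) ≈-refl x)) ⟩
    - x * (x ^ 2) ^ k ≈⟨ *-congˡ (^-assocʳ x 2 k) ⟩
    - x * x ^ (2 ℕ.* k) ≈⟨ solve 2 (λ x y → :- x :* y := :- (x :* y)) ≈-refl x (x ^ (2 ℕ.* k)) ⟩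
    - (x * x ^ (2 ℕ.* k)) ∎

  -- The constant term is, up to sign, the product of the roots.
  constant-term-^n : ∀ k {d f u} → Monic d f → (∀ x → eval f x ≈ 0# → x ^ suc (2 ℕ.* k) ≈ u) →
    eval f 0# ^ suc (2 ℕ.* k) ≈ (- u) ^ d
  constant-term-^n k {u = u} (lead {v} v≈1) roots = ≈-trans (^-congˡ n (≈-trans (eval-const v 0#) v≈1)) (1^n n)
    where n = suc (2 ℕ.* k)
  constant-term-^n k {suc d} {f} {u} m@(_ ∷ _) roots = go (root-exists m)
    where
    n = suc (2 ℕ.* k)
    go : ∃[ y ] eval f y ≈ 0# → eval f 0# ^ n ≈ (- u) ^ suc d
    go (y , fy≈0) = begin
      eval f 0# ^ n ≈⟨ ^-congˡ n (quotient-root f fy≈0 0#) ⟩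
      ((0# - y) * eval f₁ 0#) ^ n ≈⟨ ^-distrib-* (0# - y) (eval f₁ 0#) n ⟩
      (0# - y) ^ n * eval f₁ 0# ^ n ≈⟨ *-cong (^-congˡ n (+-identityˡ (- y))) (constant-term-^n k (quotient-monic y m) λ x f₁x≈0 →
                                              roots x (≈-trans (quotient-root f fy≈0 x) (≈-trans (*-congˡ f₁x≈0) (zeroʳ _)))) ⟩
      (- y) ^ n * (- u) ^ d ≈⟨ *-congʳ (≈-trans (neg-^odd k y) (-‿cong (roots y fy≈0))) ⟩
      - u * (- u) ^ d ∎
      where f₁ = quotient y f

  -- Conjugates of roots of unity

  module Q where
    open IsSubring Rational-isSubring public
    open Over Rational-isSubring public

  unity-minimalPolynomial : ∀ {n-1 ζ} → ζ ^ suc n-1 ≈ 1# → ¬ ¬ MinimalPolynomial Rational ζ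
  unity-minimalPolynomial {n-1} {ζ} ζⁿ≈1 = minimalPolynomial-exists Rational-isSubring Rational-hasInverses
    (binomialPoly-monic {suc n-1} 1# (s≤s z≤n)) (Q.binomialPoly∈ (suc n-1) Q.1∈)
    (≈-trans (eval-binomialPoly (suc n-1) 1# ζ) (x≈y⇒x-y≈0 ζⁿ≈1))

  -- The conjugation ζ ↦ ζˡ, with l = ℓ, in the only form needed: rational relations are preserved.
  -- The relation is a multiple of the minimal polynomial, which vanishes at the new point too.
  relation-^prime : ∀ {n-1 ζ} → ζ ^ suc n-1 ≈ 1# → ∀ {ℓ} → Prime ℓ → ℓ ∤ suc n-1 →
    ∀ {h} → All Rational h → eval h ζ ≈ 0# → eval h (ζ ^ ℓ) ≈ 0#
  relation-^prime {n-1} {ζ} ζⁿ≈1 {ℓ} ℓ-prime ℓ∤n {h} h∈ hζ≈0 = decidable-stable (eval h (ζ ^ ℓ) ≈? 0#) λ h≉0 →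
    unity-minimalPolynomial {n-1} ζⁿ≈1 λ min →
      let k , _ , e = minimalPolynomial-divides Rational-isSubring min h∈ hζ≈0 in
      h≉0 (≈-trans (e (ζ ^ ℓ)) (≈-trans (*-congʳ (RootOfUnity.root-^prime {n-1} ζⁿ≈1 min ℓ-prime ℓ∤n)) (zeroˡ _)))

  -- The previous lemma assumes of ζ only that ζⁿ = 1, so it can be applied again to each power
  -- reached. Primes may repeat.
  relation-^product : ∀ {n-1 ζ} → ζ ^ suc n-1 ≈ 1# → ∀ {ts} → All Prime ts → All (_∤ suc n-1) ts →
    ∀ {h} → All Rational h → eval h ζ ≈ 0# → eval h (ζ ^ product ts) ≈ 0#
  relation-^product {ζ = ζ} ζⁿ≈1 [] [] {h} h∈ hζ≈0 = ≈-trans (eval-congʳ h (*-identityʳ ζ)) hζ≈0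
  relation-^product {n-1} {ζ} ζⁿ≈1 {ℓ ∷ ts} (pr ∷ prs) (nd ∷ nds) {h} h∈ hζ≈0 =
    ≈-trans (eval-congʳ h (≈-sym (^-assocʳ ζ ℓ (product ts))))
      (relation-^product {n-1} (^-unity {suc n-1} ℓ ζⁿ≈1) prs nds h∈ (relation-^prime {n-1} ζⁿ≈1 pr nd h∈ hζ≈0))

  relation-^coprime : ∀ {n-1 ζ} → ζ ^ suc n-1 ≈ 1# → ∀ t → (∀ {ℓ} → Prime ℓ → ℓ ∣ suc t → ℓ ∤ suc n-1) →
    ∀ {h} → All Rational h → eval h ζ ≈ 0# → eval h (ζ ^ suc t) ≈ 0#
  relation-^coprime {n-1} {ζ} ζⁿ≈1 t coprime {h} h∈ hζ≈0 = ≈-trans (eval-congʳ h (^-congʳ ζ isFactorisation))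
    (relation-^product {n-1} ζⁿ≈1 factorsPrime (All.tabulate λ ℓ∈ → coprime (All.lookup factorsPrime ℓ∈)
      (subst (_ ∣_) (≡.sym isFactorisation) (∈⇒∣product ℓ∈))) h∈ hζ≈0)
    where open PrimeFactorisation (factorise (suc t))

  -- Powers of a root over the cyclotomic field.

  module Radical {k} {ζ : Carrier} (ζⁿ≈1 : ζ ^ suc (2 ℕ.* k) ≈ 1#)
    (distinct : ∀ {i j} → i ℕ.< j → j ℕ.< suc (2 ℕ.* k) → ¬ (ζ ^ i ≈ ζ ^ j))
    {q} (irreducible : ℚ[X].Irreducible (binomial (suc (2 ℕ.* k)) q))
    {a : Carrier} (a>0 : Positive a) (aⁿ≈q : a ^ suc (2 ℕ.* k) ≈ ι q) where

    open Conjugation a>0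

    private
      n-1 = 2 ℕ.* k
      n = suc n-1

    a≉0 : a ≉ 0#
    a≉0 = positive-≉0 a>0

    ζ≉0 : ζ ≉ 0#
    ζ≉0 = invertible⇒≉0 ζⁿ≈1

    rational-ι : ∀ r → Rational (ι r)
    rational-ι r = r , ≈-refl

    aζʲ-root : ∀ j → (a * ζ ^ j) ^ n ≈ ι q
    aζʲ-root j = begin
      (a * ζ ^ j) ^ n ≈⟨ ^-distrib-* a (ζ ^ j) n ⟩
      a ^ n * (ζ ^ j) ^ n ≈⟨ *-cong aⁿ≈q (^-unity {n} j ζⁿ≈1) ⟩
      ι q * 1# ≈⟨ *-identityʳ _ ⟩
      ι q ∎

    -- A rational aᵈ bounds the degree of the minimal polynomial of a over ℚ by d < n. In the
    -- resulting factorisation of Xⁿ - q neither factor is a unit: the first vanishes at a, and if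
    -- the cofactor were a unit, the first would vanish at all n roots a ζʲ.
    power-irrational : ∀ {d} → 0 ℕ.< d → d ℕ.< n → ¬ Rational (a ^ d)
    power-irrational {suc d-1} 0<d d<n (r , aᵈ≈r) =
      minimalPolynomial-exists Rational-isSubring Rational-hasInverses
        (binomialPoly-monic {n} (ι q) (s≤s z≤n)) bp∈ bp-root contradictory
      where
      d = suc d-1
      bp = binomialPoly n (ι q)
      bp∈ : All Rational bp
      bp∈ = Q.binomialPoly∈ n (rational-ι q)
      bp-root : eval bp a ≈ 0#
      bp-root = ≈-trans (eval-binomialPoly n (ι q) a) (x≈y⇒x-y≈0 aⁿ≈q)
      contradictory : ¬ MinimalPolynomial Rational a
      contradictory min = [ μ∤1 , κ∤1 ]′ (Irreducible.split-∣1 irreducible factorisation)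
        where
        open MinimalPolynomial min
        open RawMagma using (_,_)
        open RawSemiringDefs using (module Irreducible)
        degree≤d : degree ℕ.≤ d
        degree≤d = ℕ.≮⇒≥ λ d<degree → 1≉0 (≈-trans (≈-sym (Monic-coeff monic-d)) (zero⇒coeff (minimal (binomialPoly d (ι r))
          (ℕ.≤-trans (ℕ.≤-reflexive (Monic-length monic-d)) d<degree)
          (Q.binomialPoly∈ d (rational-ι r))
          (≈-trans (eval-binomialPoly d (ι r) a) (x≈y⇒x-y≈0 aᵈ≈r))) d))
          where
          monic-d = binomialPoly-monic {d} (ι r) 0<d
        quotient-data = minimalPolynomial-divides Rational-isSubring min bp∈ bp-root
        κ = proj₁ quotient-data
        bp≈ : ∀ x → eval bp x ≈ eval poly x * eval κ x
        bp≈ = proj₂ (proj₂ quotient-data)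
        μ′ = proj₁ (rationalise over)
        μ′≈ : ∀ x → evalℚ μ′ x ≈ eval poly x
        μ′≈ = proj₂ (rationalise over)
        κ′ = proj₁ (rationalise (proj₁ (proj₂ quotient-data)))
        κ′≈ : ∀ x → evalℚ κ′ x ≈ eval κ x
        κ′≈ = proj₂ (rationalise (proj₁ (proj₂ quotient-data)))
        factorisation : binomial n q ℚ[X].≋ (μ′ ℚ[X].⊗ κ′)
        factorisation = evalℚ≈⇒≋ (binomial n q) (μ′ ℚ[X].⊗ κ′) λ x → begin
          evalℚ (binomial n q) x ≈⟨ evalℚ-binomial n q x ⟩
          x ^ n - ι q ≈⟨ eval-binomialPoly n (ι q) x ⟨
          eval bp x ≈⟨ bp≈ x ⟩
          eval poly x * eval κ x ≈⟨ *-cong (μ′≈ x) (κ′≈ x) ⟨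
          evalℚ μ′ x * evalℚ κ′ x ≈⟨ evalℚ-⊗ μ′ κ′ x ⟨
          evalℚ (μ′ ℚ[X].⊗ κ′) x ∎
        unit-nonvanishing : ∀ w h → (w ℚ[X].⊗ h) ℚ[X].≋ (1ℚ ∷ []) → ∀ x → evalℚ h x ≉ 0#
        unit-nonvanishing w h e x = invertible⇒≉0 {y = evalℚ w x} (begin
          evalℚ h x * evalℚ w x ≈⟨ *-comm _ _ ⟩
          evalℚ w x * evalℚ h x ≈⟨ evalℚ-⊗ w h x ⟨
          evalℚ (w ℚ[X].⊗ h) x ≈⟨ evalℚ-cong (w ℚ[X].⊗ h) (1ℚ ∷ []) e x ⟩
          evalℚ (1ℚ ∷ []) x ≈⟨ evalℚ-1 x ⟩
          1# ∎)
        μ∤1 : ¬ (RawMagma._∣_ (RawRing.*-rawMagma ℚ[X].rawRing) μ′ (1ℚ ∷ []))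
        μ∤1 (w , e) = unit-nonvanishing w μ′ e a (≈-trans (μ′≈ a) root)
        κ∤1 : ¬ (RawMagma._∣_ (RawRing.*-rawMagma ℚ[X].rawRing) κ′ (1ℚ ∷ []))
        κ∤1 (w , e) = 1≉0 (≈-trans (≈-sym (Monic-coeff monic)) (zero⇒coeff poly≈0 degree))
          where
          poly≈0 : All (_≈ 0#) poly
          poly≈0 = roots≥length⇒zero n poly (λ j → a * ζ ^ j)
            (ℕ.≤-trans (ℕ.≤-reflexive (Monic-length monic)) (ℕ.≤-<-trans degree≤d d<n))
            (λ i<j j<n e′ → distinct i<j j<n (*-cancelˡ a≉0 e′))
            (λ {j} _ → *-zero⇒zeroˡ (λ κ≈0 → unit-nonvanishing w κ′ e (a * ζ ^ j) (≈-trans (κ′≈ _) κ≈0))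
              (≈-trans (≈-sym (bp≈ _)) (≈-trans (eval-binomialPoly n (ι q) _) (x≈y⇒x-y≈0 (aζʲ-root j)))))

    conj-ζ : ζ ^ n-1 ≈ conj ζ
    conj-ζ = *-cancelˡ ζ≉0 (≈-trans ζⁿ≈1 (≈-sym (conj-root-of-unity {n-1} ζⁿ≈1)))

    -- All conjugates of s are real n-th roots of sⁿ, hence equal to s.
    real-radical-rational : MinimalPolynomial Rational ζ → ∀ {s t} → Generated Rational ζ s →
      conj s ≈ s → s ≉ 0# → s ^ n ≈ ι t → Rational s
    real-radical-rational min {s} {t} (h , h∈ , s≈h) conj-s s≉0 sⁿ≈t =
      let u , r , u∈ , r≤ , r∈ , e = Q.divide monic over h∈
      in reduced r r≤ r∈ (begin
        s ≈⟨ s≈h ⟩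
        eval h ζ ≈⟨ e ζ ⟩
        eval poly ζ * eval u ζ + eval r ζ ≈⟨ +-congʳ (≈-trans (*-congʳ root) (zeroˡ _)) ⟩
        0# + eval r ζ ≈⟨ +-identityˡ _ ⟩
        eval r ζ ∎)
      where
      open MinimalPolynomial min
      cofactor = RootOfUnity.cofactor {n-1} ζⁿ≈1 min
      g = proj₁ (proj₂ cofactor)
      separable : ∀ x → x ^ n - 1# ≈ eval poly x * eval g x
      separable x = ≈-trans (≈-sym (eval-binomialPoly n 1# x)) (proj₂ (proj₂ (proj₂ (proj₂ cofactor))) x)
      transfer : ∀ {y} → eval poly y ≈ 0# → ∀ {l} → All Rational l → eval l ζ ≈ 0# → eval l y ≈ 0#
      transfer {y} y-root l∈ lζ≈0 = let v , _ , e = minimalPolynomial-divides Rational-isSubring min l∈ lζ≈0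
        in ≈-trans (e y) (≈-trans (*-congʳ y-root) (zeroˡ _))
      reduced : ∀ r → length r ℕ.≤ degree → All Rational r → s ≈ eval r ζ → Rational s
      -- As s is not yet known to be rational, minimality over ℚ does not apply to r - s. It
      -- vanishes instead at all roots of `poly`, which are simple and as many as the degree, so it
      -- is zero and s is the constant coefficient of r.
      reduced r r≤ r∈ s≈r = conclude r r∈ (vanishing-at-simple-roots {n-1} g difference monic separable
          (length-⊕ (- s ∷ []) r (minimalPolynomial-degree>0 Rational-isSubring min) r≤)
          λ y y-root → ≈-trans (eval-⊕ (- s ∷ []) r y) (≈-trans (+-congʳ (eval-const (- s) y))
            (≈-trans (+-comm _ _) (x≈y⇒x-y≈0 (value y y-root)))))
        where
        difference = (- s ∷ []) ⊕ r
        conclude : ∀ r → All Rational r → All (_≈ 0#) ((- s ∷ []) ⊕ r) → Rational s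
        conclude [] _ (e ∷ []) = contradiction (neg≈0⇒≈0 e) s≉0
        conclude (r₀ ∷ _) (r₀∈ ∷ _) (e ∷ _) = Q.resp (x-y≈0⇒x≈y (≈-trans (+-comm _ _) e)) r₀∈
        -- Both properties of s become rational relations for ζ: invariance under conjugation is
        -- r(ζⁿ⁻¹) = r(ζ), and the radical equation is r(ζ)ⁿ = t. They can then be transferred to
        -- every root y of `poly`.
        reflected = Q.compose r∈ (Q.monomial∈ n-1 Q.1∈)
        reflected≈ : ∀ x → eval (proj₁ reflected ⊕ ⊖ r) x ≈ eval r (x ^ n-1) - eval r x
        reflected≈ x = ≈-trans (eval-minus (proj₁ reflected) r x) (+-congʳ (≈-trans (proj₂ (proj₂ reflected) x)
          (eval-congʳ r (≈-trans (eval-monomial n-1 1# x) (*-identityˡ _)))))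
        powered = Q.compose (Q.monomial∈ n Q.1∈) r∈
        powered≈ : ∀ x → eval (proj₁ powered ⊕ ⊖ (ι t ∷ [])) x ≈ eval r x ^ n - ι t
        powered≈ x = ≈-trans (eval-minus (proj₁ powered) (ι t ∷ []) x) (+-cong (≈-trans (proj₂ (proj₂ powered) x)
          (≈-trans (eval-monomial n 1# (eval r x)) (*-identityˡ _))) (-‿cong (eval-const (ι t) x)))
        value : ∀ y → eval poly y ≈ 0# → eval r y ≈ s
        value y y-root = real-odd-root-unique {k} conj-ry conj-s s≉0 (≈-trans ryⁿ≈t (≈-sym sⁿ≈t))
          where
          yⁿ≈1 : y ^ n ≈ 1#
          yⁿ≈1 = x-y≈0⇒x≈y (≈-trans (separable y) (≈-trans (*-congʳ y-root) (zeroˡ _)))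
          conj-y : y ^ n-1 ≈ conj y
          conj-y = *-cancelˡ (invertible⇒≉0 yⁿ≈1) (≈-trans yⁿ≈1 (≈-sym (conj-root-of-unity {n-1} yⁿ≈1)))
          symmetric : eval r (ζ ^ n-1) ≈ eval r ζ
          symmetric = begin
            eval r (ζ ^ n-1) ≈⟨ eval-congʳ r conj-ζ ⟩
            eval r (conj ζ) ≈⟨ conj-eval r∈ ζ ⟨
            conj (eval r ζ) ≈⟨ conj-cong s≈r ⟨
            conj s ≈⟨ conj-s ⟩
            s ≈⟨ s≈r ⟩
            eval r ζ ∎
          conj-ry : conj (eval r y) ≈ eval r y
          conj-ry = begin
            conj (eval r y) ≈⟨ conj-eval r∈ y ⟩
            eval r (conj y) ≈⟨ eval-congʳ r conj-y ⟨
            eval r (y ^ n-1) ≈⟨ x-y≈0⇒x≈y (≈-trans (≈-sym (reflected≈ y)) (transfer y-root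
                                      (Q.⊕∈ (proj₁ (proj₂ reflected)) (Q.⊖∈ r∈))
                                      (≈-trans (reflected≈ ζ) (x≈y⇒x-y≈0 symmetric)))) ⟩
            eval r y ∎
          ryⁿ≈t : eval r y ^ n ≈ ι t
          ryⁿ≈t = x-y≈0⇒x≈y (≈-trans (≈-sym (powered≈ y)) (transfer y-root
            (Q.⊕∈ (proj₁ (proj₂ powered)) (Q.⊖∈ (rational-ι t ∷ [])))
            (≈-trans (powered≈ ζ) (x≈y⇒x-y≈0 (≈-trans (^-congˡ n (≈-sym s≈r)) sⁿ≈t)))))

    private
      ℚ[ζ] : Pred Carrier (c ⊔ ℓ₁)
      ℚ[ζ] = Generated Rational ζ

      ℚ[ζ]-isSubring : IsSubring ℚ[ζ]
      ℚ[ζ]-isSubring = Generated-isSubring Rational-isSubring ζ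

      module ℚζ = IsSubring ℚ[ζ]-isSubring

      ℚ⊆ℚ[ζ] : ∀ {x} → Rational x → ℚ[ζ] x
      ℚ⊆ℚ[ζ] = Generated-const Rational-isSubring ζ

      ζ∈ℚ[ζ] : ℚ[ζ] ζ
      ζ∈ℚ[ζ] = Generated-generator Rational-isSubring ζ

      ℚ[ζ]-hasInverses : HasInverses ℚ[ζ]
      ℚ[ζ]-hasInverses = ⊇ℚ⇒HasInverses ℚ[ζ]-isSubring (λ r → ℚ⊆ℚ[ζ] (rational-ι r))

    -- Any root α is allowed although only powers of the real root a are known to be irrational: the
    -- constant term of the minimal polynomial trades α for a.
    n≤degree : ∀ {α} → α ^ n ≈ ι q → MinimalPolynomial Rational ζ → (min : MinimalPolynomial ℚ[ζ] α) →
      n ℕ.≤ MinimalPolynomial.degree min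
    n≤degree {α} αⁿ≈q min-ζ min = ℕ.≮⇒≥ λ degree<n → power-irrational degree>0 degree<n aᵈ-rational
      where
      open MinimalPolynomial min
      degree>0 : 0 ℕ.< degree
      degree>0 = minimalPolynomial-degree>0 ℚ[ζ]-isSubring min
      quotient-data = minimalPolynomial-divides ℚ[ζ]-isSubring min
        (Over.binomialPoly∈ ℚ[ζ]-isSubring n (ℚ⊆ℚ[ζ] (rational-ι q)))
        (≈-trans (eval-binomialPoly n (ι q) α) (x≈y⇒x-y≈0 αⁿ≈q))
      κ = proj₁ quotient-data
      roots : ∀ x → eval poly x ≈ 0# → x ^ n ≈ ι q
      roots x e = x-y≈0⇒x≈y (≈-trans (≈-sym (eval-binomialPoly n (ι q) x))
        (≈-trans (proj₂ (proj₂ quotient-data) x) (≈-trans (*-congʳ e) (zeroˡ _))))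
      constant = eval poly 0#
      -- The constant term is, up to sign, a product of `degree` roots, each equal to a times a root
      -- of unity; b collects the signs and the powers of a. Hence w = constant / b has n-th power 1
      -- and is a power of ζ, which puts b into ℚ(ζ).
      b = (- a) ^ degree
      -a≉0 : - a ≉ 0#
      -a≉0 = a≉0 ∘ neg≈0⇒≈0
      b≉0 : b ≉ 0#
      b≉0 = ^-≉0 degree -a≉0
      bⁿ≈ : b ^ n ≈ (- ι q) ^ degree
      bⁿ≈ = begin
        ((- a) ^ degree) ^ n ≈⟨ ^-assocʳ (- a) degree n ⟩
        (- a) ^ (degree ℕ.* n) ≈⟨ ^-congʳ (- a) (ℕ.*-comm degree n) ⟩
        (- a) ^ (n ℕ.* degree) ≈⟨ ^-assocʳ (- a) n degree ⟨
        ((- a) ^ n) ^ degree ≈⟨ ^-congˡ degree (≈-trans (neg-^odd k a) (-‿cong aⁿ≈q)) ⟩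
        (- ι q) ^ degree ∎
      constantⁿ≈bⁿ : constant ^ n ≈ b ^ n
      constantⁿ≈bⁿ = ≈-trans (constant-term-^n k monic roots) (≈-sym bⁿ≈)
      b⁻¹ = proj₁ (invertible b≉0)
      bb⁻¹≈1 : b * b⁻¹ ≈ 1#
      bb⁻¹≈1 = proj₂ (invertible b≉0)
      w = constant * b⁻¹
      wⁿ≈1 : w ^ n ≈ 1#
      wⁿ≈1 = begin
        (constant * b⁻¹) ^ n ≈⟨ ^-distrib-* constant b⁻¹ n ⟩
        constant ^ n * b⁻¹ ^ n ≈⟨ *-congʳ constantⁿ≈bⁿ ⟩
        b ^ n * b⁻¹ ^ n ≈⟨ ^-distrib-* b b⁻¹ n ⟨
        (b * b⁻¹) ^ n ≈⟨ ^-congˡ n bb⁻¹≈1 ⟩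
        1# ^ n ≈⟨ 1^n n ⟩
        1# ∎
      w∈ : ℚ[ζ] w
      w∈ = let j , _ , w≈ = root-of-unity-power {n-1} ζⁿ≈1 distinct wⁿ≈1 in ℚζ.resp (≈-sym w≈) (ℚζ.^∈ j ζ∈ℚ[ζ])
      w-inverse = invertible {w} (invertible⇒≉0 wⁿ≈1)
      w⁻¹ = proj₁ w-inverse
      b∈ : ℚ[ζ] b
      b∈ = ℚζ.resp (begin
          constant * w⁻¹ ≈⟨ *-congʳ (≈-trans (≈-sym (*-identityʳ _)) (*-congˡ (≈-sym bb⁻¹≈1))) ⟩
          constant * (b * b⁻¹) * w⁻¹ ≈⟨ solve 4 (λ u b v w → u :* (b :* v) :* w := b :* ((u :* v) :* w)) ≈-refl constant b b⁻¹ w⁻¹ ⟩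
          b * (w * w⁻¹) ≈⟨ *-congˡ (proj₂ w-inverse) ⟩
          b * 1# ≈⟨ *-identityʳ b ⟩
          b ∎)
        (ℚζ.*∈ (Over.eval∈ ℚ[ζ]-isSubring over ℚζ.0∈) (ℚ[ζ]-hasInverses w∈ (proj₂ w-inverse)))
      -ιq^degree : ∃[ t ] (- ι q) ^ degree ≈ ι t
      -ιq^degree = Q.^∈ degree (Q.-∈ (rational-ι q))
      b-rational : Rational b
      b-rational = real-radical-rational min-ζ {b} {proj₁ -ιq^degree} b∈ conj-b b≉0 (≈-trans bⁿ≈ (proj₂ -ιq^degree))
        where
        conj-b : conj b ≈ b
        conj-b = ≈-trans (conj-^ (- a) degree) (^-congˡ degree (conj-real (real-neg (inj₁ a>0))))
      aᵈ-rational : Rational (a ^ degree)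
      aᵈ-rational = Q.resp (begin
          (- 1#) ^ degree * (- a) ^ degree ≈⟨ ^-distrib-* (- 1#) (- a) degree ⟨
          (- 1# * - a) ^ degree ≈⟨ ^-congˡ degree (solve 1 (λ a → (:- con (+ 1)) :* :- a := a) ≈-refl a) ⟩
          a ^ degree ∎)
        (Q.*∈ (Q.^∈ degree (Q.-∈ Q.1∈)) b-rational)

    -- 1, α, …, αⁿ⁻¹ are independent over ℚ(ζ), so ζ ∈ ℚ(ζʳ)(α) forces ζ ∈ ℚ(ζʳ),
    -- which the conjugation ζ ↦ ζᵗ with t ≡ 1 modulo n/r excludes.
    ζ∉Adjoin : ∀ {s} {S : Pred Carrier s} {r} → Prime r → r ∣ n → ∀ b →
      (∀ {x} → S x → ∃[ e ] x ≈ (a * ζ ^ b) * ζ ^ (r ℕ.* e)) → ¬ Adjoin ℚ̄ S ζ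
    ζ∉Adjoin {S = S} {r} r-prime (divides m n≡mr) b S⊆ ζ∈ =
      unity-minimalPolynomial {n-1} ζⁿ≈1 λ min-ζ →
      minimalPolynomial-exists ℚ[ζ]-isSubring ℚ[ζ]-hasInverses (binomialPoly-monic {n} (ι q) (s≤s z≤n))
        (Over.binomialPoly∈ ℚ[ζ]-isSubring n (ℚ⊆ℚ[ζ] (rational-ι q)))
        (≈-trans (eval-binomialPoly n (ι q) α) (x≈y⇒x-y≈0 αⁿ≈q)) λ min →
      ζ∉E (ζ∈E (n≤degree αⁿ≈q min-ζ min) (MinimalPolynomial.minimal min) (Adjoin⊆E[α] ζ∈))
      where
      α = a * ζ ^ b
      αⁿ≈q : α ^ n ≈ ι q
      αⁿ≈q = aζʲ-root b
      E : Pred Carrier (c ⊔ ℓ₁)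
      E = Generated Rational (ζ ^ r)
      E-isSubring : IsSubring E
      E-isSubring = Generated-isSubring Rational-isSubring (ζ ^ r)
      ℚ⊆E : ∀ {x} → Rational x → E x
      ℚ⊆E = Generated-const Rational-isSubring (ζ ^ r)
      ζʳ∈E : E (ζ ^ r)
      ζʳ∈E = Generated-generator Rational-isSubring (ζ ^ r)
      E[α] : Pred Carrier (c ⊔ ℓ₁)
      E[α] = Generated E α
      E[α]-isSubring : IsSubring E[α]
      E[α]-isSubring = Generated-isSubring E-isSubring α
      module E[α] = IsSubring E[α]-isSubring
      E⊆E[α] : ∀ {x} → E x → E[α] x
      E⊆E[α] = Generated-const E-isSubring α

      E⊆ℚ[ζ] : ∀ {x} → E x → ℚ[ζ] x
      E⊆ℚ[ζ] (h , h∈ , x≈) = ℚζ.resp (≈-sym x≈) (Over.eval∈ ℚ[ζ]-isSubring (All.map ℚ⊆ℚ[ζ] h∈) (ℚζ.^∈ r ζ∈ℚ[ζ]))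

      Adjoin⊆E[α] : ∀ {x} → Adjoin ℚ̄ S x → E[α] x
      Adjoin⊆E[α] (generator x∈)   = let e , x≈ = S⊆ x∈ in
        E[α].resp (≈-sym (≈-trans x≈ (*-congˡ (≈-sym (^-assocʳ ζ r e)))))
          (E[α].*∈ (Generated-generator E-isSubring α) (E⊆E[α] (IsSubring.^∈ E-isSubring e ζʳ∈E)))
      Adjoin⊆E[α] (rational t)     = E⊆E[α] (ℚ⊆E (rational-ι t))
      Adjoin⊆E[α] (add x y)        = E[α].+∈ (Adjoin⊆E[α] x) (Adjoin⊆E[α] y)
      Adjoin⊆E[α] (negate x)       = E[α].-∈ (Adjoin⊆E[α] x)
      Adjoin⊆E[α] (multiply x y)   = E[α].*∈ (Adjoin⊆E[α] x) (Adjoin⊆E[α] y)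
      Adjoin⊆E[α] (invert x xy≈1)  = ⊇ℚ⇒HasInverses E[α]-isSubring (λ t → E⊆E[α] (ℚ⊆E (rational-ι t))) (Adjoin⊆E[α] x) xy≈1
      Adjoin⊆E[α] (respect x≈y x)  = E[α].resp x≈y (Adjoin⊆E[α] x)

      -- Dividing by Xⁿ - q, whose coefficients are rational, keeps the remainder l over E. The
      -- relation l(α) - ζ = 0 has coefficients in ℚ(ζ) and at most n of them, so all vanish and ζ
      -- is the constant coefficient of l.
      ζ∈E : ∀ {d} → n ℕ.≤ d → (∀ l → length l ℕ.≤ d → All ℚ[ζ] l → eval l α ≈ 0# → All (_≈ 0#) l) → E[α] ζ → E ζ
      ζ∈E {d} n≤d minimal (h , h∈ , ζ≈h) =
        let u , l , _ , l≤ , l∈ , e = Over.divide E-isSubring (binomialPoly-monic {n} (ι q) (s≤s z≤n))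
                                        (Over.binomialPoly∈ E-isSubring n (ℚ⊆E (rational-ι q))) h∈
        in conclude l l∈ (minimal ((- ζ ∷ []) ⊕ l)
             (length-⊕ (- ζ ∷ []) l (ℕ.≤-trans (s≤s z≤n) n≤d) (ℕ.≤-trans l≤ n≤d))
             (Over.⊕∈ ℚ[ζ]-isSubring (ℚζ.-∈ ζ∈ℚ[ζ] ∷ []) (All.map E⊆ℚ[ζ] l∈))
             (≈-trans (eval-⊕ (- ζ ∷ []) l α) (≈-trans (+-congʳ (eval-const (- ζ) α)) (≈-trans (+-comm _ _) (x≈y⇒x-y≈0 (begin
               eval l α ≈⟨ +-identityˡ _ ⟨
               0# + eval l α ≈⟨ +-congʳ (≈-trans (*-congʳ
                                                                             (≈-trans (eval-binomialPoly n (ι q) α) (x≈y⇒x-y≈0 αⁿ≈q))) (zeroˡ _)) ⟨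
               eval (binomialPoly n (ι q)) α * eval u α + eval l α ≈⟨ e α ⟨
               eval h α ≈⟨ ζ≈h ⟨
               ζ ∎))))))
        where
        conclude : ∀ l → All E l → All (_≈ 0#) ((- ζ ∷ []) ⊕ l) → E ζ
        conclude [] _ (e ∷ []) = contradiction (neg≈0⇒≈0 e) ζ≉0
        conclude (l₀ ∷ _) (l₀∈ ∷ _) (e ∷ _) = IsSubring.resp E-isSubring (x-y≈0⇒x≈y (≈-trans (+-comm _ _) e)) l₀∈

      0<m : 0 ℕ.< m
      0<m = ℕ.n≢0⇒n>0 λ m≡0 → ℕ.1+n≢0 (≡.trans n≡mr (cong (ℕ._* r) m≡0))

      r≢2 : r ≢ 2
      r≢2 refl = ℕ.even≢odd m k (≡.trans (ℕ.*-comm 2 m) (≡.sym n≡mr))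

      n≡rm : n ≡ r ℕ.* m
      n≡rm = ≡.trans n≡mr (ℕ.*-comm m r)

      ζ∉E : ¬ E ζ
      ζ∉E (h , h∈ , ζ≈h) = let j , 0<j , j<r , coprime = unit-congruent-1 r-prime r≢2 0<m in
        refute j 0<j j<r λ {ℓ} ℓ-prime ℓ∣t ℓ∣n → coprime ℓ-prime ℓ∣t (subst (ℓ ∣_) n≡rm ℓ∣n)
        where
        -- If ζ = h(ζʳ), then h(Xʳ) - X vanishes at ζ and so at ζᵗ. For t = 1 + jm the r-th powers
        -- of ζᵗ and ζ coincide, because rm = n; this gives ζᵗ = ζ and ζ to the power jm equal to 1,
        -- with 0 < jm < n.
        composed = Q.compose h∈ (Q.monomial∈ r Q.1∈)
        relation = proj₁ composed ⊕ ⊖ monomial 1 1#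
        relation≈ : ∀ x → eval relation x ≈ eval h (x ^ r) - x
        relation≈ x = ≈-trans (eval-minus (proj₁ composed) (monomial 1 1#) x)
          (+-cong (≈-trans (proj₂ (proj₂ composed) x) (eval-congʳ h (≈-trans (eval-monomial r 1# x) (*-identityˡ _))))
            (-‿cong (≈-trans (eval-monomial 1 1# x) (solve 1 (λ x → con (+ 1) :* (x :* con (+ 1)) := x) ≈-refl x))))
        refute : ∀ j → 0 ℕ.< j → j ℕ.< r → (∀ {ℓ} → Prime ℓ → ℓ ∣ suc (j ℕ.* m) → ℓ ∤ n) → ⊥
        refute j 0<j j<r coprime = distinct {0} {j ℕ.* m} (ℕ.*-mono-< 0<j 0<m) jm<n (*-cancelˡ ζ≉0 (begin
            ζ * 1# ≈⟨ *-identityʳ ζ ⟩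
            ζ ≈⟨ ζ≈h ⟩
            eval h (ζ ^ r) ≈⟨ eval-congʳ h ζᵗʳ≈ζʳ ⟨
            eval h ((ζ ^ t) ^ r) ≈⟨ x-y≈0⇒x≈y (≈-trans (≈-sym (relation≈ (ζ ^ t)))
                                           (relation-^coprime {n-1} ζⁿ≈1 (j ℕ.* m) coprime
                                             (Q.⊕∈ (proj₁ (proj₂ composed)) (Q.⊖∈ (Q.monomial∈ 1 Q.1∈)))
                                             (≈-trans (relation≈ ζ) (x≈y⇒x-y≈0 (≈-sym ζ≈h))))) ⟩
            ζ * ζ ^ (j ℕ.* m) ∎))
          where
          t = suc (j ℕ.* m)
          jm<n : j ℕ.* m ℕ.< n
          jm<n = subst (j ℕ.* m ℕ.<_) (≡.sym n≡rm) (ℕ.*-monoˡ-< m {{ℕ.>-nonZero 0<m}} j<r)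
          ζᵗʳ≈ζʳ : (ζ ^ t) ^ r ≈ ζ ^ r
          ζᵗʳ≈ζʳ = begin
            (ζ ^ t) ^ r ≈⟨ ^-assocʳ ζ t r ⟩
            ζ ^ (t ℕ.* r) ≈⟨ ^-congʳ ζ tr≡ ⟩
            ζ ^ (j ℕ.* n ℕ.+ r) ≈⟨ ^-periodic {n-1} ζⁿ≈1 distinct j r ⟩
            ζ ^ r ∎
            where
            tr≡ : t ℕ.* r ≡ j ℕ.* n ℕ.+ r
            tr≡ = ≡.trans (ℕ.+-comm r _) (cong (ℕ._+ r) (≡.trans (ℕ.*-assoc j m r) (cong (j ℕ.*_) (≡.sym n≡mr))))

  -- Integer powers

  inverseʳ : ∀ {x} → x ≉ 0# → x * inverse ℚ̄ x ≈ 1#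
  inverseʳ {x} x≉0 with x #? 0#
  ... | yes x#0 = #⇒inverse x#0
  ... | no ¬x#0 = contradiction (≉0⇒# x≉0) ¬x#0

  module _ {ζ} (ζ≉0 : ζ ≉ 0#) where

    -- A factor ζᵐ with b + m ≥ 0 clears a negative exponent. The laws for integer exponents then
    -- follow from those for natural ones, without comparing signs.
    power-shift : ∀ b m j → b ℤ.+ (+ m) ≡ + j → power ℚ̄ ζ b * ζ ^ m ≈ ζ ^ j
    power-shift (+ b)    m j e = ≈-trans (≈-sym (^-homo-* ζ b m)) (^-congʳ ζ (ℤ.+-injective e))
    power-shift -[1+ b ] m j e = begin
      inverse ℚ̄ ζ ^ suc b * ζ ^ m ≈⟨ *-congˡ (^-congʳ ζ m≡) ⟩
      inverse ℚ̄ ζ ^ suc b * ζ ^ (suc b ℕ.+ j) ≈⟨ *-congˡ (^-homo-* ζ (suc b) j) ⟩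
      inverse ℚ̄ ζ ^ suc b * (ζ ^ suc b * ζ ^ j) ≈⟨ solve 3 (λ u v w → u :* (v :* w) := (v :* u) :* w) ≈-refl (inverse ℚ̄ ζ ^ suc b) (ζ ^ suc b) (ζ ^ j) ⟩
      (ζ ^ suc b * inverse ℚ̄ ζ ^ suc b) * ζ ^ j ≈⟨ *-congʳ (^-distrib-* ζ (inverse ℚ̄ ζ) (suc b)) ⟨
      (ζ * inverse ℚ̄ ζ) ^ suc b * ζ ^ j ≈⟨ *-congʳ (≈-trans (^-congˡ (suc b) (inverseʳ ζ≉0)) (1^n (suc b))) ⟩
      1# * ζ ^ j ≈⟨ *-identityˡ _ ⟩
      ζ ^ j ∎
      where
      m≡ : m ≡ suc b ℕ.+ j
      m≡ = ℤ.+-injective (≡.trans (≡.sym (ℤ.+-identityˡ (+ m))) (≡.trans (cong (ℤ._+ + m) (≡.sym (ℤ.+-inverseʳ (+ suc b))))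
        (≡.trans (ℤ.+-assoc (+ suc b) -[1+ b ] (+ m)) (cong (ℤ._+_ (+ suc b)) e))))

    shift : ∀ b → ∃[ m ] ∃[ j ] b ℤ.+ (+ m) ≡ + j
    shift (+ b)    = 0 , b , cong +_ (ℕ.+-identityʳ b)
    shift -[1+ b ] = suc b , 0 , ℤ.+-inverseˡ (+ suc b)

    power-+ : ∀ b d → power ℚ̄ ζ (b ℤ.+ d) ≈ power ℚ̄ ζ b * power ℚ̄ ζ d
    power-+ b d = let m , j , e = shift b ; m′ , j′ , e′ = shift d in go m j e m′ j′ e′
      where
      go : ∀ m j → b ℤ.+ (+ m) ≡ + j → ∀ m′ j′ → d ℤ.+ (+ m′) ≡ + j′ → power ℚ̄ ζ (b ℤ.+ d) ≈ power ℚ̄ ζ b * power ℚ̄ ζ d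
      go m j e m′ j′ e′ = *-cancelˡ (^-≉0 (m ℕ.+ m′) ζ≉0) (begin
        ζ ^ (m ℕ.+ m′) * power ℚ̄ ζ (b ℤ.+ d) ≈⟨ *-comm _ _ ⟩
        power ℚ̄ ζ (b ℤ.+ d) * ζ ^ (m ℕ.+ m′) ≈⟨ power-shift (b ℤ.+ d) (m ℕ.+ m′) (j ℕ.+ j′) e″ ⟩
        ζ ^ (j ℕ.+ j′) ≈⟨ ^-homo-* ζ j j′ ⟩
        ζ ^ j * ζ ^ j′ ≈⟨ *-cong (power-shift b m j e) (power-shift d m′ j′ e′) ⟨
        (power ℚ̄ ζ b * ζ ^ m) * (power ℚ̄ ζ d * ζ ^ m′) ≈⟨ solve 4 (λ u v w x → (u :* v) :* (w :* x) := (v :* x) :* (u :* w)) ≈-refl (power ℚ̄ ζ b) (ζ ^ m) (power ℚ̄ ζ d) (ζ ^ m′) ⟩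
        (ζ ^ m * ζ ^ m′) * (power ℚ̄ ζ b * power ℚ̄ ζ d) ≈⟨ *-congʳ (^-homo-* ζ m m′) ⟨
        ζ ^ (m ℕ.+ m′) * (power ℚ̄ ζ b * power ℚ̄ ζ d) ∎)
        where
        e″ : (b ℤ.+ d) ℤ.+ + (m ℕ.+ m′) ≡ + (j ℕ.+ j′)
        e″ = ≡.trans (ℤ+.interchange b d (+ m) (+ m′)) (cong₂ ℤ._+_ e e′)
          where module ℤ+ = CommutativeSemigroupProperties ℤ.+-commutativeSemigroup

    power-neg : ∀ b → power ℚ̄ ζ b * power ℚ̄ ζ (ℤ.- b) ≈ 1#
    power-neg b = ≈-trans (≈-sym (power-+ b (ℤ.- b))) (≈-reflexive (cong (power ℚ̄ ζ) (ℤ.+-inverseʳ b)))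

    power-period : ∀ {n} → ζ ^ n ≈ 1# → ∀ z → power ℚ̄ ζ (z ℤ.* + n) ≈ 1#
    power-period {n} ζⁿ≈1 (+ t) = ≈-trans (≈-reflexive (cong (power ℚ̄ ζ) (≡.sym (ℤ.pos-* t n)))) (≈-trans (≈-sym (^-assocʳ ζ t n)) (^-unity {n} t ζⁿ≈1))
    power-period {n} ζⁿ≈1 -[1+ t ] = begin
      power ℚ̄ ζ (-[1+ t ] ℤ.* + n) ≈⟨ ≈-reflexive (cong (power ℚ̄ ζ) (≡.sym (ℤ.neg-distribˡ-* (+ suc t) (+ n)))) ⟩
      power ℚ̄ ζ (ℤ.- (+ suc t ℤ.* + n)) ≈⟨ *-identityˡ _ ⟨
      1# * power ℚ̄ ζ (ℤ.- (+ suc t ℤ.* + n)) ≈⟨ *-congʳ (power-period {n} ζⁿ≈1 (+ suc t)) ⟨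
      power ℚ̄ ζ (+ suc t ℤ.* + n) * power ℚ̄ ζ (ℤ.- (+ suc t ℤ.* + n)) ≈⟨ power-neg (+ suc t ℤ.* + n) ⟩
      1# ∎

    power-residue : ∀ {n-1} → ζ ^ suc n-1 ≈ 1# → ∀ b → power ℚ̄ ζ b ≈ ζ ^ (b ℤ.%ℕ suc n-1)
    power-residue {n-1} ζⁿ≈1 b = begin
      power ℚ̄ ζ b
        ≈⟨ ≈-reflexive (cong (power ℚ̄ ζ) (ℤ.a≡a%ℕn+[a/ℕn]*n b n)) ⟩
      power ℚ̄ ζ (+ (b ℤ.%ℕ n) ℤ.+ (b ℤ./ℕ n) ℤ.* + n)
        ≈⟨ power-+ (+ (b ℤ.%ℕ n)) ((b ℤ./ℕ n) ℤ.* + n) ⟩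
      ζ ^ (b ℤ.%ℕ n) * power ℚ̄ ζ ((b ℤ./ℕ n) ℤ.* + n)
        ≈⟨ *-congˡ (power-period {n} ζⁿ≈1 (b ℤ./ℕ n)) ⟩
      ζ ^ (b ℤ.%ℕ n) * 1#
        ≈⟨ *-identityʳ _ ⟩
      ζ ^ (b ℤ.%ℕ n) ∎
      where n = suc n-1

  -- Generating sets of roots.

  module Generation {k} (0<k : 0 ℕ.< k) {ζ : Carrier} (ζ-primitive : IsPrimitiveRootOfUnity ℚ̄ (suc (2 ℕ.* k)) ζ)
    {q} (irreducible : ℚ[X].Irreducible (binomial (suc (2 ℕ.* k)) q))
    {a : Carrier} (a>0 : Positive a) (a-root : Root ℚ̄ (binomial (suc (2 ℕ.* k)) q) a) where

    private
      n-1 = 2 ℕ.* k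
      n = suc n-1
      f = binomial n q

    1<n : 1 ℕ.< n
    1<n = s≤s (ℕ.≤-trans 0<k (ℕ.m≤m+n k _))

    ζⁿ≈1 : ζ ^ n ≈ 1#
    ζⁿ≈1 = proj₁ ζ-primitive

    distinct : ∀ {i j} → i ℕ.< j → j ℕ.< n → ζ ^ i ≉ ζ ^ j
    distinct = primitive-distinct ζ-primitive (s≤s z≤n)

    Root⇒^ : ∀ {x} → Root ℚ̄ f x → x ^ n ≈ ι q
    Root⇒^ {x} x-root = x-y≈0⇒x≈y (≈-trans (≈-sym (evalℚ-binomial n q x)) x-root)

    ^⇒Root : ∀ {x} → x ^ n ≈ ι q → Root ℚ̄ f x
    ^⇒Root {x} e = ≈-trans (evalℚ-binomial n q x) (x≈y⇒x-y≈0 e)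

    open Radical {k} ζⁿ≈1 distinct irreducible a>0 (Root⇒^ a-root) using (a≉0; ζ≉0; aζʲ-root; ζ∉Adjoin)

    root : ℤ → Carrier
    root b = a * power ℚ̄ ζ b

    residue : ℤ → ℕ
    residue b = b ℤ.%ℕ n

    power≈ : ∀ b → power ℚ̄ ζ b ≈ ζ ^ residue b
    power≈ = power-residue ζ≉0 {n-1} ζⁿ≈1

    root-Root : ∀ b → Root ℚ̄ f (root b)
    root-Root b = ^⇒Root (≈-trans (^-congˡ n (*-congˡ (power≈ b))) (aζʲ-root (residue b)))

    Root⇒root : ∀ {x} → Root ℚ̄ f x → ∃[ j ] j ℕ.< n × x ≈ root (+ j)
    Root⇒root {x} x-root = let j , j<n , e = root-of-unity-power {n-1} ζⁿ≈1 distinct quotientⁿ≈1 in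
      j , j<n , (begin
        x ≈⟨ *-identityʳ x ⟨
        x * 1# ≈⟨ *-congˡ aa⁻¹≈1 ⟨
        x * (a * a⁻¹) ≈⟨ solve 3 (λ x a b → x :* (a :* b) := a :* (x :* b)) ≈-refl x a a⁻¹ ⟩
        a * (x * a⁻¹) ≈⟨ *-congˡ e ⟩
        a * ζ ^ j ∎)
      where
      a⁻¹ = proj₁ (invertible a≉0)
      aa⁻¹≈1 : a * a⁻¹ ≈ 1#
      aa⁻¹≈1 = proj₂ (invertible a≉0)
      quotientⁿ≈1 : (x * a⁻¹) ^ n ≈ 1#
      quotientⁿ≈1 = begin
        (x * a⁻¹) ^ n ≈⟨ ^-distrib-* x a⁻¹ n ⟩
        x ^ n * a⁻¹ ^ n ≈⟨ *-congʳ (≈-trans (Root⇒^ x-root) (≈-sym (Root⇒^ a-root))) ⟩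
        a ^ n * a⁻¹ ^ n ≈⟨ ^-distrib-* a a⁻¹ n ⟨
        (a * a⁻¹) ^ n ≈⟨ ^-congˡ n aa⁻¹≈1 ⟩
        1# ^ n ≈⟨ 1^n n ⟩
        1# ∎

    root-injective : ∀ {i j} → i ℕ.< n → j ℕ.< n → root (+ i) ≈ root (+ j) → i ≡ j
    root-injective {i} {j} i<n j<n e with ℕ.<-cmp i j
    ... | tri< i<j _ _ = contradiction (*-cancelˡ a≉0 e) (distinct i<j j<n)
    ... | tri≈ _ i≡j _ = i≡j
    ... | tri> _ _ j<i = contradiction (≈-sym (*-cancelˡ a≉0 e)) (distinct j<i i<n)

    -- Brings roots whose exponents agree modulo r into the form required by `ζ∉Adjoin`. The
    -- quotient (b′ - b) / r is replaced by its residue modulo n, so that the power of ζʳ is a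
    -- natural one.
    root-congruent : ∀ {r} b b′ → + r ∣ℤ b′ ℤ.- b → ∃[ e ] root b′ ≈ (a * ζ ^ residue b) * ζ ^ (r ℕ.* e)
    root-congruent {r} b b′ (dividesℤ z b′-b≡zr) = e , (begin
      a * power ℚ̄ ζ b′ ≈⟨ *-congˡ (≈-reflexive (cong (power ℚ̄ ζ) b′≡)) ⟩
      a * power ℚ̄ ζ (b ℤ.+ (+ (r ℕ.* e) ℤ.+ d ℤ.* + r ℤ.* + n)) ≈⟨ *-congˡ (≈-trans (power-+ ζ≉0 b (+ (r ℕ.* e) ℤ.+ d ℤ.* + r ℤ.* + n))
                                                                  (*-cong (power≈ b) (power-+ ζ≉0 (+ (r ℕ.* e)) (d ℤ.* + r ℤ.* + n)))) ⟩
      a * (ζ ^ residue b * (ζ ^ (r ℕ.* e) * power ℚ̄ ζ (d ℤ.* + r ℤ.* + n)))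
        ≈⟨ *-congˡ (*-congˡ (*-congˡ (power-period ζ≉0 {n} ζⁿ≈1 (d ℤ.* + r)))) ⟩
      a * (ζ ^ residue b * (ζ ^ (r ℕ.* e) * 1#))
        ≈⟨ solve 3 (λ a u v → a :* (u :* (v :* con (+ 1))) := (a :* u) :* v) ≈-refl a (ζ ^ residue b) (ζ ^ (r ℕ.* e)) ⟩
      (a * ζ ^ residue b) * ζ ^ (r ℕ.* e) ∎)
      where
      e = z ℤ.%ℕ n
      d = z ℤ./ℕ n
      zr≡ : z ℤ.* + r ≡ + (r ℕ.* e) ℤ.+ d ℤ.* + r ℤ.* + n
      zr≡ = ≡.trans (cong (ℤ._* + r) (ℤ.a≡a%ℕn+[a/ℕn]*n z n))
        (≡.trans (ℤ.*-distribʳ-+ (+ r) (+ e) (d ℤ.* + n))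
          (cong₂ ℤ._+_ (≡.trans (≡.sym (ℤ.pos-* e r)) (cong +_ (ℕ.*-comm e r)))
            (≡.trans (ℤ.*-assoc d (+ n) (+ r)) (≡.trans (cong (d ℤ.*_) (ℤ.*-comm (+ n) (+ r))) (≡.sym (ℤ.*-assoc d (+ r) (+ n)))))))
      b′≡ : b′ ≡ b ℤ.+ (+ (r ℕ.* e) ℤ.+ d ℤ.* + r ℤ.* + n)
      b′≡ = ≡.trans (≡.sym (i+[j-i]≡j b b′)) (cong (ℤ._+_ b) (≡.trans b′-b≡zr zr≡))

    Adjoin-least : ∀ {s t} {S : Pred Carrier s} {T : Pred Carrier t} → S ⊆ Adjoin ℚ̄ T → Adjoin ℚ̄ S ⊆ Adjoin ℚ̄ T
    Adjoin-least S⊆ (generator x∈)   = S⊆ x∈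
    Adjoin-least S⊆ (rational q)     = rational q
    Adjoin-least S⊆ (add x y)        = add (Adjoin-least S⊆ x) (Adjoin-least S⊆ y)
    Adjoin-least S⊆ (negate x)       = negate (Adjoin-least S⊆ x)
    Adjoin-least S⊆ (multiply x y)   = multiply (Adjoin-least S⊆ x) (Adjoin-least S⊆ y)
    Adjoin-least S⊆ (invert x xy≈1)  = invert (Adjoin-least S⊆ x) xy≈1
    Adjoin-least S⊆ (respect x≈y x)  = respect x≈y (Adjoin-least S⊆ x)

    module _ {s} {S : Pred Carrier s} where

      divideˡ : ∀ {x y z} → x ∈ Adjoin ℚ̄ S → x ≉ 0# → x * y ≈ z → z ∈ Adjoin ℚ̄ S → y ∈ Adjoin ℚ̄ S
      divideˡ {x} {y} {z} x∈ x≉0 xy≈z z∈ = let w , xw≈1 = invertible x≉0 in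
        respect (begin
          w * z ≈⟨ *-congˡ xy≈z ⟨
          w * (x * y) ≈⟨ solve 3 (λ w x y → w :* (x :* y) := (x :* w) :* y) ≈-refl w x y ⟩
          (x * w) * y ≈⟨ *-congʳ xw≈1 ⟩
          1# * y ≈⟨ *-identityˡ y ⟩
          y ∎) (multiply (invert x∈ xw≈1) z∈)

      1∈Adjoin : 1# ∈ Adjoin ℚ̄ S
      1∈Adjoin = respect ι-1 (rational 1ℚ)

      ^∈Adjoin : ∀ {x} m → x ∈ Adjoin ℚ̄ S → x ^ m ∈ Adjoin ℚ̄ S
      ^∈Adjoin zero    x∈ = 1∈Adjoin
      ^∈Adjoin (suc m) x∈ = multiply x∈ (^∈Adjoin m x∈)

      private
        Exponent : Pred ℤ _
        Exponent b = power ℚ̄ ζ b ∈ Adjoin ℚ̄ S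

      exponent-∣∣ : ∀ b → Exponent b → Exponent (+ ℤ.∣ b ∣)
      exponent-∣∣ (+ b)    b∈ = b∈
      exponent-∣∣ -[1+ b ] b∈ = invert b∈ (power-neg ζ≉0 -[1+ b ])

      exponent-bézout : ∀ {d x y i j} → d ℕ.+ y ℕ.* j ≡ x ℕ.* i → ζ ^ i ∈ Adjoin ℚ̄ S → ζ ^ j ∈ Adjoin ℚ̄ S → ζ ^ d ∈ Adjoin ℚ̄ S
      exponent-bézout {d} {x} {y} {i} {j} eq i∈ j∈ = divideˡ (^∈Adjoin y j∈) (^-≉0 y (^-≉0 j ζ≉0)) (begin
          (ζ ^ j) ^ y * ζ ^ d ≈⟨ *-comm _ _ ⟩
          ζ ^ d * (ζ ^ j) ^ y ≈⟨ *-congˡ (≈-trans (^-assocʳ ζ j y) (^-congʳ ζ (ℕ.*-comm j y))) ⟩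
          ζ ^ d * ζ ^ (y ℕ.* j) ≈⟨ ^-homo-* ζ d (y ℕ.* j) ⟨
          ζ ^ (d ℕ.+ y ℕ.* j) ≈⟨ ^-congʳ ζ (≡.trans eq (ℕ.*-comm x i)) ⟩
          ζ ^ (i ℕ.* x) ≈⟨ ^-assocʳ ζ i x ⟨
          (ζ ^ i) ^ x ∎) (^∈Adjoin x i∈)

      -- The exponents b for which ζᵇ lies in a given field form a subgroup of ℤ, so Bézout's
      -- identity gives closure under gcd.
      exponent-gcd : ∀ i j → Exponent i → Exponent j → Exponent (ℤ.gcd i j)
      exponent-gcd i j i∈ j∈ = go (Bézout.identity (gcd-GCD ℤ.∣ i ∣ ℤ.∣ j ∣))
        where
        go : Bézout.Identity (gcd ℤ.∣ i ∣ ℤ.∣ j ∣) ℤ.∣ i ∣ ℤ.∣ j ∣ → Exponent (ℤ.gcd i j)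
        go (Bézout.+- x y eq) = exponent-bézout {x = x} {y} {ℤ.∣ i ∣} {ℤ.∣ j ∣} eq (exponent-∣∣ i i∈) (exponent-∣∣ j j∈)
        go (Bézout.-+ x y eq) = exponent-bézout {x = y} {x} {ℤ.∣ j ∣} {ℤ.∣ i ∣} eq (exponent-∣∣ j j∈) (exponent-∣∣ i i∈)

      exponent-gcd-fold : ∀ {m} (v : Vector ℤ m) → (∀ i → Exponent (v i)) → Exponent (Vector.foldr ℤ.gcd (+ n) v)
      -- The fold starts from n, an admissible exponent because ζⁿ = 1.
      exponent-gcd-fold {zero}  v v∈ = respect (≈-sym ζⁿ≈1) 1∈Adjoin
      exponent-gcd-fold {suc m} v v∈ = exponent-gcd (v Fin.zero) (Vector.foldr ℤ.gcd (+ n) (v ∘ Fin.suc)) (v∈ Fin.zero) (exponent-gcd-fold (v ∘ Fin.suc) (v∈ ∘ Fin.suc))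

      exponent-difference : ∀ b b′ → root b ∈ Adjoin ℚ̄ S → root b′ ∈ Adjoin ℚ̄ S → Exponent (b′ ℤ.- b)
      exponent-difference b b′ b∈ b′∈ = divideˡ b∈ (*-≉0 a≉0 (invertible⇒≉0 (power-neg ζ≉0 b))) (begin
          (a * power ℚ̄ ζ b) * power ℚ̄ ζ (b′ ℤ.- b) ≈⟨ *-assoc _ _ _ ⟩
          a * (power ℚ̄ ζ b * power ℚ̄ ζ (b′ ℤ.- b)) ≈⟨ *-congˡ (power-+ ζ≉0 b (b′ ℤ.- b)) ⟨
          a * power ℚ̄ ζ (b ℤ.+ (b′ ℤ.- b)) ≈⟨ *-congˡ (≈-reflexive (cong (power ℚ̄ ζ) (i+[j-i]≡j b b′))) ⟩
          a * power ℚ̄ ζ b′ ∎) b′∈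

      generating : ∀ {b} → S ⊆ Root ℚ̄ f → root b ∈ Adjoin ℚ̄ S → ζ ∈ Adjoin ℚ̄ S → Adjoin ℚ̄ S ≐ SplittingField ℚ̄ f
      generating {b} S⊆ root∈ ζ∈ = Adjoin-least (generator ∘ S⊆) , Adjoin-least λ x-root →
        let j , _ , e = Root⇒root x-root in respect (≈-sym e) (multiply a∈ (^∈Adjoin j ζ∈))
        where
        power∈ : power ℚ̄ ζ b ∈ Adjoin ℚ̄ S
        power∈ = respect (≈-sym (power≈ b)) (^∈Adjoin (residue b) ζ∈)
        a∈ : a ∈ Adjoin ℚ̄ S
        a∈ = divideˡ power∈ (invertible⇒≉0 (power-neg ζ≉0 b)) (*-comm _ _) root∈

    ζ∈SplittingField : ζ ∈ SplittingField ℚ̄ f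
    ζ∈SplittingField = divideˡ (generator a-root) a≉0 (*-congˡ (≈-sym (*-identityʳ ζ))) (generator (root-Root (+ 1)))

    -- The splitting field contains ζ as the quotient of aζ by a, but by `ζ∉Adjoin` a set with
    -- exponents congruent modulo r does not generate ζ.
    not-generating : ∀ {s} {S : Pred Carrier s} {r} → Prime r → r ∣ n → ∀ b →
      (∀ {x} → S x → ∃[ b′ ] + r ∣ℤ b′ ℤ.- b × x ≈ root b′) → ¬ (Adjoin ℚ̄ S ≐ SplittingField ℚ̄ f)
    not-generating {S = S} {r} r-prime r∣n b S⊆ (_ , ⊇) = ζ∉Adjoin {S = S} r-prime r∣n (residue b)
      (λ x∈ → let b′ , r∣ , x≈ = S⊆ x∈ ; e , root≈ = root-congruent b b′ r∣ in e , ≈-trans x≈ root≈) (⊇ ζ∈SplittingField)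

    -- Stated for any C with the same elements as the family, because the counting argument meets
    -- sets that are only extensionally equal to a pair of roots.
    generating⇔ : ∀ (C : SubsetOf ℚ̄) {m} (b : Vector ℤ (suc m)) → (∀ i → root (b i) ∈ member C) →
      (∀ {x} → x ∈ member C → ∃[ i ] x ≈ root (b i)) → IsGeneratingSet ℚ̄ f C ⇔ gcdDifferences n b ≡ 1ℤ
    generating⇔ C b root∈ ∈root = mk⇔ to from
      where
      to : IsGeneratingSet ℚ̄ f C → gcdDifferences n b ≡ 1ℤ
      to (_ , gen) = decidable-stable (gcdDifferences n b ℤ.≟ 1ℤ) λ g≢1 →
        let r , r-prime , r∣n , r∣ = gcdDifferences≢1⇒prime {n} (λ ()) b g≢1
        in not-generating {S = member C} r-prime r∣n (b Fin.zero) (λ x∈ → let i , x≈ = ∈root x∈ in b i , r∣ i , x≈) gen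
      from : gcdDifferences n b ≡ 1ℤ → IsGeneratingSet ℚ̄ f C
      from g≡1 = C⊆Root , generating {S = member C} {b Fin.zero} C⊆Root (generator (root∈ Fin.zero)) (respect (*-identityʳ ζ)
        (subst (λ g → power ℚ̄ ζ g ∈ Adjoin ℚ̄ (member C)) g≡1 (exponent-gcd-fold (λ i → b (Fin.suc i) ℤ.- b Fin.zero)
          λ i → exponent-difference (b Fin.zero) (b (Fin.suc i)) (generator (root∈ Fin.zero)) (generator (root∈ (Fin.suc i))))))
        where
        C⊆Root : member C ⊆ Root ℚ̄ f
        C⊆Root x∈ = let i , x≈ = ∈root x∈ in ^⇒Root (≈-trans (^-congˡ n x≈) (Root⇒^ (root-Root (b i))))

    generating⇔gcd≡1 : ∀ {m} (b : Vector ℤ (suc m)) → IsGeneratingSet ℚ̄ f (range ℚ̄ (λ i → root (b i))) ⇔ gcdDifferences n b ≡ 1ℤ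
    generating⇔gcd≡1 b = generating⇔ (range ℚ̄ (λ i → root (b i))) b (λ i → i , ≈-refl) id

    ¬¬-∀ : ∀ {m s} {P : Fin m → Set s} → (∀ i → ¬ ¬ P i) → ¬ ¬ (∀ i → P i)
    ¬¬-∀ {zero}  ¬¬P none = none λ ()
    ¬¬-∀ {suc m} ¬¬P none = ¬¬P Fin.zero λ p₀ → ¬¬-∀ (¬¬P ∘ Fin.suc) λ ps → none λ { Fin.zero → p₀ ; (Fin.suc i) → ps i }

    -- A proper subset A need not come with a specified missing root, as membership in A is
    -- undecidable. The goal is a negation and the family finite, so it is enough to refute the
    -- omission of each single root.
    minimal : ∀ {m} (x : Vector Carrier m) →
      (∀ i (A : SubsetOf ℚ̄) → (∀ {y} → y ∈ member A → ∃[ j ] j ≢ i × y ≈ x j) → ¬ (Adjoin ℚ̄ (member A) ≐ SplittingField ℚ̄ f)) →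
      ∀ (A : SubsetOf ℚ̄) → member A ⊂ member (range ℚ̄ x) → ¬ (Adjoin ℚ̄ (member A) ≐ SplittingField ℚ̄ f)
    minimal x omit A (A⊆ , ¬⊆A) gen = ¬¬-∀ {P = λ i → x i ∈ member A}
      (λ i xᵢ∉A → omit i A (λ y∈A → let j , y≈xⱼ = A⊆ y∈A in j , (λ { refl → xᵢ∉A (respects A y≈xⱼ y∈A) }) , y≈xⱼ) gen)
      (λ x∈A → ¬⊆A λ { (i , y≈xᵢ) → respects A (≈-sym y≈xᵢ) (x∈A i) })

    private
      prime-factor = prime-divisor {n} (λ ()) (λ e → ℕ.<⇒≢ 1<n (≡.sym e))

    -- With at most one root present all differences are 0, so any prime divisor of n > 1 is an
    -- obstruction. The set may be empty.
    singleton-not-generating : ∀ {s} {S : Pred Carrier s} b → (∀ {x} → S x → x ≈ root b) → ¬ (Adjoin ℚ̄ S ≐ SplittingField ℚ̄ f)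
    singleton-not-generating {S = S} b S⊆ = let r , r-prime , r∣n = prime-factor in
      not-generating {S = S} r-prime r∣n b λ x∈ → b , subst (+ r ∣ℤ_) (≡.sym (ℤ.+-inverseʳ b)) (∣ᵤ⇒∣ (r ∣0)) , S⊆ x∈

    minimal-cardinality≥2 : ∀ D m → IsMinimalGeneratingSet ℚ̄ f D → HasCardinality _≈_ (member D) m → 2 ℕ.≤ m
    minimal-cardinality≥2 D zero ((_ , gen) , _) (_ , _ , _ , onto) =
      contradiction gen (singleton-not-generating {S = member D} (+ 0) λ x∈ → ⊥-elim (Fin.¬Fin0 (proj₁ (onto x∈))))
    minimal-cardinality≥2 D (suc zero) ((D⊆ , gen) , _) (e , e∈ , _ , onto) =
      let j , _ , e₀≈ = Root⇒root (D⊆ (e∈ Fin.zero)) in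
      contradiction gen (singleton-not-generating {S = member D} (+ j) λ x∈ → ≈-trans (only (onto x∈)) e₀≈)
      where
      only : ∀ {x} → ∃[ i ] x ≈ e i → x ≈ e Fin.zero
      only (Fin.zero , x≈) = x≈
    minimal-cardinality≥2 D (suc (suc m)) _ _ = s≤s (s≤s z≤n)

    pair : ℕ → ℕ → SubsetOf ℚ̄
    pair k l = range ℚ̄ (root (+ k) Vector.∷ root (+ l) Vector.∷ Vector.[])

    pair-cardinality : ∀ {k l} → k ℕ.< l → l ℕ.< n → HasCardinality _≈_ (member (pair k l)) 2
    pair-cardinality {k} {l} k<l l<n = _ , (λ i → i , ≈-refl) , (λ {i} {j} → injective i j) , id
      where
      k≢l : root (+ k) ≉ root (+ l)
      k≢l e = ℕ.<⇒≢ k<l (root-injective (ℕ.<-trans k<l l<n) l<n e)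
      injective : ∀ i j → (root (+ k) Vector.∷ root (+ l) Vector.∷ Vector.[]) i ≈ (root (+ k) Vector.∷ root (+ l) Vector.∷ Vector.[]) j → i ≡ j
      injective Fin.zero           Fin.zero           _ = refl
      injective Fin.zero           (Fin.suc Fin.zero) e = contradiction e k≢l
      injective (Fin.suc Fin.zero) Fin.zero           e = contradiction (≈-sym e) k≢l
      injective (Fin.suc Fin.zero) (Fin.suc Fin.zero) _ = refl

    pair-generating⇔ : ∀ (C : SubsetOf ℚ̄) {k l} → k ℕ.≤ l → _≐ₛ_ ℚ̄ C (pair k l) → IsGeneratingSet ℚ̄ f C ⇔ gcd (l ℕ.∸ k) n ≡ 1
    pair-generating⇔ C {k} {l} k≤l (C⊆ , ⊆C) = mk⇔
      (λ gen → ℤ.+-injective (≡.trans (≡.sym (gcdDifferences-pair n k≤l)) (Equivalence.to equivalence gen)))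
      (λ e → Equivalence.from equivalence (≡.trans (gcdDifferences-pair n k≤l) (cong +_ e)))
      where
      b : Vector ℤ 2
      b = + k Vector.∷ + l Vector.∷ Vector.[]
      root∈ : ∀ i → root (b i) ∈ member C
      root∈ Fin.zero           = ⊆C (Fin.zero , ≈-refl)
      root∈ (Fin.suc Fin.zero) = ⊆C (Fin.suc Fin.zero , ≈-refl)
      ∈root : ∀ {x} → ∃[ i ] x ≈ (root (+ k) Vector.∷ root (+ l) Vector.∷ Vector.[]) i → ∃[ i ] x ≈ root (b i)
      ∈root (Fin.zero , e)         = Fin.zero , e
      ∈root (Fin.suc Fin.zero , e) = Fin.suc Fin.zero , e
      equivalence : IsGeneratingSet ℚ̄ f C ⇔ gcdDifferences n b ≡ 1ℤ
      equivalence = generating⇔ C b root∈ (λ x∈ → ∈root (C⊆ x∈))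

    -- Fewer than two roots never generate. A generating pair is therefore automatically minimal,
    -- and also of least size.
    shortest⇔coprime : ∀ k l → k ℕ.< l → l ℕ.≤ n ℕ.∸ 1 → IsShortestMinimalGeneratingSet ℚ̄ f (pair k l) ⇔ gcd (l ℕ.∸ k) n ≡ 1
    shortest⇔coprime k l k<l l≤n-1 = mk⇔ (λ { ((gen , _) , _) → Equivalence.to equivalence gen }) λ e →
      (Equivalence.from equivalence e , minimal _ omit) , 2 , pair-cardinality k<l (s≤s l≤n-1) , minimal-cardinality≥2
      where
      equivalence : IsGeneratingSet ℚ̄ f (pair k l) ⇔ gcd (l ℕ.∸ k) n ≡ 1
      equivalence = pair-generating⇔ (pair k l) (ℕ.<⇒≤ k<l) (id , id)
      omit : ∀ i (A : SubsetOf ℚ̄) → (∀ {y} → y ∈ member A → ∃[ j ] j ≢ i × y ≈ (root (+ k) Vector.∷ root (+ l) Vector.∷ Vector.[]) j) →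
        ¬ (Adjoin ℚ̄ (member A) ≐ SplittingField ℚ̄ f)
      omit Fin.zero A A⊆ = singleton-not-generating {S = member A} (+ l) λ y∈ → only (A⊆ y∈)
        where
        only : ∀ {y} → ∃[ j ] j ≢ Fin.zero × y ≈ (root (+ k) Vector.∷ root (+ l) Vector.∷ Vector.[]) j → y ≈ root (+ l)
        only (Fin.zero , j≢ , _)           = contradiction refl j≢
        only (Fin.suc Fin.zero , _ , y≈)   = y≈
      omit (Fin.suc Fin.zero) A A⊆ = singleton-not-generating {S = member A} (+ k) λ y∈ → only (A⊆ y∈)
        where
        only : ∀ {y} → ∃[ j ] j ≢ Fin.suc Fin.zero × y ≈ (root (+ k) Vector.∷ root (+ l) Vector.∷ Vector.[]) j → y ≈ root (+ k)
        only (Fin.zero , _ , y≈)           = y≈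
        only (Fin.suc Fin.zero , j≢ , _)   = contradiction refl j≢

    open CoprimePairs 1<n

    pair-of : ℕ × ℕ → SubsetOf ℚ̄
    pair-of (d , k) = pair k (k ℕ.+ d)

    pair-injective : ∀ {k l k′ l′} → k ℕ.< l → l ℕ.< n → k′ ℕ.< l′ → l′ ℕ.< n →
      member (pair k l) ⊆ member (pair k′ l′) → k ≡ k′ × l ≡ l′
    pair-injective {k} {l} {k′} {l′} k<l l<n k′<l′ l′<n ⊆′ = go (one k<n (⊆′ (Fin.zero , ≈-refl))) (one l<n (⊆′ (Fin.suc Fin.zero , ≈-refl)))
      where
      k<n = ℕ.<-trans k<l l<n
      k′<n = ℕ.<-trans k′<l′ l′<n
      one : ∀ {i} → i ℕ.< n → ∃[ j ] root (+ i) ≈ (root (+ k′) Vector.∷ root (+ l′) Vector.∷ Vector.[]) j → i ≡ k′ ⊎ i ≡ l′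
      one i<n (Fin.zero , e)         = inj₁ (root-injective i<n k′<n e)
      one i<n (Fin.suc Fin.zero , e) = inj₂ (root-injective i<n l′<n e)
      go : k ≡ k′ ⊎ k ≡ l′ → l ≡ k′ ⊎ l ≡ l′ → k ≡ k′ × l ≡ l′
      go (inj₁ refl) (inj₁ refl) = contradiction k<l (ℕ.<-irrefl refl)
      go (inj₁ k≡)   (inj₂ l≡)   = k≡ , l≡
      go (inj₂ refl) (inj₁ refl) = contradiction k<l (ℕ.<-asym k′<l′)
      go (inj₂ refl) (inj₂ refl) = contradiction k<l (ℕ.<-irrefl refl)

    pair-swap : ∀ k l → _≐ₛ_ ℚ̄ (pair k l) (pair l k)
    pair-swap k l = swap k l , swap l k
      where
      swap : ∀ k l {x} → x ∈ member (pair k l) → x ∈ member (pair l k)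
      swap k l (Fin.zero , e)         = Fin.suc Fin.zero , e
      swap k l (Fin.suc Fin.zero , e) = Fin.zero , e

    shortest⇒pair : ∀ {C} → IsShortestMinimalGeneratingSet ℚ̄ f C → ∃[ i ] ∃[ j ] i ℕ.< n × j ℕ.< n × i ≢ j × _≐ₛ_ ℚ̄ C (pair i j)
    shortest⇒pair {C} (((C⊆ , gen) , min) , m , cardinality , shortest) = go m cardinality
        -- The competitor with roots a and aζ is always generating, as gcd(1, n) = 1; it bounds the
        -- size by 2 from above.
        (shortest (pair 0 1) 2 (proj₁ (Equivalence.from (shortest⇔coprime 0 1 (s≤s z≤n) (ℕ.≤-pred 1<n)) gcd[1,n]≡1)) (pair-cardinality (s≤s z≤n) 1<n))
        (minimal-cardinality≥2 C m ((C⊆ , gen) , min) cardinality)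
      where
      gcd[1,n]≡1 : gcd 1 n ≡ 1
      gcd[1,n]≡1 = ∣1⇒≡1 (gcd[m,n]∣m 1 n)
      go : ∀ m → HasCardinality _≈_ (member C) m → m ℕ.≤ 2 → 2 ℕ.≤ m → ∃[ i ] ∃[ j ] i ℕ.< n × j ℕ.< n × i ≢ j × _≐ₛ_ ℚ̄ C (pair i j)
      go (suc (suc zero)) (e , e∈ , e-injective , onto) _ _ =
        let i , i<n , e₀≈ = Root⇒root (C⊆ (e∈ Fin.zero))
            j , j<n , e₁≈ = Root⇒root (C⊆ (e∈ (Fin.suc Fin.zero)))
        in i , j , i<n , j<n
         , (λ i≡j → Fin.0≢1+n (e-injective (≈-trans e₀≈ (≈-trans (≈-reflexive (cong (λ u → root (+ u)) i≡j)) (≈-sym e₁≈)))))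
         , (λ x∈ → to i j e₀≈ e₁≈ (onto x∈))
         , from i j e₀≈ e₁≈
        where
        to : ∀ i j {x} → e Fin.zero ≈ root (+ i) → e (Fin.suc Fin.zero) ≈ root (+ j) → ∃[ u ] x ≈ e u → x ∈ member (pair i j)
        to i j e₀≈ e₁≈ (Fin.zero , x≈)         = Fin.zero , ≈-trans x≈ e₀≈
        to i j e₀≈ e₁≈ (Fin.suc Fin.zero , x≈) = Fin.suc Fin.zero , ≈-trans x≈ e₁≈
        from : ∀ i j {x} → e Fin.zero ≈ root (+ i) → e (Fin.suc Fin.zero) ≈ root (+ j) → x ∈ member (pair i j) → x ∈ member C
        from i j e₀≈ e₁≈ (Fin.zero , x≈)         = respects C (≈-sym (≈-trans x≈ (≈-sym e₀≈))) (e∈ Fin.zero)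
        from i j e₀≈ e₁≈ (Fin.suc Fin.zero , x≈) = respects C (≈-sym (≈-trans x≈ (≈-sym e₁≈))) (e∈ (Fin.suc Fin.zero))
      go zero             _ _              ()
      go (suc zero)       _ _              (s≤s ())
      go (suc (suc (suc _))) _ (s≤s (s≤s ())) _

    -- Each shortest set is a pair of roots and becomes unique once its exponents are ordered, which
    -- matches it with exactly one entry of `pairs`. Doubling N avoids dividing by 2.
    shortest-count : ∃[ N ] 2 ℕ.* N ≡ n ℕ.* φ n × HasCardinality (_≐ₛ_ ℚ̄) (IsShortestMinimalGeneratingSet ℚ̄ f) N
    shortest-count = length pairs , pairs-count , (λ u → pair-of (lookup pairs u)) , (λ u → shortest (∈-lookup u)) , (λ {u} {v} → injective u v) , (λ {C} → onto {C})
      where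
      shortest : ∀ {dk} → dk ∈ₗ pairs → IsShortestMinimalGeneratingSet ℚ̄ f (pair-of dk)
      shortest {d , k} dk∈ = let (0<d , _ , e) , k+d<n = ∈pairs⁻ dk∈ in
        Equivalence.from (shortest⇔coprime k (k ℕ.+ d) (ℕ.m<m+n k 0<d) (ℕ.≤-pred k+d<n)) (≡.trans (cong (λ u → gcd u n) (ℕ.m+n∸m≡n k d)) e)
      injective : ∀ u v → _≐ₛ_ ℚ̄ (pair-of (lookup pairs u)) (pair-of (lookup pairs v)) → u ≡ v
      injective u v (⊆′ , _) = Unique⇒lookup-injective pairs-unique (same (∈-lookup u) (∈-lookup v) ⊆′)
        where
        same : ∀ {x y} → x ∈ₗ pairs → y ∈ₗ pairs → member (pair-of x) ⊆ member (pair-of y) → x ≡ y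
        same {d , k} {d′ , k′} x∈ y∈ ⊆′ =
          let (0<d , _) , k+d<n = ∈pairs⁻ x∈
              (0<d′ , _) , k′+d′<n = ∈pairs⁻ y∈
              k≡k′ , k+d≡k′+d′ = pair-injective (ℕ.m<m+n k 0<d) k+d<n (ℕ.m<m+n k′ 0<d′) k′+d′<n ⊆′
          in conclude k≡k′ k+d≡k′+d′
          where
          conclude : k ≡ k′ → k ℕ.+ d ≡ k′ ℕ.+ d′ → (d , k) ≡ (d′ , k′)
          conclude refl e = cong (_, k) (ℕ.+-cancelˡ-≡ k d d′ e)
      ordered : ∀ {C i j} → IsShortestMinimalGeneratingSet ℚ̄ f C → j ℕ.< n → i ℕ.< j → _≐ₛ_ ℚ̄ C (pair i j) →
        ∃[ u ] _≐ₛ_ ℚ̄ C (pair-of (lookup pairs u))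
      ordered {C} {i} {j} ((gen , _) , _) j<n i<j C≐ = Any.index ∈pairs , subst (λ x → _≐ₛ_ ℚ̄ C (pair-of x)) (lookup-index ∈pairs)
        (subst (λ l → _≐ₛ_ ℚ̄ C (pair i l)) (≡.sym i+[j∸i]≡j) C≐)
        where
        i+[j∸i]≡j : i ℕ.+ (j ℕ.∸ i) ≡ j
        i+[j∸i]≡j = ℕ.m+[n∸m]≡n (ℕ.<⇒≤ i<j)
        ∈pairs : (j ℕ.∸ i , i) ∈ₗ pairs
        ∈pairs = ∈pairs⁺ (ℕ.m<n⇒0<n∸m i<j) (subst (ℕ._< n) (≡.sym i+[j∸i]≡j) j<n)
          (Equivalence.to (pair-generating⇔ C (ℕ.<⇒≤ i<j) C≐) gen)
      onto : ∀ {C} → IsShortestMinimalGeneratingSet ℚ̄ f C → ∃[ u ] _≐ₛ_ ℚ̄ C (pair-of (lookup pairs u))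
      onto {C} C-shortest = let i , j , i<n , j<n , i≢j , C≐ = shortest⇒pair {C} C-shortest in go i<n j<n i≢j C≐ (ℕ.<-cmp i j)
        where
        go : ∀ {i j} → i ℕ.< n → j ℕ.< n → i ≢ j → _≐ₛ_ ℚ̄ C (pair i j) → Tri (i ℕ.< j) (i ≡ j) (j ℕ.< i) →
          ∃[ u ] _≐ₛ_ ℚ̄ C (pair-of (lookup pairs u))
        go i<n j<n i≢j C≐ (tri< i<j _ _) = ordered {C} C-shortest j<n i<j C≐
        go i<n j<n i≢j C≐ (tri≈ _ i≡j _) = contradiction i≡j i≢j
        go {i} {j} i<n j<n i≢j (C⊆ , ⊆C) (tri> _ _ j<i) = ordered {C} C-shortest i<n j<i
          ((λ x∈ → proj₁ (pair-swap i j) (C⊆ x∈)) , (λ x∈ → ⊆C (proj₂ (pair-swap i j) x∈)))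

    -- Omitting the i-th root leaves exponents congruent modulo some prime rᵢ ∣ n;
    -- rᵢ = rⱼ for i ≠ j would, as m > 2, make all exponents congruent modulo rᵢ.
    minimal⇒≤ω : ∀ m → 2 ℕ.< m → (b : Vector ℤ m) → Injective _≡_ _≈_ (λ i → root (b i)) →
      IsMinimalGeneratingSet ℚ̄ f (range ℚ̄ (λ i → root (b i))) → m ℕ.≤ ω n
    minimal⇒≤ω (suc (suc zero)) (s≤s (s≤s ()))
    minimal⇒≤ω (suc zero) (s≤s ())
    minimal⇒≤ω (suc (suc (suc m))) _ b b-injective ((C⊆ , gen) , min) = injection⇒≤length r r-injective
        (λ i → prime∣n⇒∈ {n} (λ ()) (r-prime i) (r∣n i))
      where
      M = suc (suc (suc m))
      -- A gcd of 1 after an omission would make the remaining roots generate. Distinctness of the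
      -- roots guarantees that they form a proper subset.
      omitted≢1 : ∀ i → gcdDifferences n (removeAt b i) ≢ 1ℤ
      omitted≢1 i e = min A (A⊆C , λ C⊆A → not-member (C⊆A (i , ≈-refl))) (proj₂ (Equivalence.from (generating⇔gcd≡1 (removeAt b i)) e))
        where
        A = range ℚ̄ (λ j → root (removeAt b i j))
        A⊆C : member A ⊆ member (range ℚ̄ (λ i → root (b i)))
        A⊆C (j , x≈) = Fin.punchIn i j , x≈
        not-member : ¬ (root (b i) ∈ member A)
        not-member (j , e) = Fin.punchInᵢ≢i i j (≡.sym (b-injective e))
      chosen : ∀ i → ∃[ r ] Prime r × r ∣ n × (∀ j → + r ∣ℤ removeAt b i j ℤ.- removeAt b i Fin.zero)
      chosen i = gcdDifferences≢1⇒prime {n} (λ ()) (removeAt b i) (omitted≢1 i)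
      r : Fin M → ℕ
      r i = proj₁ (chosen i)
      r-prime : ∀ i → Prime (r i)
      r-prime i = proj₁ (proj₂ (chosen i))
      r∣n : ∀ i → r i ∣ n
      r∣n i = proj₁ (proj₂ (proj₂ (chosen i)))
      r∣-base : ∀ i {j} → i ≢ j → + r i ∣ℤ b j ℤ.- removeAt b i Fin.zero
      r∣-base i {j} i≢j = subst (λ u → + r i ∣ℤ b u ℤ.- removeAt b i Fin.zero) (Fin.punchIn-punchOut i≢j) (proj₂ (proj₂ (proj₂ (chosen i))) (Fin.punchOut i≢j))
      difference : ∀ {r} x y z → + r ∣ℤ x ℤ.- z → + r ∣ℤ y ℤ.- z → + r ∣ℤ x ℤ.- y
      difference {r} x y z r∣x r∣y = subst (+ r ∣ℤ_) (telescope x y z) (ℤ∣.∣m∣n⇒∣m-n r∣x r∣y)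
        where
        telescope : ∀ x y z → (x ℤ.- z) ℤ.- (y ℤ.- z) ≡ x ℤ.- y
        telescope = ℤSolver.solve-∀
      r∣ : ∀ i {j l} → i ≢ j → i ≢ l → + r i ∣ℤ b j ℤ.- b l
      r∣ i {j} {l} i≢j i≢l = difference (b j) (b l) (removeAt b i Fin.zero) (r∣-base i i≢j) (r∣-base i i≢l)
      third : ∀ (i j : Fin M) → ∃[ l ] i ≢ l × j ≢ l
      third Fin.zero                Fin.zero                = Fin.suc Fin.zero , (λ ()) , (λ ())
      third Fin.zero                (Fin.suc Fin.zero)      = Fin.suc (Fin.suc Fin.zero) , (λ ()) , (λ ())
      third Fin.zero                (Fin.suc (Fin.suc _))   = Fin.suc Fin.zero , (λ ()) , (λ ())
      third (Fin.suc Fin.zero)      Fin.zero                = Fin.suc (Fin.suc Fin.zero) , (λ ()) , (λ ())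
      third (Fin.suc (Fin.suc _))   Fin.zero                = Fin.suc Fin.zero , (λ ()) , (λ ())
      third (Fin.suc _)             (Fin.suc _)             = Fin.zero , (λ ()) , (λ ())
      r-injective : ∀ {i j} → r i ≡ r j → i ≡ j
      r-injective {i} {j} rᵢ≡rⱼ = decidable-stable (i Fin.≟ j) λ i≢j →
        let l , i≢l , j≢l = third i j in
        not-generating {S = member (range ℚ̄ (λ i → root (b i)))} (r-prime i) (r∣n i) (b l)
          (λ { (u , x≈) → b u , congruent i≢l j≢l i≢j u (i Fin.≟ u) , x≈ }) gen
        where
        -- The prime rᵢ controls every index except i, and rⱼ every index except j. For u = i the
        -- congruence is borrowed from rⱼ, the same prime; the index l differs from both.
        congruent : ∀ {l} → i ≢ l → j ≢ l → i ≢ j → ∀ u → Dec (i ≡ u) → + r i ∣ℤ b u ℤ.- b l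
        congruent i≢l j≢l i≢j u (yes refl) = subst (λ r → + r ∣ℤ _) (≡.sym rᵢ≡rⱼ) (r∣ j (i≢j ∘ ≡.sym) j≢l)
        congruent i≢l j≢l i≢j u (no i≢u)   = r∣ i i≢u i≢l

    -- The exponent n / dᵢ is the product of the other dⱼ. A prime r ∣ dᵢ thus divides every
    -- exponent except the i-th: omitting that root leaves all exponents divisible by r, while with
    -- all roots present they are not all congruent modulo r.
    pairwise-coprime-minimal : ∀ m → 2 ℕ.≤ m → (d : Vector ℕ m) → (d>1 : ∀ i → 1 ℕ.< d i) →
      (∀ i j → i ≢ j → Coprime (d i) (d j)) → n ≡ ∏ d →
      IsMinimalGeneratingSet ℚ̄ f (range ℚ̄ (λ i → root (+ (ℕ._/_ n (d i) {{ℕ.>-nonZero (ℕ.<⇒≤ (d>1 i))}}))))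
    pairwise-coprime-minimal (suc zero) (s≤s ())
    pairwise-coprime-minimal (suc (suc m)) _ d d>1 d-coprime n≡∏d = Equivalence.from (generating⇔gcd≡1 b) gcd≡1ℤ , minimal (λ i → root (b i)) omit
      where
      b : Vector ℤ (suc (suc m))
      b i = + (ℕ._/_ n (d i) {{ℕ.>-nonZero (ℕ.<⇒≤ (d>1 i))}})
      co : Fin (suc (suc m)) → ℕ
      co i = ∏ (removeAt d i)
      n≡ : ∀ i → n ≡ co i ℕ.* d i
      n≡ i = ≡.trans n≡∏d (≡.trans (∏-remove d i) (ℕ.*-comm (d i) (co i)))
      b≡ : ∀ i → b i ≡ + co i
      b≡ i = cong +_ (≡.trans (cong (λ u → ℕ._/_ u (d i) {{ℕ.>-nonZero (ℕ.<⇒≤ (d>1 i))}}) (n≡ i)) (m*n/n≡m (co i) (d i) {{ℕ.>-nonZero (ℕ.<⇒≤ (d>1 i))}}))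
      not-both : ∀ {r} → Prime r → ∀ {i j} → i ≢ j → r ∣ d i → r ∤ d j
      not-both r-prime {i} {j} i≢j r∣dᵢ r∣dⱼ = ℕ.<⇒≢ (1<prime r-prime) (≡.sym (d-coprime i j i≢j (r∣dᵢ , r∣dⱼ)))
      ∣co : ∀ {r} → Prime r → ∀ {i j} → i ≢ j → r ∣ d i → r ∣ co j
      ∣co {r} r-prime {i} {j} i≢j r∣dᵢ = [ id , (λ r∣dⱼ → contradiction r∣dⱼ (not-both r-prime i≢j r∣dᵢ)) ]′
        (euclidsLemma (co j) (d j) r-prime (subst (r ∣_) (n≡ j) (∣-trans r∣dᵢ (subst (d i ∣_) (≡.sym (n≡ i)) (n∣m*n (co i))))))
      ∤co : ∀ {r} → Prime r → ∀ {i} → r ∣ d i → r ∤ co i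
      ∤co r-prime {i} r∣dᵢ r∣co = let j , r∣ = ∣∏⇒∣some r-prime (removeAt d i) r∣co in
        not-both r-prime (Fin.punchInᵢ≢i i j ∘ ≡.sym) r∣dᵢ r∣
      gcd≡1ℤ : gcdDifferences n b ≡ 1ℤ
      gcd≡1ℤ = decidable-stable (gcdDifferences n b ℤ.≟ 1ℤ) λ g≢1 →
        let r , r-prime , r∣n , r∣ = gcdDifferences≢1⇒prime {n} (λ ()) b g≢1
            i , r∣dᵢ = ∣∏⇒∣some r-prime d (subst (r ∣_) n≡∏d r∣n)
        in ∤co r-prime r∣dᵢ (all-divisible r-prime r∣dᵢ r∣)
        where
        from-base : ∀ {r x y} → + r ∣ℤ x ℤ.- y → + r ∣ℤ y → + r ∣ℤ x
        from-base {r} {x} {y} r∣x-y r∣y = subst (+ r ∣ℤ_) (i+[j-i]≡j y x) (ℤ∣.∣m∣n⇒∣m+n r∣y r∣x-y)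
        to-base : ∀ {r x y} → + r ∣ℤ x ℤ.- y → + r ∣ℤ x → + r ∣ℤ y
        to-base {r} {x} {y} r∣x-y r∣x = subst (+ r ∣ℤ_) (telescope x y) (ℤ∣.∣m∣n⇒∣m-n r∣x r∣x-y)
          where
          telescope : ∀ x y → x ℤ.- (x ℤ.- y) ≡ y
          telescope = ℤSolver.solve-∀
        all-divisible : ∀ {r} → Prime r → ∀ {i} → r ∣ d i → (∀ j → + r ∣ℤ b j ℤ.- b Fin.zero) → r ∣ co i
        all-divisible {r} r-prime {i} r∣dᵢ r∣ = ∣⇒∣ᵤ (subst (+ r ∣ℤ_) (b≡ i) (from-base (r∣ i) base))
          where
          other : ∃[ j ] i ≢ j
          other = distinct-from i
            where
            distinct-from : ∀ (i : Fin (suc (suc m))) → ∃[ j ] i ≢ j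
            distinct-from Fin.zero    = Fin.suc Fin.zero , λ ()
            distinct-from (Fin.suc _) = Fin.zero , λ ()
          base : + r ∣ℤ b Fin.zero
          base = let j , i≢j = other in to-base (r∣ j) (subst (+ r ∣ℤ_) (≡.sym (b≡ j)) (∣ᵤ⇒∣ (∣co r-prime i≢j r∣dᵢ)))
      omit : ∀ i (A : SubsetOf ℚ̄) → (∀ {y} → y ∈ member A → ∃[ j ] j ≢ i × y ≈ root (b j)) → ¬ (Adjoin ℚ̄ (member A) ≐ SplittingField ℚ̄ f)
      omit i A A⊆ = let r , r-prime , r∣dᵢ = prime-divisor {d i} (λ e → ℕ.<⇒≱ (d>1 i) (subst (ℕ._≤ 1) (≡.sym e) z≤n)) (λ e → ℕ.<⇒≢ (d>1 i) (≡.sym e)) in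
        -- The comparison exponent is 0, that is, the root a, which need not belong to the set.
        not-generating {S = member A} r-prime (∣-trans r∣dᵢ (subst (d i ∣_) (≡.sym (n≡ i)) (n∣m*n (co i)))) (+ 0)
          λ y∈ → let j , j≢i , y≈ = A⊆ y∈ in b j ,
            subst (+ r ∣ℤ_) (≡.sym (≡.trans (ℤ.+-identityʳ (b j)) (b≡ j))) (∣ᵤ⇒∣ (∣co r-prime (j≢i ∘ ≡.sym) r∣dᵢ)) , y≈

open import Data.Fin.Base using (Fin)
open import Data.Integer.Base using (ℤ; +_; 1ℤ)
open import Data.Nat.Base using (ℕ; suc; _*_; _∸_; _/_; _≤_; _<_; >-nonZero)
open import Data.Nat.Coprimality using (Coprime)
open import Data.Nat.Divisibility using (_∣_)
open import Data.Nat.GCD using (gcd)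
open import Data.Nat.Properties using (<⇒≤)
open import Data.Product.Base using (_×_; ∃-syntax)
open import Data.Rational.Base using (ℚ; 0ℚ) renaming (_<_ to _<ℚ_)
open import Data.Vec.Functional using (Vector; []; _∷_)
open import Function.Bundles using (_⇔_)
open import Function.Definitions using (Injective)
open import Relation.Binary.PropositionalEquality.Core using (_≡_; _≢_)
open import Relation.Nullary using (¬_)

lemma2p12 :
  ∀ {c ℓ₁ ℓ₂ p} (ℚ̄ : AlgebraicClosureOfℚ c ℓ₁ ℓ₂ p) →
  let module K = AlgebraicClosureOfℚ ℚ̄ in
  (n : ℕ) → 2 < n → ¬ (2 ∣ n) →
  (ζ : K.Carrier) → IsPrimitiveRootOfUnity ℚ̄ n ζ →
  (q : ℚ) → 0ℚ <ℚ q →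
  let f = binomial n q in
  ℚ[X].Irreducible f →
  (a : K.Carrier) → K.Positive a → Root ℚ̄ f a →
  let root : ℤ → K.Carrier
      root b = a K.* power ℚ̄ ζ b
  in
  -- (1)
  (∀ {m} (b : Vector ℤ (suc m)) →
     IsGeneratingSet ℚ̄ f (range ℚ̄ (λ i → root (b i)))
       ⇔ gcdDifferences n b ≡ 1ℤ)
  ×
  -- (2)
  (∀ k l → k < l → l ≤ n ∸ 1 →
     IsShortestMinimalGeneratingSet ℚ̄ f
       (range ℚ̄ (root (+ k) ∷ root (+ l) ∷ []))
       ⇔ gcd (l ∸ k) n ≡ 1)
  ×
  (∃[ N ] 2 * N ≡ n * φ n ×
     HasCardinality (_≐ₛ_ ℚ̄) (IsShortestMinimalGeneratingSet ℚ̄ f) N)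
  ×
  -- (3)
  (∀ m → 2 < m → (b : Vector ℤ m) →
     Injective _≡_ K._≈_ (λ i → root (b i)) →
     IsMinimalGeneratingSet ℚ̄ f (range ℚ̄ (λ i → root (b i))) →
     m ≤ ω n)
  ×
  -- (4)
  (∀ m → 2 ≤ m → (d : Vector ℕ m) → (d>1 : ∀ i → 1 < d i) →
     (∀ i j → i ≢ j → Coprime (d i) (d j)) →
     n ≡ ∏ d →
     IsMinimalGeneratingSet ℚ̄ f
       (range ℚ̄ (λ i →
         root (+ (_/_ n (d i) {{>-nonZero (<⇒≤ (d>1 i))}})))))
lemma2p12 ℚ̄ n 2<n odd ζ ζ-primitive q _ irreducible a a>0 a-root with Arithmetic.odd-decomposition n odd
... | k , refl =
  (λ {m} → generating⇔gcd≡1 ℚ̄ {k} (0<k {k} 2<n) ζ-primitive irreducible a>0 a-root {m}) ,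
  shortest⇔coprime ℚ̄ {k} (0<k {k} 2<n) ζ-primitive irreducible a>0 a-root ,
  shortest-count ℚ̄ {k} (0<k {k} 2<n) ζ-primitive irreducible a>0 a-root ,
  minimal⇒≤ω ℚ̄ {k} (0<k {k} 2<n) ζ-primitive irreducible a>0 a-root ,
  pairwise-coprime-minimal ℚ̄ {k} (0<k {k} 2<n) ζ-primitive irreducible a>0 a-root
  where
  open RadicalExtensions.Generation using (generating⇔gcd≡1; shortest⇔coprime; shortest-count; minimal⇒≤ω; pairwise-coprime-minimal)
  0<k : ∀ {k} → 2 < suc (2 * k) → 0 < k
  0<k {zero}  (s≤s ())
  0<k {suc k} _ = s≤s z≤n
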